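{- There is a Monte Carlo algorithm that, given a directed unweighted graph on $n$ nodes and $m$ edges with Source Radius $R$, runs in time $O(m\sqrt{n}\log^2 n)$ and outputs, with high probability, a value $R^*$ such that $R\le R^*\le 2R$.
   Context: The Source Radius of a directed graph $G=(V,E)$ is $R=\min_{x\in V}\max_{v\in V} d(x,v)$, where $d(x,v)$ is the length of a shortest directed path from $x$ to $v$ ($\infty$ if none exists). Running times are in the standard word-RAM model with $O(\log n)$-bit words. -}

module Defs where

open import Data.Bool.Base using (Bool; true; false; if_then_else_; _∧_; _∨_; _xor_)
open import Data.Fin.Base using (Fin; toℕ)
open import Data.List.Base
  using (List; []; _∷_; head; drop; concatMap; length; filter; allFin; cartesianProductWith)
open import Data.Maybe.Base using (Maybe; just; nothing; fromMaybe)
import Data.Maybe.Base as Maybe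
open import Data.Maybe.Relation.Unary.Any using (Any)
import Data.Maybe.Relation.Unary.Any as Any
open import Data.Nat.Base
open import Data.Nat.DivMod using (_mod_)
import Data.Nat.Properties as ℕₚ
open import Data.Product.Base using (_×_; _,_; ∃-syntax)
open import Data.Vec.Base using (Vec; toList)
import Data.Vec.Base as Vec
open import Data.Vec.Membership.Propositional using (_∈_)
open import Data.Vec.Relation.Unary.Unique.Propositional using (Unique)
open import Relation.Binary.Construct.Add.Supremum.NonStrict _≤_ using (_≤⁺_; ≤⁺-dec)
open import Relation.Nullary.Construct.Add.Supremum using (_⁺; ⊤⁺; [_])
open import Relation.Nullary.Decidable.Core using (_×-dec_)
open import Relation.Nullary.Negation.Core using (¬_)
open import Relation.Unary using (Decidable)
open import Relation.Unary.Properties using (∁?)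

private
  variable
    n m w T k : ℕ

-- A graph comes with an enumeration of its edge set; this enumeration,
-- in whatever order it lists the edges, is what an algorithm receives.
-- Self-loops are allowed, parallel edges are not.
record Digraph (n m : ℕ) : Set where
  field
    edges  : Vec (Fin n × Fin n) m
    unique : Unique edges

open Digraph public

data Path (G : Digraph n m) : Fin n → Fin n → ℕ → Set where
  here : ∀ {x} → Path G x x 0
  step : ∀ {x y z} → (x , y) ∈ edges G → Path G y z k → Path G x z (suc k)

-- ℕ ⁺ is ℕ with a top element ⊤⁺, playing the role of ∞.
data IsDistance (G : Digraph n m) (x v : Fin n) : ℕ ⁺ → Set where
  finite   : Path G x v k → (∀ {j} → Path G x v j → k ≤ j) → IsDistance G x v [ k ]
  infinite : (∀ {j} → ¬ Path G x v j) → IsDistance G x v ⊤⁺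

IsEccentricity : Digraph n m → Fin n → ℕ ⁺ → Set
IsEccentricity G x e =
  (∃[ v ] IsDistance G x v e) × (∀ v d → IsDistance G x v d → d ≤⁺ e)

IsSourceRadius : Digraph n m → ℕ ⁺ → Set
IsSourceRadius G R =
  (∃[ x ] IsEccentricity G x R) × (∀ x e → IsEccentricity G x e → R ≤⁺ e)

⌊√_⌋ : ℕ → ℕ
⌊√ zero ⌋  = 0
⌊√ suc n ⌋ = next ⌊√ n ⌋
  where
  next : ℕ → ℕ
  next r = if suc r * suc r ≤ᵇ suc n then suc r else r

-- A word RAM with w-bit words and 2 ^ w addressable memory cells.

Word : ℕ → Set
Word w = Fin (2 ^ w)

word : ∀ w → ℕ → Word w
word w a = _mod_ a (2 ^ w) {{ℕₚ.m^n≢0 2 w}}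

fromBool : Bool → ℕ
fromBool b = if b then 1 else 0

bitwise : (Bool → Bool → Bool) → ℕ → ℕ → ℕ → ℕ
bitwise f zero    a b = 0
bitwise f (suc w) a b =
  fromBool (f (odd a) (odd b)) + 2 * bitwise f w ⌊ a /2⌋ ⌊ b /2⌋
  where
  odd : ℕ → Bool
  odd a = a % 2 ≡ᵇ 1

data Op : Set where
  add sub mul quot rem and or xor shl shr lt eq : Op

-- Results are reduced modulo 2 ^ w; division by zero yields zero.
⟦_⟧ : Op → ∀ w → ℕ → ℕ → ℕ
⟦ add  ⟧ w a b       = a + b
⟦ sub  ⟧ w a b       = (a + 2 ^ w) ∸ b
⟦ mul  ⟧ w a b       = a * b
⟦ quot ⟧ w a zero    = 0
⟦ quot ⟧ w a (suc b) = a / suc b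
⟦ rem  ⟧ w a zero    = 0
⟦ rem  ⟧ w a (suc b) = a % suc b
⟦ and  ⟧ w a b       = bitwise _∧_ w a b
⟦ or   ⟧ w a b       = bitwise _∨_ w a b
⟦ xor  ⟧ w a b       = bitwise _xor_ w a b
⟦ shl  ⟧ w a b       = a * 2 ^ b
⟦ shr  ⟧ w a b       = _/_ a (2 ^ b) {{ℕₚ.m^n≢0 2 b}}
⟦ lt   ⟧ w a b       = fromBool (a <ᵇ b)
⟦ eq   ⟧ w a b       = fromBool (a ≡ᵇ b)

Reg : Set
Reg = ℕ

data Instr : Set where
  const : Reg → ℕ → Instr
  op    : Op → Reg → Reg → Reg → Instr
  load  : Reg → Reg → Instr          -- load r a:   r := memory[a]
  store : Reg → Reg → Instr          -- store a r:  memory[a] := r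
  rand  : Reg → Instr
  jump  : ℕ → Instr
  jzero : Reg → ℕ → Instr

-- A program is finite, so it names only a constant number of registers.
Program : Set
Program = List Instr

record State (w : ℕ) : Set where
  constructor state
  field
    pc     : ℕ
    regs   : Reg → Word w
    memory : Word w → Word w

open State public

_[_≔ᵣ_] : {A : Set} → (Reg → A) → Reg → A → Reg → A
(ρ [ r ≔ᵣ x ]) s = if r ≡ᵇ s then x else ρ s

_[_≔ₘ_] : {A : Set} → (Fin k → A) → Fin k → A → Fin k → A
(μ [ a ≔ₘ x ]) b = if toℕ a ≡ᵇ toℕ b then x else μ b

-- Every step is offered a fresh random word, which only rand looks at.
exec : Instr → Word w → State w → State w
exec {w} (const r c) ω (state p ρ μ) = state (suc p) (ρ [ r ≔ᵣ word w c ]) μ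
exec {w} (op o r a b) ω (state p ρ μ) =
  state (suc p) (ρ [ r ≔ᵣ word w (⟦ o ⟧ w (toℕ (ρ a)) (toℕ (ρ b))) ]) μ
exec (load r a)  ω (state p ρ μ) = state (suc p) (ρ [ r ≔ᵣ μ (ρ a) ]) μ
exec (store a r) ω (state p ρ μ) = state (suc p) ρ (μ [ ρ a ≔ₘ ρ r ])
exec (rand r)    ω (state p ρ μ) = state (suc p) (ρ [ r ≔ᵣ ω ]) μ
exec (jump l)    ω (state p ρ μ) = state l ρ μ
exec (jzero r l) ω (state p ρ μ) =
  state (if toℕ (ρ r) ≡ᵇ 0 then l else suc p) ρ μ

-- run P σ ωs is the content of register 0 on halting, if P halts within T
-- steps, and nothing otherwise.  A program halts when control leaves it.
run : Program → State w → Vec (Word w) T → Maybe (Word w)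
run P σ ωs with head (drop (pc σ) P)
run P σ ωs              | nothing = just (regs σ 0)
run P σ Vec.[]          | just i  = nothing
run P σ (ω Vec.∷ ωs)    | just i  = run P (exec i ω σ) ωs

-- n, m, then the two endpoints of each edge in turn.
encode : Digraph n m → List ℕ
encode {n} {m} G =
  n ∷ m ∷ concatMap (λ (u , v) → toℕ u ∷ toℕ v ∷ []) (toList (edges G))

initial : ∀ w → Digraph n m → State w
initial w G = state 0
  (λ _ → word w 0)
  (λ a → word w (fromMaybe 0 (head (drop (toℕ a) (encode G)))))

-- Output words encode ℕ ⁺: 0 stands for ∞, and k + 1 for k.
decode : ℕ → ℕ ⁺
decode zero    = ⊤⁺
decode (suc k) = [ k ]

2·_ : ℕ ⁺ → ℕ ⁺
2· R = Maybe.map (2 *_) R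

2-Approximates : ℕ ⁺ → ℕ ⁺ → Set
2-Approximates R R* = (R ≤⁺ R*) × (R* ≤⁺ (2· R))

Outputs2Approx : Program → State w → ℕ ⁺ → Vec (Word w) T → Set
Outputs2Approx P σ R ωs = Any (λ x → 2-Approximates R (decode (toℕ x))) (run P σ ωs)

outputs2Approx? : ∀ (P : Program) (σ : State w) (R : ℕ ⁺) →
  Decidable (Outputs2Approx {T = T} P σ R)
outputs2Approx? P σ R ωs = Any.dec
  (λ x → ≤⁺-dec _≤?_ R (decode (toℕ x)) ×-dec ≤⁺-dec _≤?_ (decode (toℕ x)) (2· R)) (run P σ ωs)
  where open ℕₚ using (_≤?_)

allTapes : ∀ w T → List (Vec (Word w) T)
allTapes w zero    = Vec.[] ∷ []
allTapes w (suc T) = cartesianProductWith Vec._∷_ (allFin (2 ^ w)) (allTapes w T)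

-- For N > 0: a uniformly random tape violates Q with probability at most 1 / N.
FailsWithProbability≤1/ : ℕ → {Q : Vec (Word w) T → Set} → Decidable Q → Set
FailsWithProbability≤1/ {w} {T} N Q? =
  N * length (filter (∁? Q?) (allTapes w T)) ≤ length (allTapes w T)

-- Let K = ⌊√ n⌋.  Sample O(K log n) vertices; with high probability the sample meets every in-ball
-- that has at least K vertices.  Breadth-first searches from all samples, in both directions, give
-- F y, the largest distance from y to a sample, and D v, the smallest distance from a sample to v.
-- Let y minimise F and let v maximise D; the centre shows that F y ≤ R.  If D v ≤ R, then y reaches
-- every vertex within 2 R through a sample.  Otherwise the vertices at distance less than D v to v
-- include the centre but no sample, so there are fewer than K of them, and searching from each of
-- them finds R.  The smallest eccentricity seen is thus at most 2 R, and never less than R.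
--
-- The algorithm is analysed on states of natural numbers, which the machine represents exactly
-- because values grow slowly with the number of steps.  For the probability, a run of an arbitrary
-- program is an adaptive sampler; a union bound over n² in-balls concludes.

{-# OPTIONS --safe #-}
module Submission where

open import Defs
open import Data.Bool.Base using (Bool; true; false; if_then_else_; not; _∧_; _∨_)
  renaming (T to IsTrue)
open import Data.Empty using (⊥; ⊥-elim)
open import Data.Fin.Base using (Fin; toℕ; fromℕ<; combine)
import Data.Fin.Properties as Finₚ
open import Data.List.Base using (List; []; _∷_; _++_; length; head; drop; map; concatMap; filter;
  tabulate; allFin; cartesianProductWith; _ʳ++_)
open import Data.List.Membership.Propositional using (_∈_)
import Data.List.Properties as Listₚ
open import Data.List.Relation.Unary.All as All using (All; []; _∷_)
open import Data.List.Relation.Unary.Any using (here; there)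
open import Data.Maybe using (Is-just)
open import Data.Maybe.Base using (just; nothing; fromMaybe)
open import Data.Maybe.Relation.Unary.Any using (Any; just)
open import Data.Nat.Base
open import Data.Nat.DivMod
open import Data.Nat.Induction using (<-rec)
open import Data.Nat.Logarithm
open import Data.Nat.Properties
open import Data.Nat.Tactic.RingSolver using (solve-∀)
open import Data.Product.Base using (_×_; _,_; ∃-syntax; ∃₂; proj₁; proj₂)
open import Data.Sum.Base using (_⊎_; inj₁; inj₂)
open import Data.Unit.Base using (⊤; tt)
open import Data.Vec.Base as Vec using (Vec; []; _∷_; toList)
open import Data.Vec.Membership.Propositional using () renaming (_∈_ to _∈ᵥ_)
import Data.Vec.Membership.Propositional.Properties as ∈ₚ
import Data.Vec.Relation.Unary.Any as VecAny
import Data.Vec.Relation.Unary.Any.Properties as VecAnyₚ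
import Data.Vec.Relation.Unary.Unique.Propositional.Properties as Uniqueₚ
open import Function.Base using (_∘_; case_of_)
open import Relation.Binary.Construct.Add.Supremum.NonStrict _≤_ using (_≤⁺_; _≤⊤⁺)
  renaming ([_] to ≤[_])
open import Relation.Binary.PropositionalEquality
  using (_≡_; _≢_; refl; sym; trans; cong; cong₂; subst; subst₂)
open import Relation.Nullary.Construct.Add.Supremum using (_⁺; ⊤⁺; [_])
open import Relation.Nullary.Decidable.Core using (Dec; yes; no; does; _×-dec_)
open import Relation.Nullary.Negation.Core using (¬_; contradiction)
import Relation.Unary as Unary
open import Relation.Unary.Properties using (∁?)

-- When `m` is much smaller than `n`, the time bound does not even allow one loop over the vertices.
-- This is harmless: a vertex that reaches all others forces `n ≤ m + 1`, so in the remaining case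
-- the radius is infinite and the answer is known at once. Once `n ≤ m + 1` is assumed, every cost
-- is linear in `m + 1`, and the `O(√n log n)` searches dominate.
--
-- Randomness enters through the list of sampled words alone. Whatever the samples are, the run
-- halts in time with ∞ or a genuine eccentricity, and the value is a 2-approximation unless the
-- sampled list avoids one particular large in-ball. The program logic therefore treats all samples
-- at once, and probability is reduced to counting the tapes whose sampled list avoids a fixed set.

infixl 6 _∔_
_∔_ : ∀ {A : Set} {x y z : A} → x ≡ y → y ≡ z → x ≡ z
_∔_ = trans

≔-hit : ∀ {A : Set} (f : ℕ → A) {x y} v → x ≡ y → (f [ x ≔ᵣ v ]) y ≡ v
≔-hit f {x} v refl with x ≡ᵇ x | ≡⇒≡ᵇ x x refl
... | true | _ = refl

≔-miss : ∀ {A : Set} (f : ℕ → A) {x y} v → x ≢ y → (f [ x ≔ᵣ v ]) y ≡ f y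
≔-miss f {x} {y} v x≢y with x ≡ᵇ y | ≡ᵇ⇒≡ x y
... | false | _ = refl
... | true  | e = contradiction (e tt) x≢y

-- Structured programs

data Atom : Set where
  clr : Reg → Atom
  set : Reg → ℕ → Atom
  mov : Reg → Reg → Atom
  inc : Reg → Atom
  mul : Reg → Reg → Reg → Atom
  ld  : Reg → ℕ → Reg → Atom
  st  : ℕ → Reg → Reg → Atom
  inp : Reg → Reg → Atom

infixr 5 _⨾_

data Cmd : Set where
  blk  : List Atom → Cmd
  samp : Reg → Reg → Cmd
  _⨾_  : Cmd → Cmd → Cmd
  ifl  : Reg → Reg → Cmd → Cmd → Cmd
  whl  : Reg → Reg → Cmd → Cmd

-- log lists the words sampled so far, latest first.
record St : Set where
  constructor mkSt
  field
    reg : Reg → ℕ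
    arr : ℕ → ℕ → ℕ
    log : List ℕ

open St

wrA : Atom → Reg → Bool
wrA (clr r)     x = r ≡ᵇ x
wrA (set r _)   x = r ≡ᵇ x
wrA (mov r _)   x = r ≡ᵇ x
wrA (inc r)     x = r ≡ᵇ x
wrA (mul r _ _) x = r ≡ᵇ x
wrA (ld r _ _)  x = r ≡ᵇ x
wrA (st _ _ _)  x = false
wrA (inp r _)   x = r ≡ᵇ x

waA : Atom → ℕ → Bool
waA (st j _ _) x = j ≡ᵇ x
waA _          x = false

wr : Cmd → Reg → Bool
wr (blk [])        x = false
wr (blk (a ∷ as))  x = wrA a x ∨ wr (blk as) x
wr (samp r _)      x = r ≡ᵇ x
wr (c ⨾ d)         x = wr c x ∨ wr d x
wr (ifl _ _ c d)   x = wr c x ∨ wr d x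
wr (whl _ _ c)     x = wr c x

wa : Cmd → ℕ → Bool
wa (blk [])        x = false
wa (blk (a ∷ as))  x = waA a x ∨ wa (blk as) x
wa (samp _ _)      x = false
wa (c ⨾ d)         x = wa c x ∨ wa d x
wa (ifl _ _ c d)   x = wa c x ∨ wa d x
wa (whl _ _ c)     x = wa c x

samples : Cmd → Bool
samples (blk _)       = false
samples (samp _ _)    = true
samples (c ⨾ d)       = samples c ∨ samples d
samples (ifl _ _ c d) = samples c ∨ samples d
samples (whl _ _ c)   = samples c

-- What a command may change is computed by boolean functions, so that for a concrete command each
-- premise here is closed by `refl`.
record Frame (c : Cmd) (s s' : St) : Set where
  constructor frame
  field
    regF : ∀ r → wr c r ≡ false → reg s' r ≡ reg s r
    arrF : ∀ j → wa c j ≡ false → ∀ i → arr s' j i ≡ arr s j i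
    logF : samples c ≡ false → log s' ≡ log s

open Frame

∨-false : ∀ b {c} → b ∨ c ≡ false → b ≡ false × c ≡ false
∨-false false p = refl , p

if-false : ∀ {A : Set} {b : Bool} {x y : A} → b ≡ false → (if b then x else y) ≡ y
if-false refl = refl

frame-refl : ∀ {c s} → Frame c s s
frame-refl = frame (λ _ _ → refl) (λ _ _ _ → refl) (λ _ → refl)

frame-trans : ∀ {c s s' s''} → Frame c s s' → Frame c s' s'' → Frame c s s''
frame-trans (frame f g h) (frame f' g' h') =
  frame (λ r p → trans (f' r p) (f r p)) (λ j p i → trans (g' j p i) (g j p i))
        (λ p → trans (h' p) (h p))

frame-⨾ : ∀ {c d s s' s''} → Frame c s s' → Frame d s' s'' → Frame (c ⨾ d) s s''
frame-⨾ {c} {d} (frame f g h) (frame f' g' h') = frame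
  (λ r p → let q , q' = ∨-false (wr c r) p in trans (f' r q') (f r q))
  (λ j p i → let q , q' = ∨-false (wa c j) p in trans (g' j q' i) (g j q i))
  (λ p → let q , q' = ∨-false (samples c) p in trans (h' q') (h q))

forC : Reg → Reg → Cmd → Cmd
forC i N c = blk (clr i ∷ []) ⨾ whl i N (c ⨾ blk (inc i ∷ []))

-- Cost semantics and rules for loops

module Semantics (input : ℕ → ℕ) (|input| bound : ℕ) where

  do1 : Atom → St → St
  do1 (clr r)     (mkSt ρ α l) = mkSt (ρ [ r ≔ᵣ 0 ]) α l
  do1 (set r c)   (mkSt ρ α l) = mkSt (ρ [ r ≔ᵣ c ]) α l
  do1 (mov r a)   (mkSt ρ α l) = mkSt (ρ [ r ≔ᵣ ρ a ]) α l
  do1 (inc r)     (mkSt ρ α l) = mkSt (ρ [ r ≔ᵣ suc (ρ r) ]) α l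
  do1 (mul r a b) (mkSt ρ α l) = mkSt (ρ [ r ≔ᵣ ρ a * ρ b ]) α l
  do1 (ld r j i)  (mkSt ρ α l) = mkSt (ρ [ r ≔ᵣ α j (ρ i) ]) α l
  do1 (st j i r)  (mkSt ρ α l) = mkSt ρ (α [ j ≔ᵣ α j [ ρ i ≔ᵣ ρ r ] ]) l
  do1 (inp r a)   (mkSt ρ α l) = mkSt (ρ [ r ≔ᵣ input (ρ a) ]) α l

  do* : List Atom → St → St
  do* []       s = s
  do* (a ∷ as) s = do* as (do1 a s)

  doSamp : Reg → Reg → ℕ → St → St
  doSamp r a ω (mkSt ρ α l) = mkSt (ρ [ r ≔ᵣ ⟦ rem ⟧ 0 ω (ρ a) ]) α (ω ∷ l)

  -- Conditions fall on the atoms that can produce a value far from those present: constants,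
  -- products and input cells. An increment raises the maximum by one only, and is paid for by
  -- elapsed time.
  Pre : List Atom → St → Set
  Pre []               s = ⊤
  Pre (set r c ∷ as)   s = (c ≤ bound) × Pre as (do1 (set r c) s)
  Pre (mul r a b ∷ as) s = (reg s a * reg s b ≤ bound) × Pre as (do1 (mul r a b) s)
  Pre (inp r a ∷ as)   s = (reg s a < |input|) × Pre as (do1 (inp r a) s)
  Pre (clr r ∷ as)     s = Pre as (do1 (clr r) s)
  Pre (mov r a ∷ as)   s = Pre as (do1 (mov r a) s)
  Pre (inc r ∷ as)     s = Pre as (do1 (inc r) s)
  Pre (ld r j i ∷ as)  s = Pre as (do1 (ld r j i) s)
  Pre (st j i r ∷ as)  s = Pre as (do1 (st j i r) s)

  -- Ex c κ s Q: from s, and whatever words are sampled, c ends within κ units of time in a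
  -- state satisfying Q.
  data Ex : Cmd → ℕ → St → (St → Set) → Set₁ where
    blkE  : ∀ {as s} {Q : St → Set} → Pre as s → Q (do* as s) → Ex (blk as) (length as) s Q
    sampE : ∀ {r a s} {Q : St → Set} → (∀ ω → Q (doSamp r a ω s)) → Ex (samp r a) 1 s Q
    seqE  : ∀ {c d κ κ' s} {Q Q' : St → Set} →
            Ex c κ s Q → (∀ s' → Q s' → Ex d κ' s' Q') → Ex (c ⨾ d) (κ + κ') s Q'
    iflE  : ∀ {a b c d κ s} {Q : St → Set} →
            (reg s a < reg s b → Ex c κ s Q) → (reg s b ≤ reg s a → Ex d κ s Q) →
            Ex (ifl a b c d) (2 + κ) s Q
    whlE  : ∀ {a b c κ κ' s} {Q Q' : St → Set} →
            (reg s a < reg s b → Ex c κ s Q) → (∀ s' → Q s' → Ex (whl a b c) κ' s' Q') →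
            (reg s b ≤ reg s a → Q' s) → Ex (whl a b c) (2 + κ + κ') s Q'
    subE  : ∀ {c κ κ' s} {Q : St → Set} → κ ≤ κ' → Ex c κ s Q → Ex c κ' s Q

  monoE : ∀ {c κ s} {Q Q' : St → Set} → Ex c κ s Q → (∀ s' → Q s' → Q' s') → Ex c κ s Q'
  monoE (blkE p q)   f = blkE p (f _ q)
  monoE (sampE q)    f = sampE (λ ω → f _ (q ω))
  monoE (seqE e k)   f = seqE e (λ s' q → monoE (k s' q) f)
  monoE (iflE x y)   f = iflE (λ p → monoE (x p) f) (λ p → monoE (y p) f)
  monoE (whlE x k y) f = whlE x (λ s' q → monoE (k s' q) f) (λ p → f _ (y p))
  monoE (subE p e)   f = subE p (monoE e f)

  frame-do1 : ∀ a s → Frame (blk (a ∷ [])) s (do1 a s)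
  frame-do1 (clr r)     s = frame (λ x p → if-false (∨-false (r ≡ᵇ x) p .proj₁)) (λ _ _ _ → refl)
      (λ _ → refl)
  frame-do1 (set r _)   s = frame (λ x p → if-false (∨-false (r ≡ᵇ x) p .proj₁)) (λ _ _ _ → refl)
      (λ _ → refl)
  frame-do1 (mov r _)   s = frame (λ x p → if-false (∨-false (r ≡ᵇ x) p .proj₁)) (λ _ _ _ → refl)
      (λ _ → refl)
  frame-do1 (inc r)     s = frame (λ x p → if-false (∨-false (r ≡ᵇ x) p .proj₁)) (λ _ _ _ → refl)
      (λ _ → refl)
  frame-do1 (mul r _ _) s = frame (λ x p → if-false (∨-false (r ≡ᵇ x) p .proj₁)) (λ _ _ _ → refl)
      (λ _ → refl)
  frame-do1 (ld r _ _)  s = frame (λ x p → if-false (∨-false (r ≡ᵇ x) p .proj₁)) (λ _ _ _ → refl)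
      (λ _ → refl)
  frame-do1 (inp r _)   s = frame (λ x p → if-false (∨-false (r ≡ᵇ x) p .proj₁)) (λ _ _ _ → refl)
      (λ _ → refl)
  frame-do1 (st j _ _)  s = frame (λ _ _ → refl) (λ x p i → cong (λ (f : ℕ → ℕ) → f i)
      (if-false (∨-false (j ≡ᵇ x) p .proj₁))) (λ _ → refl)

  frame-do* : ∀ as s → Frame (blk as) s (do* as s)
  frame-do* []       s = frame-refl
  frame-do* (a ∷ as) s = frame
    (λ r p → let q , q' = ∨-false (wrA a r) p in
       trans (regF (frame-do* as _) r q') (regF f r (orFalse q)))
    (λ j p i → let q , q' = ∨-false (waA a j) p in
       trans (arrF (frame-do* as _) j q' i) (arrF f j (orFalse q) i))
    (λ p → trans (logF (frame-do* as _) refl) (logF f refl))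
    where
    f = frame-do1 a s
    orFalse : ∀ {b} → b ≡ false → b ∨ false ≡ false
    orFalse refl = refl

  frame-iflˡ : ∀ {a b c d s s'} → Frame c s s' → Frame (ifl a b c d) s s'
  frame-iflˡ {c = c} (frame f g h) = frame (λ r p → f r (∨-false (wr c r) p .proj₁))
    (λ j p → g j (∨-false (wa c j) p .proj₁)) (λ p → h (∨-false (samples c) p .proj₁))

  frame-iflʳ : ∀ {a b c d s s'} → Frame d s s' → Frame (ifl a b c d) s s'
  frame-iflʳ {c = c} (frame f g h) = frame (λ r p → f r (∨-false (wr c r) p .proj₂))
    (λ j p → g j (∨-false (wa c j) p .proj₂)) (λ p → h (∨-false (samples c) p .proj₂))

  frame-whl : ∀ {a b c s s'} → Frame c s s' → Frame (whl a b c) s s'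
  frame-whl (frame f g h) = frame f g h

  -- A frame can be added to any postcondition afterwards, so specifications state only what a
  -- command achieves.
  frameE : ∀ {c κ s Q} → Ex c κ s Q → Ex c κ s (λ s' → Frame c s s' × Q s')
  frameE (blkE {as} p q) = blkE p (frame-do* as _ , q)
  frameE (sampE {r} q) = sampE (λ ω → frame (λ x p → if-false p) (λ _ _ _ → refl) (λ ()) , q ω)
  frameE (seqE e k) = seqE (frameE e) λ { s' (f , q) →
    monoE (frameE (k s' q)) λ { _ (f' , q') → frame-⨾ f f' , q' } }
  frameE (iflE {a} {b} {c} {d} x y) = iflE
    (λ p → monoE (frameE (x p)) λ { _ (f , q) → frame-iflˡ {a} {b} {c} {d} f , q })
    (λ p → monoE (frameE (y p)) λ { _ (f , q) → frame-iflʳ {a} {b} {c} {d} f , q })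
  frameE (whlE {a} {b} {c} x k y) = whlE (λ p → frameE (x p))
    (λ { s' (f , q) → monoE (frameE (k s' q)) λ { _ (f' , q') →
         frame-trans (frame-whl {a} {b} f) f' , q' } })
    (λ p → frame-refl , y p)
  frameE (subE p e) = subE p (frameE e)

  -- The invariant is indexed by the time that is left rather than by a number of rounds. Rounds of
  -- different cost are thus paid from one budget, which is how the amortised bound for
  -- breadth-first search is obtained. Every round uses at least the 2 units of its test, so the
  -- loop ends.
  whileR : ∀ {a b c} (I : ℕ → St → Set) {Q : St → Set} s₀ →
    (∀ κ s → Frame c s₀ s → I κ s → reg s a < reg s b →
       ∃₂ λ κ₁ κ₂ → (2 + κ₁ + κ₂ ≤ κ) × Ex c κ₁ s (I κ₂)) →
    (∀ κ s → Frame c s₀ s → I κ s → reg s b ≤ reg s a → Q s) →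
    ∀ κ → I κ s₀ → Ex (whl a b c) (2 + κ) s₀ Q
  whileR {a} {b} {c} I {Q} s₀ body exit κ i₀ = go κ κ s₀ ≤-refl frame-refl i₀
    where
    -- `fuel` makes the recursion structural: it bounds `κ`, which each round lowers by at least 2.
    go : ∀ fuel κ s → κ ≤ fuel → Frame c s₀ s → I κ s → Ex (whl a b c) (2 + κ) s Q
    go fuel κ s κ≤ f i with reg s a <? reg s b
    ... | no ¬p = subE (m≤m+n 2 κ)
            (whlE {κ = 0} {κ' = 0} {Q = λ _ → ⊥} (λ p → contradiction p ¬p)
                  (λ _ ()) (λ q → exit κ s f i q))
    ... | yes p with body κ s f i p
    go zero κ s κ≤ f i | yes p | κ₁ , κ₂ , le , e with ≤-trans le κ≤
    ... | ()
    go (suc fuel) κ s κ≤ f i | yes p | κ₁ , κ₂ , le , e =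
      subE le' (whlE (λ _ → frameE e)
        (λ { s' (f' , i') → go fuel κ₂ s' κ₂≤ (frame-trans f f') i' })
        (λ q → contradiction p (≤⇒≯ q)))
      where
      κ₂≤ : κ₂ ≤ fuel
      κ₂≤ = s≤s⁻¹ (≤-trans (≤-trans (m≤n+m (suc κ₂) (1 + κ₁)) (≤-reflexive (+-suc (1 + κ₁) κ₂)))
          (≤-trans le κ≤))
      le' : 2 + κ₁ + (2 + κ₂) ≤ 2 + κ
      le' = ≤-trans (≤-reflexive (regroup κ₁ κ₂)) (+-monoʳ-≤ 2 le)
        where regroup : ∀ x y → 2 + x + (2 + y) ≡ 2 + (2 + x + y)
              regroup = solve-∀

  -- `J` is restored after the counter has moved, so the body proves it for `do1 (inc i)` of its
  -- final state. A round costs `κ`, 2 for the test and 1 for the increment; the 3 in front are the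
  -- initial `clr` and the last test.
  forR : ∀ {i N c n κ} (J : ℕ → St → Set) {Q : St → Set} s₀ → reg s₀ N ≡ n →
    wr c i ≡ false → wr (forC i N c) N ≡ false →
    J 0 (do1 (clr i) s₀) →
    (∀ k s → k < n → Frame (forC i N c) s₀ s → reg s i ≡ k → J k s →
       Ex c κ s (λ s' → Frame c s s' → J (suc k) (do1 (inc i) s'))) →
    (∀ s → Frame (forC i N c) s₀ s → J n s → Q s) →
    Ex (forC i N c) (3 + n * (3 + κ)) s₀ Q
  forR {i} {N} {c} {n} {κ} J {Q} s₀ N≡ ci cN j₀ body exit =
    seqE {κ = 1} (blkE {Q = λ s → s ≡ do1 (clr i) s₀} tt refl)
      (λ { _ refl → whileR I s₁ iter end (n * (3 + κ))
          (0 , frame-refl , ≔-hit (reg s₀) 0 refl , z≤n , refl , j₀) })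
    where
    loop = c ⨾ blk (inc i ∷ [])
    s₁ = do1 (clr i) s₀
    I : ℕ → St → Set
    I κ' s = ∃[ k ] Frame loop s₁ s × reg s i ≡ k × k ≤ n × κ' ≡ (n ∸ k) * (3 + κ) × J k s
    toF : ∀ {s} → Frame loop s₁ s → Frame (forC i N c) s₀ s
    toF f = frame-⨾ (frame-do* (clr i ∷ []) s₀) (frame-whl {i} {N} f)
    iter : ∀ κ' s → Frame loop s₁ s → I κ' s → reg s i < reg s N →
       ∃₂ λ κ₁ κ₂ → (2 + κ₁ + κ₂ ≤ κ') × Ex loop κ₁ s (I κ₂)
    iter κ' s _ (k , f , ik , k≤ , κ≡ , j) i<N = κ + 1 , (n ∸ suc k) * (3 + κ) , le ,
      seqE (frameE (body k s k<n (toF f) ik j)) λ { s' (f' , j') →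
        blkE tt (suc k , frame-trans f (frame-⨾ f' (frame-do1 (inc i) s')) ,
          trans (≔-hit (reg s') _ refl) (cong suc (trans (regF f' i ci) ik)) ,
          k<n , refl , j' f') }
      where
      k<n : k < n
      k<n = subst₂ _<_ ik (trans (regF (toF f) N cN) N≡) i<N
      le : 2 + (κ + 1) + (n ∸ suc k) * (3 + κ) ≤ κ'
      le = ≤-reflexive (trans (regroup κ (n ∸ suc k))
          (trans (cong (_* (3 + κ)) (sym (+-∸-assoc 1 k<n))) (sym κ≡)))
        where regroup : ∀ x y → 2 + (x + 1) + y * (3 + x) ≡ (1 + y) * (3 + x)
              regroup = solve-∀
    end : ∀ κ' s → Frame loop s₁ s → I κ' s → reg s N ≤ reg s i → Q s
    end κ' s _ (k , f , ik , k≤ , κ≡ , j) ge = exit s (toF f) (subst (λ x → J x s) k≡n j)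
      where
      k≡n : k ≡ n
      k≡n = ≤-antisym k≤ (subst₂ _≤_ (trans (regF (toF f) N cN) N≡) ik ge)

-- Compilation to the word RAM

valid : Cmd → Bool
valid (blk [])              = true
valid (blk (ld _ j _ ∷ as)) = (j <ᵇ 16) ∧ valid (blk as)
valid (blk (st j _ _ ∷ as)) = (j <ᵇ 16) ∧ valid (blk as)
valid (blk (_ ∷ as))        = valid (blk as)
valid (samp _ _)            = true
valid (c ⨾ d)               = valid c ∧ valid d
valid (ifl _ _ c d)         = valid c ∧ valid d
valid (whl _ _ c)           = valid c

-- Register r is machine register 4 + r; machine registers 0 and 1 are scratch space and
-- machine register 3 holds m + 1.  Cell i of array j < 16 is at address j + (i + (m + 1)) * 16,
-- which is beyond the input.
address : ℕ → Reg → List Instr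
address j i = const 0 16 ∷ op add 1 (4 + i) 3 ∷ op mul 0 1 0 ∷ const 1 j ∷ op add 0 1 0 ∷ []

instrs : Atom → List Instr
instrs (clr r)     = const (4 + r) 0 ∷ []
instrs (set r c)   = const (4 + r) c ∷ []
instrs (mov r a)   = const 0 0 ∷ op add (4 + r) (4 + a) 0 ∷ []
instrs (inc r)     = const 0 1 ∷ op add (4 + r) 0 (4 + r) ∷ []
instrs (mul r a b) = op mul (4 + r) (4 + a) (4 + b) ∷ []
instrs (ld r j i)  = address j i ++ load (4 + r) 0 ∷ []
instrs (st j i r)  = address j i ++ store 0 (4 + r) ∷ []
instrs (inp r a)   = load (4 + r) (4 + a) ∷ []

clen : Cmd → ℕ
clen (blk [])        = 0
clen (blk (a ∷ as))  = clen (blk as) + length (instrs a)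
clen (samp _ _)      = 2
clen (c ⨾ d)         = clen d + clen c
clen (ifl _ _ c d)   = clen d + (3 + clen c)
clen (whl _ _ c)     = 3 + clen c

-- Jumps are absolute, so code is generated for the position `p` at which it will stand.
comp : ℕ → Cmd → List Instr
comp p (blk [])       = []
comp p (blk (a ∷ as)) = instrs a ++ comp (length (instrs a) + p) (blk as)
comp p (samp r a)     = rand 0 ∷ op rem (4 + r) 0 (4 + a) ∷ []
comp p (c ⨾ d)        = comp p c ++ comp (clen c + p) d
comp p (ifl a b c d)  = op lt 0 (4 + a) (4 + b) ∷ jzero 0 (3 + (clen c + p)) ∷
  comp (2 + p) c ++ jump (clen d + (3 + (clen c + p))) ∷ comp (3 + (clen c + p)) d
comp p (whl a b c)    = op lt 0 (4 + a) (4 + b) ∷ jzero 0 (3 + (clen c + p)) ∷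
  comp (2 + p) c ++ jump p ∷ []

clen-comp : ∀ p c → length (comp p c) ≡ clen c
clen-comp p (blk [])       = refl
clen-comp p (blk (a ∷ as)) = trans (Listₚ.length-++ (instrs a))
  (trans (cong (length (instrs a) +_) (clen-comp _ (blk as))) (+-comm (length (instrs a)) _))
clen-comp p (samp r a)     = refl
clen-comp p (c ⨾ d)        = trans (Listₚ.length-++ (comp p c))
  (trans (cong₂ _+_ (clen-comp p c) (clen-comp _ d)) (+-comm (clen c) _))
clen-comp p (ifl a b c d)  = trans (cong (2 +_) (trans (Listₚ.length-++ (comp (2 + p) c))
  (cong₂ (λ x y → x + suc y) (clen-comp (2 + p) c) (clen-comp _ d)))) (regroup (clen c) (clen d))
  where regroup : ∀ x y → 2 + (x + (1 + y)) ≡ y + (3 + x)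
        regroup = solve-∀
clen-comp p (whl a b c)    = trans (cong (2 +_) (trans (Listₚ.length-++ (comp (2 + p) c))
  (cong (_+ 1) (clen-comp (2 + p) c)))) (cong (2 +_) (+-comm (clen c) 1))

record At (P : Program) (p : ℕ) (is : List Instr) : Set where
  constructor _,_
  field
    rest : List Instr
    code : drop p P ≡ is ++ rest

at-head : ∀ {P p i is} → At P p (i ∷ is) → head (drop p P) ≡ just i
at-head (_ , e) = cong head e

drop-suc : ∀ {A : Set} p (xs : List A) → drop (suc p) xs ≡ drop 1 (drop p xs)
drop-suc zero    xs       = refl
drop-suc (suc p) []       = refl
drop-suc (suc p) (x ∷ xs) = drop-suc p xs

at-tail : ∀ {P p i is} → At P p (i ∷ is) → At P (suc p) is
at-tail {P} {p} (rest , e) = rest , trans (drop-suc p P) (cong (drop 1) e)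

at-++ˡ : ∀ {P p} is {js} → At P p (is ++ js) → At P p is
at-++ˡ is {js} (rest , e) = js ++ rest , trans e (Listₚ.++-assoc is js rest)

at-++ʳ : ∀ {P p} is {js} → At P p (is ++ js) → At P (length is + p) js
at-++ʳ []       a = a
at-++ʳ {P} {p} (i ∷ is) {js} a =
  subst (λ q → At P q js) (+-suc (length is) p) (at-++ʳ is (at-tail {P} {p} a))

at-comp : ∀ {P p} q c {js} → At P p (comp q c ++ js) → At P (clen c + p) js
at-comp {P} {p} q c {js} a = subst (λ k → At P (k + p) js) (clen-comp q c) (at-++ʳ (comp q c) a)

-- Simulation of commands by the machine

emit : ∀ {w} → Instr → Word w → List ℕ
emit (rand _) ω = toℕ ω ∷ []
emit _        ω = []

-- Every step consumes a word of tape, but only the words read by `rand` can influence the run. They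
-- are what `log` records on the abstract side.
trace : ∀ {w T} → Program → State w → Vec (Word w) T → List ℕ
trace {w} P σ ωs with head (drop (pc σ) P)
trace {w} P σ ωs       | nothing = []
trace {w} P σ []       | just i  = []
trace {w} P σ (ω ∷ ωs) | just i  = emit {w} i ω ++ trace P (exec i ω σ) ωs

run-just : ∀ {P w T i} {σ : State w} {ω} {ωs : Vec (Word w) T} → head (drop (pc σ) P) ≡ just i →
           run P σ (ω ∷ ωs) ≡ run P (exec i ω σ) ωs
run-just e rewrite e = refl

trace-just : ∀ {P w T i} {σ : State w} {ω} {ωs : Vec (Word w) T} → head (drop (pc σ) P) ≡ just i →
             trace P σ (ω ∷ ωs) ≡ emit {w} i ω ++ trace P (exec i ω σ) ωs
trace-just e rewrite e = refl

∧-true : ∀ b {c} → b ∧ c ≡ true → b ≡ true × c ≡ true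
∧-true true p = refl , p

rem-≤ : ∀ w a b → ⟦ rem ⟧ w a b ≤ b
rem-≤ w a zero    = z≤n
rem-≤ w a (suc b) = <⇒≤ (m%n<n a (suc b))

-- The abstract semantics has no word width; this lets it use `rem` at width 0.
rem-width : ∀ w a b → ⟦ rem ⟧ w a b ≡ ⟦ rem ⟧ 0 a b
rem-width w a zero    = refl
rem-width w a (suc b) = refl

toℕ-word : ∀ w {x} → x < 2 ^ w → toℕ (word w x) ≡ x
toℕ-word w {x} x< = trans (Finₚ.toℕ-fromℕ< _) (m<n⇒m%n≡m {{m^n≢0 2 w}} x<)

T⇒true : ∀ b → IsTrue b → b ≡ true
T⇒true true _ = refl

¬T⇒false : ∀ b → ¬ IsTrue b → b ≡ false
¬T⇒false false _ = refl
¬T⇒false true  h = ⊥-elim (h tt)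

-- `V` bounds every value and array index of the whole run. Cell addresses are then below
-- `16 + (V + suc m) * 16`, and `fits` keeps them, and all values, below `2 ^ w`.
module Machine (P : Program) (w m : ℕ) (input : ℕ → ℕ) (bound V : ℕ) (Post : ℕ → List ℕ → Set)
  (fits : 16 + (V + suc m) * 16 ≤ 2 ^ w)
  (input≤ : ∀ a → a < 2 + 2 * m → input a ≤ bound) where

  open Semantics input (2 + 2 * m) bound

  -- `l` is the log so far, latest sample first, hence the reversed append of what is still to be
  -- sampled.
  record Res {T} (σ : State w) (l : List ℕ) (ωs : Vec (Word w) T) : Set where
    constructor res
    field
      output : Word w
      halts  : run P σ ωs ≡ just output
      post   : Post (toℕ output) (trace P σ ωs ʳ++ l)

  res-step : ∀ {T i} σ l ω (ωs : Vec (Word w) T) → head (drop (pc σ) P) ≡ just i →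
             Res (exec i ω σ) (emit {w} i ω ʳ++ l) ωs → Res σ l (ω ∷ ωs)
  res-step {i = i} σ l ω ωs e (res x r q) =
    res x (trans (run-just e) r) (subst (Post (toℕ x))
        (trans (sym (Listₚ.++-ʳ++ (emit {w} i ω))) (cong (_ʳ++ l) (sym (trace-just e)))) q)


  addr : ℕ → ℕ → ℕ
  addr j i = j + (i + suc m) * 16

  -- The remainder modulo 16 gives the array, the quotient the index.
  addr-injective : ∀ {j i j' i'} → j < 16 → j' < 16 → addr j i ≡ addr j' i' → j ≡ j' × i ≡ i'
  addr-injective {j} {i} {j'} {i'} j< j'< e = j≡ , i≡
    where
    mod : ∀ {j} i → j < 16 → addr j i % 16 ≡ j
    mod {j} i j< = trans ([m+kn]%n≡m%n j (i + suc m) 16) (m<n⇒m%n≡m j<)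
    j≡ : j ≡ j'
    j≡ = trans (sym (mod i j<)) (trans (cong (_% 16) e) (mod i' j'<))
    i≡ : i ≡ i'
    i≡ = +-cancelʳ-≡ (suc m) i i' (*-cancelʳ-≡ (i + suc m) (i' + suc m) 16
           (+-cancelˡ-≡ j _ _ (trans e (cong (_+ (i' + suc m) * 16) (sym j≡)))))

  addr-beyond : ∀ j i → 2 + 2 * m ≤ addr j i
  addr-beyond j i = ≤-trans (≤-trans (m≤m+n (2 + 2 * m) (14 + 14 * m)) (≤-reflexive (regroup m)))
    (≤-trans (*-monoˡ-≤ 16 (m≤n+m (suc m) i)) (m≤n+m _ j))
    where regroup : ∀ m → 2 + 2 * m + (14 + 14 * m) ≡ (1 + m) * 16
          regroup = solve-∀

  record Rel (σ : State w) (s : St) : Set where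
    field
      regR : ∀ r → toℕ (regs σ (4 + r)) ≡ St.reg s r
      baseR : toℕ (regs σ 3) ≡ suc m
      arrR : ∀ a j i → j < 16 → toℕ a ≡ addr j i → toℕ (memory σ a) ≡ St.arr s j i
      inputR : ∀ a → toℕ a < 2 + 2 * m → toℕ (memory σ a) ≡ input (toℕ a)

  open Rel

  -- Beyond bound, a step increases the largest value by at most one, so that with T words of tape
  -- left nothing will exceed V, and all arithmetic is exact.
  record Bnd (s : St) (T : ℕ) : Set where
    field
      regB : ∀ r → St.reg s r + T ≤ V
      arrB : ∀ j i → St.arr s j i + T ≤ V
      boundB : bound + T ≤ V

  open Bnd

  -- Continuation style: from here, every run with at least `T` words of tape left ends in `Post`.
  -- Commands are then treated backwards, without describing the machine state in which they end.
  OK : ℕ → St → ℕ → Set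
  OK p s T = ∀ T' → T ≤ T' → ∀ σ → pc σ ≡ p → Rel σ s → Bnd s T' →
             (ωs : Vec (Word w) T') → Res σ (St.log s) ωs

  ok-≤ : ∀ {p s T T'} → T ≤ T' → OK p s T → OK p s T'
  ok-≤ le ok T'' le' = ok T'' (≤-trans le le')

  ≤V⇒< : ∀ {x} → x ≤ V → x < 2 ^ w
  ≤V⇒< {x} x≤ = ≤-trans (s≤s x≤) (≤-trans (s≤s (≤-trans (m≤m+n V (suc m)) (m≤m*n _ 16)))
    (≤-trans (m≤n+m (suc ((V + suc m) * 16)) 15) (≤-trans (≤-reflexive (+-suc 15 _)) fits)))

  +≤⇒< : ∀ {x T} → x + T ≤ V → x < 2 ^ w
  +≤⇒< {x} {T} le = ≤V⇒< (≤-trans (m≤m+n x T) le)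

  16< : 16 < 2 ^ w
  16< = ≤-trans (≤-trans (s≤s (m≤m+n 16 0)) (+-monoʳ-≤ 16
      (≤-trans (s≤s z≤n) (*-monoˡ-≤ 16 (m≤n+m (suc m) V))))) fits

  bnd-less : ∀ {s T} k → Bnd s (k + T) → Bnd s T
  bnd-less {s} {T} k b = record
    { regB = λ r → ≤-trans (shrink (St.reg s r)) (regB b r)
    ; arrB = λ j i → ≤-trans (shrink (St.arr s j i)) (arrB b j i)
    ; boundB = ≤-trans (shrink bound) (boundB b) }
    where shrink : ∀ x → x + T ≤ x + (k + T)
          shrink x = +-monoʳ-≤ x (m≤n+m T k)

  bnd-reg : ∀ {ρ α l T} r v → Bnd (mkSt ρ α l) T → v + T ≤ V → ∀ {l'} →
            Bnd (mkSt (ρ [ r ≔ᵣ v ]) α l') T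
  bnd-reg {ρ} {T = T} r v b v≤ = record { regB = λ x → upd x ; arrB = arrB b ; boundB = boundB b }
    where
    upd : ∀ x → (ρ [ r ≔ᵣ v ]) x + T ≤ V
    upd x with r ≡ᵇ x
    ... | true  = v≤
    ... | false = regB b x

  reg-upd : ∀ {ρ : Reg → ℕ} {f : Reg → Word w} r {v} {x : Word w} → toℕ x ≡ v →
            (∀ y → toℕ (f (4 + y)) ≡ ρ y) →
            ∀ y → toℕ ((f [ 4 + r ≔ᵣ x ]) (4 + y)) ≡ (ρ [ r ≔ᵣ v ]) y
  reg-upd r e h y with r ≡ᵇ y
  ... | true  = e
  ... | false = h y

  addr-word : ∀ {i j} {x b : Word w} → toℕ x ≡ i → toℕ b ≡ suc m → i ≤ V → j < 16 →
    toℕ (word w (toℕ (word w j) + toℕ (word w (toℕ (word w (toℕ x + toℕ b)) * toℕ (word w 16)))))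
      ≡ addr j i
  addr-word {i} {j} {x} {b} x≡ b≡ i≤ j< =
    trans (cong₂ (λ y z → toℕ (word w (y + z))) (toℕ-word w (<-trans j< 16<))
             (trans (cong₂ (λ y z → toℕ (word w (y * z)))
                (trans (cong₂ (λ y z → toℕ (word w (y + z))) x≡ b≡)
                  (toℕ-word w (≤-<-trans (≤-trans (m≤m*n _ 16) (m≤n+m _ j)) a<)))
                (toℕ-word w 16<)) (toℕ-word w (≤-<-trans (m≤n+m _ j) a<))))
          (toℕ-word w a<)
    where
    a< : addr j i < 2 ^ w
    a< = ≤-trans (+-mono-≤ j< (*-monoˡ-≤ 16 (+-monoˡ-≤ (suc m) i≤))) fits

  arr-upd : ∀ {α : ℕ → ℕ → ℕ} {μ : Word w → Word w} {a v : Word w} {j i x} →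
    j < 16 → toℕ a ≡ addr j i → toℕ v ≡ x →
    (∀ b j i → j < 16 → toℕ b ≡ addr j i → toℕ (μ b) ≡ α j i) →
    ∀ b j' i' → j' < 16 → toℕ b ≡ addr j' i' →
    toℕ ((μ [ a ≔ₘ v ]) b) ≡ (α [ j ≔ᵣ α j [ i ≔ᵣ x ] ]) j' i'
  arr-upd {α} {μ} {a} {v} {j} {i} {x} j< a≡ v≡ h b j' i' j'< b≡
    with toℕ a ≡ᵇ toℕ b | ≡ᵇ⇒≡ (toℕ a) (toℕ b) | ≡⇒≡ᵇ (toℕ a) (toℕ b)
  ... | true | e | _ with addr-injective {j} {i} {j'} {i'} j< j'< (trans (sym a≡) (trans (e tt) b≡))
  ...   | refl , refl with j ≡ᵇ j | ≡⇒≡ᵇ j j refl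
  ...     | true | _ with i ≡ᵇ i | ≡⇒≡ᵇ i i refl
  ...       | true | _ = v≡
  arr-upd {α} {μ} {a} {v} {j} {i} {x} j< a≡ v≡ h b j' i' j'< b≡ | false | _ | ne
    with j ≡ᵇ j' | ≡ᵇ⇒≡ j j'
  ... | false | _ = h b j' i' j'< b≡
  ... | true | e with e tt
  ...   | refl with i ≡ᵇ i' | ≡ᵇ⇒≡ i i'
  ...     | false | _ = h b j' i' j'< b≡
  ...     | true | e' with e' tt
  ...       | refl = ⊥-elim (ne (trans a≡ (sym b≡)))

  bnd-arr : ∀ {ρ α l T} j i v → Bnd (mkSt ρ α l) T → v + T ≤ V →
            Bnd (mkSt ρ (α [ j ≔ᵣ α j [ i ≔ᵣ v ] ]) l) T
  bnd-arr {α = α} {T = T} j i v b v≤ = record { regB = regB b ; arrB = upd ; boundB = boundB b }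
    where
    upd : ∀ j' i' → (α [ j ≔ᵣ α j [ i ≔ᵣ v ] ]) j' i' + T ≤ V
    upd j' i' with j ≡ᵇ j'
    ... | false = arrB b j' i'
    ... | true with i ≡ᵇ i'
    ...   | true  = v≤
    ...   | false = arrB b j i'

  input-upd : ∀ {μ : Word w → Word w} {a v : Word w} {j i} → toℕ a ≡ addr j i →
    (∀ b → toℕ b < 2 + 2 * m → toℕ (μ b) ≡ input (toℕ b)) →
    ∀ b → toℕ b < 2 + 2 * m → toℕ ((μ [ a ≔ₘ v ]) b) ≡ input (toℕ b)
  input-upd {a = a} {j = j} {i} a≡ h b b< with toℕ a ≡ᵇ toℕ b | ≡ᵇ⇒≡ (toℕ a) (toℕ b)
  ... | false | _ = h b b<
  ... | true  | e = contradiction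
    (≤-trans b< (subst (2 + 2 * m ≤_) (trans (sym a≡) (e tt)) (addr-beyond j i))) (<-irrefl refl)

  -- The longest atom, an array access, takes 6 instructions. A unit of cost is charged 8 machine
  -- steps throughout.
  atomOK : ∀ a {as} {s p T} → valid (blk (a ∷ [])) ≡ true → At P p (instrs a) → Pre (a ∷ as) s →
           OK (length (instrs a) + p) (do1 a s) T → OK p s (8 + T)
  atomOK (clr r) {p = p} _ at _ ok (suc T') (s≤s le) σ refl R B (_ ∷ ωs) =
    res-step σ _ _ ωs (at-head at) (ok T' (≤-trans (m≤n+m _ 7) le) _ refl
      (record { regR = reg-upd {f = regs σ} r (toℕ-word w (+≤⇒< 0≤)) (regR R) ; baseR = baseR R ;
          arrR = arrR R ; inputR = inputR R })
      (bnd-reg r 0 (bnd-less 1 B) 0≤) ωs)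
    where 0≤ : 0 + T' ≤ V
          0≤ = ≤-trans (m≤n+m T' bound) (boundB (bnd-less 1 B))
  atomOK (set r c) {p = p} _ at (c≤ , _) ok (suc T') (s≤s le) σ refl R B (_ ∷ ωs) =
    res-step σ _ _ ωs (at-head at) (ok T' (≤-trans (m≤n+m _ 7) le) _ refl
      (record { regR = reg-upd {f = regs σ} r (toℕ-word w (+≤⇒< c≤') ) (regR R) ; baseR = baseR R ;
          arrR = arrR R ; inputR = inputR R })
      (bnd-reg r c (bnd-less 1 B) c≤') ωs)
    where c≤' : c + T' ≤ V
          c≤' = ≤-trans (+-monoˡ-≤ T' c≤) (boundB (bnd-less 1 B))
  atomOK (mov r a) {s = s} {p} _ at _ ok (suc (suc T')) (s≤s (s≤s le)) σ refl R B (ω₀ ∷ ω ∷ ωs) =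
    res-step σ _ ω₀ _ (at-head at) (res-step _ _ ω ωs (at-head (at-tail {P} {p} at))
      (ok T' (≤-trans (m≤n+m _ 6) le) _ refl
      (record { regR = reg-upd {f = regs σ} r
          (trans (cong₂ (λ x y → toℕ (word w (x + y))) (regR R a) (toℕ-word w (<-trans z<s 16<)))
            (trans (cong (toℕ ∘ word w) (+-identityʳ _)) (toℕ-word w (+≤⇒< a≤)))) (regR R)
        ; baseR = baseR R ; arrR = arrR R ; inputR = inputR R })
      (bnd-reg r _ (bnd-less 2 B) a≤) ωs))
    where a≤ : St.reg s a + T' ≤ V
          a≤ = regB (bnd-less 2 B) a
  atomOK (inc r) {s = s} {p} _ at _ ok (suc (suc T')) (s≤s (s≤s le)) σ refl R B (ω₀ ∷ ω ∷ ωs) =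
    res-step σ _ ω₀ _ (at-head at) (res-step _ _ ω ωs (at-head (at-tail {P} {p} at))
      (ok T' (≤-trans (m≤n+m _ 6) le) _ refl
      (record { regR = reg-upd {f = regs σ} r
          (trans (cong₂ (λ x y → toℕ (word w (x + y))) (toℕ-word w (<-trans (s≤s z<s) 16<)) (regR R r))
            (toℕ-word w (+≤⇒< r≤))) (regR R)
        ; baseR = baseR R ; arrR = arrR R ; inputR = inputR R })
      (bnd-reg r _ (bnd-less 2 B) r≤) ωs))
    -- One of the two steps just taken pays for the increment, so the bound holds with the shorter
    -- tape.
    where r≤ : suc (St.reg s r) + T' ≤ V
          r≤ = ≤-trans (≤-reflexive (sym (+-suc (St.reg s r) T'))) (regB (bnd-less 1 B) r)
  atomOK (mul r a b) {s = s} {p} _ at (ab≤ , _) ok (suc T') (s≤s le) σ refl R B (_ ∷ ωs) =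
    res-step σ _ _ ωs (at-head at) (ok T' (≤-trans (m≤n+m _ 7) le) _ refl
      (record { regR = reg-upd {f = regs σ} r (trans
          (cong₂ (λ x y → toℕ (word w (x * y))) (regR R a) (regR R b))
            (toℕ-word w (+≤⇒< ab≤'))) (regR R)
        ; baseR = baseR R ; arrR = arrR R ; inputR = inputR R })
      (bnd-reg r _ (bnd-less 1 B) ab≤') ωs)
    where ab≤' : St.reg s a * St.reg s b + T' ≤ V
          ab≤' = ≤-trans (+-monoˡ-≤ T' ab≤) (boundB (bnd-less 1 B))
  atomOK (ld r j i) {s = s} {p} v at _ ok (suc (suc (suc (suc (suc (suc T'))))))
    (s≤s (s≤s (s≤s (s≤s (s≤s (s≤s le)))))) σ refl R B (ω₀ ∷ ω₁ ∷ ω₂ ∷ ω₃ ∷ ω₄ ∷ ω ∷ ωs) =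
    let at₁ = at-tail {P} {p} at ; at₂ = at-tail {P} {1 + p} at₁ ; at₃ = at-tail {P} {2 + p} at₂
        at₄ = at-tail {P} {3 + p} at₃ ; at₅ = at-tail {P} {4 + p} at₄ in
    res-step σ _ ω₀ _ (at-head at) (res-step _ _ ω₁ _ (at-head at₁) (res-step _ _ ω₂ _ (at-head at₂)
    (res-step _ _ ω₃ _ (at-head at₃) (res-step _ _ ω₄ _ (at-head at₄) (res-step _ _ ω ωs (at-head at₅)
      (ok T' (≤-trans (m≤n+m _ 2) le) _ refl
      (record { regR = reg-upd {f = regs σ} r (arrR R _ j _ j<
          (addr-word (regR R i) (baseR R) i≤ j<)) (regR R)
        ; baseR = baseR R ; arrR = arrR R ; inputR = inputR R })
      (bnd-reg r _ (bnd-less 6 B) (arrB (bnd-less 6 B) j (St.reg s i))) ωs))))))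
    where j< : j < 16
          j< = <ᵇ⇒< j 16 (subst IsTrue (sym (∧-true (j <ᵇ 16) v .proj₁)) tt)
          i≤ : St.reg s i ≤ V
          i≤ = ≤-trans (m≤m+n _ _) (regB B i)
  atomOK (st j i r) {s = s} {p} v at _ ok (suc (suc (suc (suc (suc (suc T'))))))
    (s≤s (s≤s (s≤s (s≤s (s≤s (s≤s le)))))) σ refl R B (ω₀ ∷ ω₁ ∷ ω₂ ∷ ω₃ ∷ ω₄ ∷ ω ∷ ωs) =
    let at₁ = at-tail {P} {p} at ; at₂ = at-tail {P} {1 + p} at₁ ; at₃ = at-tail {P} {2 + p} at₂
        at₄ = at-tail {P} {3 + p} at₃ ; at₅ = at-tail {P} {4 + p} at₄ in
    res-step σ _ ω₀ _ (at-head at) (res-step _ _ ω₁ _ (at-head at₁) (res-step _ _ ω₂ _ (at-head at₂)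
    (res-step _ _ ω₃ _ (at-head at₃) (res-step _ _ ω₄ _ (at-head at₄) (res-step _ _ ω ωs (at-head at₅)
      (ok T' (≤-trans (m≤n+m _ 2) le) _ refl
      (record { regR = regR R ; baseR = baseR R
        ; arrR = arr-upd {α = St.arr s} {i = St.reg s i} j< a≡ (regR R r) (arrR R) ; inputR =
            input-upd {j = j} {St.reg s i} a≡ (inputR R) })
      (bnd-arr j (St.reg s i) _ (bnd-less 6 B) (regB (bnd-less 6 B) r)) ωs))))))
    where j< : j < 16
          j< = <ᵇ⇒< j 16 (subst IsTrue (sym (∧-true (j <ᵇ 16) v .proj₁)) tt)
          i≤ : St.reg s i ≤ V
          i≤ = ≤-trans (m≤m+n _ _) (regB B i)
          a≡ = addr-word {j = j} (regR R i) (baseR R) i≤ j<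
  atomOK (inp r a) {s = s} {p} _ at (a< , _) ok (suc T') (s≤s le) σ refl R B (_ ∷ ωs) =
    res-step σ _ _ ωs (at-head at) (ok T' (≤-trans (m≤n+m _ 7) le) _ refl
      (record { regR = reg-upd {f = regs σ} r (trans (inputR R _ (subst (_< 2 + 2 * m) (sym (regR R a)) a<))
            (cong input (regR R a))) (regR R)
        ; baseR = baseR R ; arrR = arrR R ; inputR = inputR R })
      (bnd-reg r _ (bnd-less 1 B) (≤-trans (+-monoˡ-≤ T' (input≤ _ a<)) (boundB (bnd-less 1 B)))) ωs)

  sampOK : ∀ {r a s p T} → At P p (comp p (samp r a)) → (∀ ω → OK (2 + p) (doSamp r a ω s) T) →
           OK p s (8 + T)
  sampOK {r} {a} {s} {p} at ok (suc (suc T')) (s≤s (s≤s le)) σ refl R B (ω₀ ∷ ω ∷ ωs) =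
    res-step σ _ ω₀ _ (at-head at) (res-step _ _ ω ωs (at-head (at-tail {P} {p} at))
      (ok (toℕ ω₀) T' (≤-trans (m≤n+m _ 6) le) _ refl
      (record { regR = reg-upd {f = regs σ} r (trans
          (cong (toℕ ∘ word w) (trans (rem-width w (toℕ ω₀) (toℕ (regs σ (4 + a))))
             (cong (⟦ rem ⟧ 0 (toℕ ω₀)) (regR R a)))) (toℕ-word w (+≤⇒< a≤))) (regR R)
        ; baseR = baseR R ; arrR = arrR R ; inputR = inputR R })
      (bnd-reg r _ (bnd-less 2 B) a≤) ωs))
    where a≤ : ⟦ rem ⟧ 0 (toℕ ω₀) (St.reg s a) + T' ≤ V
          a≤ = ≤-trans (+-monoˡ-≤ T' (rem-≤ 0 (toℕ ω₀) _)) (regB (bnd-less 2 B) a)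

  jumpOK : ∀ {p l s T} → At P p (jump l ∷ []) → OK l s T → OK p s (1 + T)
  jumpOK {p} at ok (suc T') (s≤s le) σ refl R B (ω ∷ ωs) =
    res-step σ _ ω ωs (at-head at) (ok T' le _ refl
      (record { regR = regR R ; baseR = baseR R ; arrR = arrR R ; inputR = inputR R }) (bnd-less 1 B) ωs)

  testOK : ∀ {p l a b s T} → At P p (op lt 0 (4 + a) (4 + b) ∷ jzero 0 l ∷ []) →
           (St.reg s a < St.reg s b → OK (2 + p) s T) → (St.reg s b ≤ St.reg s a → OK l s T) →
           OK p s (2 + T)
  testOK {p} {l} {a} {b} {s} {T} at yes' no' (suc (suc T')) (s≤s (s≤s le)) σ refl R B (ω₀ ∷ ω ∷ ωs) =
    res-step σ _ ω₀ _ (at-head at) (res-step _ _ ω ωs (at-head (at-tail {P} {p} at)) goal)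
    where
    test = toℕ (word w (fromBool (toℕ (regs σ (4 + a)) <ᵇ toℕ (regs σ (4 + b)))))
    σ' = exec (jzero 0 l) ω (exec (op lt 0 (4 + a) (4 + b)) ω₀ σ)
    R' : Rel σ' s
    R' = record { regR = regR R ; baseR = baseR R ; arrR = arrR R ; inputR = inputR R }
    goal : Res σ' (St.log s) ωs
    goal with St.reg s a <? St.reg s b
    ... | yes a<b = yes' a<b T' le σ' (cong (λ x → if x ≡ᵇ 0 then l else 2 + p) test≡) R' (bnd-less 2 B) ωs
      where
      test≡ : test ≡ 1
      test≡ = trans (cong₂ (λ x y → toℕ (word w (fromBool (x <ᵇ y)))) (regR R a) (regR R b))
        (trans (cong (toℕ ∘ word w ∘ fromBool) (T⇒true _ (<⇒<ᵇ a<b))) (toℕ-word w (<-trans (s≤s z<s) 16<)))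
    ... | no a≮b = no' (≮⇒≥ a≮b) T' le σ' (cong (λ x → if x ≡ᵇ 0 then l else 2 + p) test≡) R'
        (bnd-less 2 B) ωs
      where
      test≡ : test ≡ 0
      test≡ = trans (cong₂ (λ x y → toℕ (word w (fromBool (x <ᵇ y)))) (regR R a) (regR R b))
        (trans (cong (toℕ ∘ word w ∘ fromBool) (¬T⇒false _ (λ t → a≮b (<ᵇ⇒< _ _ t))))
            (toℕ-word w (<-trans z<s 16<)))

  pre-head : ∀ a {as s} → Pre (a ∷ as) s → Pre as (do1 a s)
  pre-head (clr r) p = p
  pre-head (set r x) p = p .proj₂
  pre-head (mov r a) p = p
  pre-head (inc r) p = p
  pre-head (mul r a b) p = p .proj₂
  pre-head (ld r j i) p = p
  pre-head (st j i r) p = p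
  pre-head (inp r a) p = p .proj₂

  valid-head : ∀ a as → valid (blk (a ∷ as)) ≡ true → valid (blk (a ∷ [])) ≡ true × valid (blk as) ≡ true
  valid-head (clr r) as v = refl , v
  valid-head (set r x) as v = refl , v
  valid-head (mov r a) as v = refl , v
  valid-head (inc r) as v = refl , v
  valid-head (mul r a b) as v = refl , v
  valid-head (ld r j i) as v with j <ᵇ 16
  ... | true = refl , v
  valid-head (st j i r) as v with j <ᵇ 16
  ... | true = refl , v
  valid-head (inp r a) as v = refl , v

  blkOK : ∀ as {s} p T → valid (blk as) ≡ true → At P p (comp p (blk as)) → Pre as s →
          OK (clen (blk as) + p) (do* as s) T → OK p s (length as * 8 + T)
  blkOK [] p T v at pre ok = ok
  blkOK (a ∷ as) {s} p T v at pre ok = ok-≤ (≤-reflexive (sym (+-assoc 8 (length as * 8) T)))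
    (atomOK a {as} {s} (valid-head a as v .proj₁) (at-++ˡ (instrs a) at) pre
      (blkOK as _ T (valid-head a as v .proj₂) (at-++ʳ (instrs a) at) (pre-head a pre)
        (subst (λ q → OK q (do* as (do1 a s)) T) (+-assoc (clen (blk as)) _ p) ok)))

  -- The induction is on the derivation of the cost, not on the command: after one round of a loop
  -- the command is unchanged, but the derivation for the remaining rounds is a part of the given
  -- one.
  sound : ∀ {c κ s Q} p T → valid c ≡ true → At P p (comp p c) → Ex c κ s Q →
          (∀ s' → Q s' → OK (clen c + p) s' T) → OK p s (κ * 8 + T)
  sound p T v at (blkE {as} pre q) ok = blkOK as p T v at pre (ok _ q)
  sound p T v at (sampE q) ok = sampOK at (λ ω → ok _ (q ω))
  sound p T v at (seqE {c} {d} {κ} {κ'} e k) ok =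
    let vc , vd = ∧-true (valid c) v in
    ok-≤ (≤-reflexive (regroup κ κ' T))
      (sound p (κ' * 8 + T) vc (at-++ˡ (comp p c) at) e λ s' q →
        sound (clen c + p) T vd (at-comp p c {comp (clen c + p) d} at) (k s' q) λ s'' q' →
          subst (λ x → OK x s'' T) (+-assoc (clen d) (clen c) p) (ok s'' q'))
    where regroup : ∀ x y z → x * 8 + (y * 8 + z) ≡ (x + y) * 8 + z
          regroup = solve-∀
  sound p T v at (iflE {a} {b} {c} {d} {κ} {s} {Q} x y) ok =
    let vc , vd = ∧-true (valid c) v in
    ok-≤ (≤-trans (m≤n+m _ 13) (≤-reflexive (cost κ T)))
     (testOK (at-++ˡ (_ ∷ _ ∷ []) at)
      (λ l → sound (2 + p) (1 + T) vc (at-++ˡ (comp (2 + p) c) at₂) (x l) λ s' q →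
         jumpOK (at-++ˡ (_ ∷ []) at₃) (end s' q))
      (λ g → sound _ (1 + T) vd at₄ (y g) λ s' q → ok-≤ (n≤1+n T) (end s' q)))
    where
    cost : ∀ x z → 13 + (2 + (x * 8 + (1 + z))) ≡ (2 + x) * 8 + z
    cost = solve-∀
    at₂ = at-++ʳ {P} {p} (_ ∷ _ ∷ []) at
    at₃ = at-comp (2 + p) c at₂
    at₄ = subst (λ z → At P z (comp (3 + (clen c + p)) d)) (regroup (clen c) p)
        (at-tail {P} {clen c + (2 + p)} at₃)
      where regroup : ∀ x y → 1 + (x + (2 + y)) ≡ 3 + (x + y)
            regroup = solve-∀
    end : ∀ s' → Q s' → OK (clen d + (3 + (clen c + p))) s' T
    end s' q = subst (λ z → OK z s' T) (regroup (clen d) (clen c) p) (ok s' q)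
      where regroup : ∀ x y z → x + (3 + y) + z ≡ x + (3 + (y + z))
            regroup = solve-∀
  sound p T v at (whlE {a} {b} {c} {κ} {κ'} {s} {Q} {Q'} x k y) ok =
    ok-≤ (≤-trans (m≤n+m _ 13) (≤-reflexive (regroup κ κ' T))) (testOK (at-++ˡ (_ ∷ _ ∷ []) at)
      (λ l → sound (2 + p) (1 + (κ' * 8 + T)) v (at-++ˡ (comp (2 + p) c) at₂) (x l) λ s' q →
         jumpOK (at-comp (2 + p) c at₂) (sound p T v at (k s' q) ok))
      (λ g → ok-≤ (≤-trans (≤-trans (m≤n+m T (κ' * 8)) (n≤1+n _)) (m≤n+m _ (κ * 8))) (ok s (y g))))
    where
    at₂ = at-++ʳ {P} {p} (_ ∷ _ ∷ []) at
    regroup : ∀ x y z → 13 + (2 + (x * 8 + (1 + (y * 8 + z)))) ≡ (2 + x + y) * 8 + z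
    regroup = solve-∀
  sound {s = s} p T v at (subE le e) ok =
    ok-≤ (+-monoˡ-≤ T (*-monoˡ-≤ 8 le)) (sound p T v at e ok)

-- The prologue loads `m` from cell 1 and leaves the array base `m + 1` in machine register 3. The
-- epilogue copies the result to register 0, and control then runs off the end, which is halting.
program : Cmd → Reg → Program
program c r = const 1 1 ∷ load 3 1 ∷ op add 3 3 1 ∷ comp 3 c ++ const 0 0 ∷ op add 0 0 (4 + r) ∷ []

input : ∀ {n m} → Digraph n m → ℕ → ℕ
input G a = fromMaybe 0 (head (drop a (encode G)))

length-encode : ∀ {n m} (G : Digraph n m) → length (encode G) ≡ 2 + 2 * m
length-encode {m = m} G = cong (2 +_) (pairs (edges G))
  where
  pairs : ∀ {n m} (es : Vec (Fin n × Fin n) m) →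
    length (concatMap (λ (u , v) → toℕ u ∷ toℕ v ∷ []) (toList es)) ≡ 2 * m
  pairs []            = refl
  pairs {m = suc m} (_ ∷ es) = trans (cong (2 +_) (pairs es)) (sym (*-suc 2 m))

input-beyond : ∀ {n m} (G : Digraph n m) {a} → 2 + 2 * m ≤ a → input G a ≡ 0
input-beyond G {a} le = cong (λ xs → fromMaybe 0 (head xs))
  (Listₚ.drop-all a (encode G) (subst (_≤ a) (sym (length-encode G)) le))

s₀ : St
s₀ = mkSt (λ _ → 0) (λ _ _ → 0) []

-- The 5 extra steps are the three instructions of the prologue and the two of the epilogue.
module Run {n m} (G : Digraph n m) (c : Cmd) (r : Reg) (v : valid c ≡ true)
  (w bound V : ℕ) (Post : ℕ → List ℕ → Set)
  (fits : 16 + (V + suc m) * 16 ≤ 2 ^ w)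
  (input≤ : ∀ a → a < 2 + 2 * m → input G a ≤ bound)
  {T κ : ℕ} (bound≤ : bound + T ≤ V) (time : 5 + κ * 8 ≤ T) where

  open Semantics (input G) (2 + 2 * m) bound
  open Machine (program c r) w m (input G) bound V Post fits input≤

  run-program : Ex c κ s₀ (λ s → Post (St.reg s r) (St.log s)) →
                (ωs : Vec (Word w) T) → Res (initial w G) [] ωs
  run-program e = go T time bound≤
    where
    1≡ : toℕ (word w 1) ≡ 1
    1≡ = toℕ-word w (<-trans (s≤s z<s) 16<)
    input< : ∀ a → input G a < 2 ^ w
    input< a with a <? 2 + 2 * m
    ... | yes a< = ≤V⇒< (≤-trans (m≤m+n _ T) (≤-trans (+-monoˡ-≤ T (input≤ a a<)) bound≤))
    ... | no  a≮ = subst (_< 2 ^ w) (sym (input-beyond G (≮⇒≥ a≮))) (<-trans z<s 16<)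
    at₃ : At (program c r) 3 (comp 3 c ++ const 0 0 ∷ op add 0 0 (4 + r) ∷ [])
    at₃ = [] , sym (Listₚ.++-identityʳ _)
    end : ∀ s → Post (St.reg s r) (St.log s) → OK (clen c + 3) s 2
    end s q (suc (suc T')) (s≤s (s≤s _)) σ refl R B (ω₀ ∷ ω ∷ ωs) =
      res-step σ _ ω₀ _ (at-head at₄) (res-step _ _ ω ωs (at-head (at-tail {p = clen c + 3} at₄))
        (res (word w (toℕ (word w 0) + toℕ (regs σ (4 + r)))) (halted ωs)
          (subst₂ Post (sym out≡) (cong (_ʳ++ St.log s) (sym (silent ωs))) q)))
      where
      at₄ = at-comp {p = 3} 3 c at₃
      out≡ : toℕ (word w (toℕ (word w 0) + toℕ (regs σ (4 + r)))) ≡ St.reg s r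
      out≡ = trans (cong₂ (λ x y → toℕ (word w (x + y))) (toℕ-word w (<-trans z<s 16<)) (Rel.regR R r))
               (toℕ-word w (+≤⇒< (Bnd.regB B r)))
      σ' = exec (op add 0 0 (4 + r)) ω (exec (const 0 0) ω₀ σ)
      outside : head (drop (2 + (clen c + 3)) (program c r)) ≡ nothing
      outside = cong head (Listₚ.drop-all (2 + (clen c + 3)) (program c r) (≤-reflexive
        (trans (cong (3 +_) (trans (Listₚ.length-++ (comp 3 c)) (cong (_+ 2) (clen-comp 3 c))))
            (regroup (clen c)))))
        where regroup : ∀ x → 3 + (x + 2) ≡ 2 + (x + 3)
              regroup = solve-∀
      halted : ∀ {T} (ωs : Vec (Word w) T) → run (program c r) σ' ωs ≡ just (regs σ' 0)
      halted ωs rewrite outside = refl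
      silent : ∀ {T} (ωs : Vec (Word w) T) → trace (program c r) σ' ωs ≡ []
      silent ωs rewrite outside = refl
    go : ∀ T → 5 + κ * 8 ≤ T → bound + T ≤ V → (ωs : Vec (Word w) T) → Res (initial w G) [] ωs
    go (suc (suc (suc T))) (s≤s (s≤s (s≤s le))) b≤ (ω₀ ∷ ω₁ ∷ ω₂ ∷ ωs) =
      res-step (initial w G) [] ω₀ _ refl (res-step _ _ ω₁ _ refl (res-step _ _ ω₂ _ refl
        (sound 3 2 v (at-++ˡ (comp 3 c) at₃) e end T (subst (_≤ T) (+-comm 2 (κ * 8)) le) _ refl
          (record
            { regR = λ _ → toℕ-word w (<-trans z<s 16<)
            ; baseR = trans (cong₂ (λ x y → toℕ (word w (x + y)))
                (trans (cong (λ a → toℕ (word w (input G a))) 1≡) (toℕ-word w (input< 1))) 1≡)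
                (trans (toℕ-word w (≤-<-trans (≤-reflexive (+-comm m 1)) sm<)) (+-comm m 1))
            ; arrR = λ a j i _ a≡ → trans (cong (toℕ ∘ word w) (input-beyond G
                (subst (2 + 2 * m ≤_) (sym a≡) (addr-beyond j i)))) (toℕ-word w (<-trans z<s 16<))
            ; inputR = λ a _ → toℕ-word w (input< (toℕ a)) })
          (record { regB = λ _ → ≤-trans (m≤n+m T bound) b≤' ; arrB = λ _ _ → ≤-trans
              (m≤n+m T bound) b≤' ; boundB = b≤' })
          ωs)))
      where
      b≤' : bound + T ≤ V
      b≤' = ≤-trans (+-monoʳ-≤ bound (m≤n+m T 3)) b≤
      sm< : suc m < 2 ^ w
      sm< = ≤-trans (s≤s (≤-trans (m≤n+m (suc m) V) (m≤m*n _ 16)))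
        (≤-trans (m≤n+m (suc ((V + suc m) * 16)) 15) (≤-trans (≤-reflexive (+-suc 15 _)) fits))

-- Breadth-first search

sumTo : (ℕ → ℕ) → ℕ → ℕ
sumTo f zero    = 0
sumTo f (suc k) = f k + sumTo f k

sumTo-cong : ∀ {f g} n → (∀ v → v < n → f v ≡ g v) → sumTo f n ≡ sumTo g n
sumTo-cong zero    h = refl
sumTo-cong (suc n) h = cong₂ _+_ (h n ≤-refl) (sumTo-cong n λ v v< → h v (m≤n⇒m≤1+n v<))

sumTo-≤ : ∀ f {k n} → k ≤ n → sumTo f k ≤ sumTo f n
sumTo-≤ f {zero}  _ = z≤n
sumTo-≤ f {suc k} {suc n} (s≤s k≤n) with k ≟ n
... | yes refl = ≤-refl
... | no  k≢n  = ≤-trans (sumTo-≤ f (≤∧≢⇒< k≤n k≢n)) (m≤n+m _ (f n))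

sumTo-bump : ∀ {f g d x} n → x < n → g x ≡ d + f x → (∀ v → v < n → x ≢ v → g v ≡ f v) →
             sumTo g n ≡ d + sumTo f n
sumTo-bump {f} {g} {d} {x} (suc n) x< gx h with x ≟ n
... | yes refl = cong₂ _+_ gx (sumTo-cong n λ v v< → h v (m≤n⇒m≤1+n v<) λ { refl → <-irrefl refl v< })
                   ∔ +-assoc d (f n) _
... | no x≢n = cong₂ _+_ (h n ≤-refl x≢n) (sumTo-bump n (≤∧≢⇒< (s≤s⁻¹ x<) x≢n) gx λ v v< → h v
    (m≤n⇒m≤1+n v<))
                 ∔ swap (f n) d (sumTo f n)
  where swap : ∀ a b c → a + (b + c) ≡ b + (a + c)
        swap = solve-∀

sumTo-linear : ∀ a b f n → sumTo (λ v → a + b * f v) n ≡ a * n + b * sumTo f n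
sumTo-linear a b f zero    = sym (cong₂ _+_ (*-zeroʳ a) (*-zeroʳ b))
sumTo-linear a b f (suc n) = cong (a + b * f n +_) (sumTo-linear a b f n) ∔ regroup a b (f n) n (sumTo f n)
  where regroup : ∀ a b x n s → a + b * x + (a * n + b * s) ≡ a * (1 + n) + b * (x + s)
        regroup = solve-∀

-- Edges are numbered 0, …, m - 1 and run from src e to tgt e.
module Graph (m : ℕ) (src tgt : ℕ → ℕ) where

  data Walk : ℕ → ℕ → ℕ → Set where
    nil  : ∀ {x} → Walk x x 0
    cons : ∀ {e z k} → e < m → Walk (tgt e) z k → Walk (src e) z (suc k)

  snoc : ∀ {x e k} → Walk x (src e) k → e < m → Walk x (tgt e) (suc k)
  snoc {e = e} w e< = go w refl
    where
    go : ∀ {x y k} → Walk x y k → y ≡ src e → Walk x (tgt e) (suc k)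
    go nil         refl = cons e< nil
    go (cons e' w) refl = cons e' (go w refl)

  append : ∀ {x y z j k} → Walk x y j → Walk y z k → Walk x z (j + k)
  append nil         w' = w'
  append (cons e< w) w' = cons e< (append w w')

  -- Decidability at each length makes in-balls boolean functions, so that their members can be
  -- counted.
  walk? : ∀ k x y → Dec (Walk x y k)
  walk? zero x y with x ≟ y
  ... | yes refl = yes nil
  ... | no  p    = no λ { nil → p refl }
  walk? (suc k) x y with anyUpTo? (λ e → (src e ≟ x) ×-dec walk? k (tgt e) y) m
  ... | yes (e , e< , refl , w) = yes (cons e< w)
  ... | no  p = no λ { (cons {e} e< w) → p (e , e< , refl , w) }

  walk-end : ∀ {x y k} → Walk x y k → x ≡ y ⊎ ∃[ e ] e < m × tgt e ≡ y
  walk-end nil = inj₁ refl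
  walk-end (cons {e} e< w) with walk-end w
  ... | inj₁ p = inj₂ (e , e< , p)
  ... | inj₂ q = inj₂ q

  -- Every vertex other than `x` is the target of the last edge of its walk, and different vertices
  -- have different last edges. Together with `x` itself this maps the vertices injectively to
  -- `m + 1` values.
  spanning : ∀ {n x} → (∀ v → v < n → ∃[ k ] Walk x v k) → n ≤ suc m
  spanning {n} {x} reach = Finₚ.injective⇒≤ {f = f} λ {u} {v} → inj u v
    where
    edge : ∀ {v} → x ≡ v ⊎ (∃[ e ] e < m × tgt e ≡ v) → Fin (suc m)
    edge (inj₁ _)            = Fin.zero
    edge (inj₂ (e , e< , _)) = Fin.suc (fromℕ< e<)
    end : ∀ (v : Fin n) → x ≡ toℕ v ⊎ ∃[ e ] e < m × tgt e ≡ toℕ v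
    end v = walk-end (reach (toℕ v) (Finₚ.toℕ<n v) .proj₂)
    f : Fin n → Fin (suc m)
    f v = edge (end v)
    same : ∀ {u v} (p : x ≡ u ⊎ ∃[ e ] e < m × tgt e ≡ u) (q : x ≡ v ⊎ ∃[ e ] e < m × tgt e ≡ v) →
           edge p ≡ edge q → u ≡ v
    same (inj₁ p) (inj₁ q) _ = sym p ∔ q
    same (inj₂ (e , e< , p)) (inj₂ (e' , e'< , q)) r =
      sym p ∔ cong tgt (sym (Finₚ.toℕ-fromℕ< e<) ∔ cong toℕ (Finₚ.suc-injective r) ∔ Finₚ.toℕ-fromℕ<
          e'<) ∔ q
    inj : ∀ u v → f u ≡ f v → u ≡ v
    inj u v p = Finₚ.toℕ-injective (same (end u) (end v) p)

  -- The incidence list of u is kept as a linked list of edges, latest first: last k u is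
  -- one more than the last of the first k edges that leaves u, and 0 if there is none.
  last : ℕ → ℕ → ℕ
  last zero    u = 0
  last (suc k) u = if src k ≡ᵇ u then suc k else last k u

  deg : ℕ → ℕ → ℕ
  deg zero    u = 0
  deg (suc k) u = if src k ≡ᵇ u then suc (deg k u) else deg k u

  -- One step down the incidence list. The skipped edges do not leave `u`, and the degree falls by
  -- one, so `deg` measures the rest of the list and pays for it.
  data LastView (k u : ℕ) : Set where
    none : last k u ≡ 0 → (∀ e → e < k → src e ≢ u) → LastView k u
    some : ∀ e → e < k → last k u ≡ suc e → src e ≡ u →
           (∀ e' → suc e ≤ e' → e' < k → src e' ≢ u) → deg k u ≡ suc (deg e u) → LastView k u

  last-view : ∀ k u → LastView k u
  last-view zero    u = none refl λ _ ()
  last-view (suc k) u with src k ≡ᵇ u in eq | ≡ᵇ⇒≡ (src k) u | ≡⇒≡ᵇ (src k) u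
  ... | true  | h | _ = some k ≤-refl (if-t eq) (h tt)
      (λ e' le p< → contradiction (≤-trans le (s≤s⁻¹ p<)) (<-irrefl refl)) (if-t eq)
    where if-t : ∀ {b} {x y : ℕ} → b ≡ true → (if b then x else y) ≡ x
          if-t refl = refl
  ... | false | _ | h with last-view k u
  ...   | none l no-e = none (if-false eq ∔ l) λ e e< → λ { refl → lem e (s≤s⁻¹ e<) refl }
    where lem : ∀ e → e ≤ k → src e ≢ u
          lem e e≤ with e ≟ k
          ... | yes refl = h
          ... | no e≢k   = no-e e (≤∧≢⇒< e≤ e≢k)
  ...   | some e e< l s no-e d = some e (m≤n⇒m≤1+n e<) (if-false eq ∔ l) s lem (if-false eq ∔ d)
    where lem : ∀ e' → suc e ≤ e' → e' < suc k → src e' ≢ u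
          lem e' le p< with e' ≟ k
          ... | yes refl = h
          ... | no e≢k   = no-e e' le (≤∧≢⇒< (s≤s⁻¹ p<) e≢k)

  sumTo-deg : ∀ {n} k → (∀ e → e < k → src e < n) → sumTo (deg k) n ≡ k
  sumTo-deg {n} zero    h = zeros n
    where zeros : ∀ n → sumTo (λ _ → 0) n ≡ 0
          zeros zero    = refl
          zeros (suc n) = zeros n
  sumTo-deg {n} (suc k) h =
    sumTo-bump {deg k} {deg (suc k)} {1} n (h k ≤-refl) at other
      ∔ cong suc (sumTo-deg k λ e e< → h e (m≤n⇒m≤1+n e<))
    where
    at : deg (suc k) (src k) ≡ suc (deg k (src k))
    at with src k ≡ᵇ src k | ≡⇒≡ᵇ (src k) (src k) refl
    ... | true | _ = refl
    other : ∀ v → v < n → src k ≢ v → deg (suc k) v ≡ deg k v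
    other v _ ne with src k ≡ᵇ v | ≡ᵇ⇒≡ (src k) v
    ... | false | _ = refl
    ... | true  | e = contradiction (e tt) ne

  -- δ holds the distances from x, where n stands for ∞.
  record DistFrom (n x : ℕ) (δ : ℕ → ℕ) : Set where
    field
      dist≤n : ∀ v → v < n → δ v ≤ n
      attained : ∀ v → v < n → δ v < n → Walk x v (δ v)
      shortest : ∀ {v k} → Walk x v k → δ v < n × δ v ≤ k

  module BreadthFirst (n x : ℕ) (x<n : x < n)
    (src< : ∀ e → e < m → src e < n) (tgt< : ∀ e → e < m → tgt e < n) where

    Done : (ℕ → ℕ) → ℕ → Set
    Done δ v = ∀ e → e < m → src e ≡ v → δ (tgt e) < n × δ (tgt e) ≤ suc (δ v)

    unseen : (ℕ → ℕ) → (ℕ → ℕ) → ℕ → ℕ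
    unseen g δ v = if δ v <ᵇ n then 0 else g v

    -- What a vertex costs once it is queued: 10 for taking it out, and 10 for each edge leaving it.
    -- By `sumTo-deg` the total is `10 * n + 10 * m`.
    weight : ℕ → ℕ
    weight u = 10 + 10 * deg m u

    -- `h` and `t` delimit the waiting part of the queue; `ℓ` is the level being handled, and
    -- waiting vertices are at distance `ℓ` or `ℓ + 1`. `X` is what holds of the seen vertices that
    -- have left the queue; it varies because the current vertex is not yet `Done`. `count` and
    -- `budget` are one conservation law, for the number of vertices and for their weights: it gives
    -- `t ≤ n` and bounds the total work. The bound `δ (Q i) ≤ i` keeps true distances below `n`,
    -- which is thus free to mean ∞.
    record Inv (X : (ℕ → ℕ) → ℕ → Set) (δ Q : ℕ → ℕ) (h t ℓ : ℕ) : Set where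
      field
        h≤t    : h ≤ t
        count  : t + sumTo (unseen (λ _ → 1) δ) n ≡ n
        budget : sumTo (weight ∘ Q) t + sumTo (unseen weight δ) n ≡ sumTo weight n
        queue  : ∀ i → i < t → Q i < n × δ (Q i) < n × δ (Q i) ≤ i
        le     : ∀ v → v < n → δ v ≤ n
        seen   : ∀ v → v < n → δ v < n → (∃[ i ] h ≤ i × i < t × Q i ≡ v) ⊎ X δ v
        sorted : ∀ i j → h ≤ i → i ≤ j → j < t → δ (Q i) ≤ δ (Q j)
        upper  : ∀ v → v < n → δ v < n → δ v ≤ suc ℓ
        lower  : ∀ i → h ≤ i → i < t → ℓ ≤ δ (Q i)
        walk   : ∀ v → v < n → δ v < n → Walk x v (δ v)
        source : δ x ≡ 0

    unseen-seen : ∀ g δ {v} → δ v < n → unseen g δ v ≡ 0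
    unseen-seen g δ {v} p< with δ v <ᵇ n | <⇒<ᵇ p<
    ... | true | _ = refl

    unseen-new : ∀ g δ {v} → n ≤ δ v → unseen g δ v ≡ g v
    unseen-new g δ {v} ge with δ v <ᵇ n | <ᵇ⇒< (δ v) n
    ... | false | _ = refl
    ... | true  | h = contradiction (h tt) (≤⇒≯ ge)

    unseen-mark : ∀ g δ {y d} → y < n → n ≤ δ y → d < n →
      sumTo (unseen g δ) n ≡ g y + sumTo (unseen g (δ [ y ≔ᵣ d ])) n
    unseen-mark g δ {y} {d} y< new d< = sumTo-bump n y<
      (unseen-new g δ new ∔ sym (cong (g y +_) (unseen-seen g (δ [ y ≔ᵣ d ])
          (subst (_< n) (sym (≔-hit δ d refl)) d<)) ∔ +-identityʳ (g y)))
      (λ v _ ne → cong (λ z → if z <ᵇ n then 0 else g v) (sym (≔-miss δ d ne)))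

    Agrees : (ℕ → ℕ) → (ℕ → ℕ) → Set
    Agrees δ δ' = ∀ v → δ v < n → δ' v ≡ δ v

    done-agrees : ∀ {δ δ' v} → Agrees δ δ' → δ v < n → Done δ v → Done δ' v
    done-agrees {δ} {δ'} {v} agree v< d e e< s = let a , b = d e e< s ; q = agree (tgt e) a in
      subst (_< n) (sym q) a , subst₂ (λ y z → y ≤ suc z) (sym q) (sym (agree v v<)) b

    mark-agrees : ∀ δ {y d} → n ≤ δ y → Agrees δ (δ [ y ≔ᵣ d ])
    mark-agrees δ {y} {d} new v v< = ≔-miss δ {y} d λ { refl → <⇒≱ v< new }

    -- A newly seen vertex y gets the value suc ℓ, the largest in use, so the queue stays sorted.
    visit : ∀ {X δ Q h t ℓ y} → Inv X δ Q h t ℓ →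
      (∀ {δ' v} → Agrees δ δ' → δ v < n → X δ v → X δ' v) →
      y < n → n ≤ δ y → ℓ < t → Walk x y (suc ℓ) →
      Inv X (δ [ y ≔ᵣ suc ℓ ]) (Q [ t ≔ᵣ y ]) h (suc t) ℓ
    visit {X} {δ} {Q} {h} {t} {ℓ} {y} I X-agrees y< new ℓ<t wy = record
      { h≤t = m≤n⇒m≤1+n h≤t
      ; count = count'
      ; budget = budget'
      ; queue = queue'
      ; le = le'
      ; seen = seen'
      ; sorted = sorted'
      ; upper = upper'
      ; lower = lower'
      ; walk = walk'
      ; source = agree x (subst (_< n) (sym source) (≤-<-trans z≤n x<n)) ∔ source
      }
      where
      open Inv I
      δ' = δ [ y ≔ᵣ suc ℓ ]
      Q' = Q [ t ≔ᵣ y ]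
      -- With `y` still unseen, `count` leaves room for one more entry. The marking uses 0 because
      -- `suc ℓ < n` is only known as a consequence of this bound.
      t<n : t < n
      t<n = ≤-trans (m≤m+n (suc t) (sumTo (unseen (λ _ → 1) (δ [ y ≔ᵣ 0 ])) n))
        (≤-reflexive (sym (+-suc t _) ∔ cong (t +_)
            (sym (unseen-mark (λ _ → 1) δ y< new (≤-<-trans z≤n x<n))) ∔ count))
      d< : suc ℓ < n
      d< = ≤-<-trans ℓ<t t<n
      agree : Agrees δ δ'
      agree = mark-agrees δ new
      δ'y : δ' y ≡ suc ℓ
      δ'y = ≔-hit δ (suc ℓ) refl
      Q't : Q' t ≡ y
      Q't = ≔-hit Q y refl
      Q'i : ∀ {i} → i < t → Q' i ≡ Q i
      Q'i i< = ≔-miss Q {t} y λ { refl → <-irrefl refl i< }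
      δ'Q'i : ∀ {i} → i < t → δ' (Q' i) ≡ δ (Q i)
      δ'Q'i i< = cong δ' (Q'i i<) ∔ agree _ (queue _ i< .proj₂ .proj₁)
      δ'Q't : δ' (Q' t) ≡ suc ℓ
      δ'Q't = cong δ' Q't ∔ δ'y
      count' : suc t + sumTo (unseen (λ _ → 1) δ') n ≡ n
      count' = sym (+-suc t _) ∔ cong (t +_) (sym (unseen-mark (λ _ → 1) δ y< new d<)) ∔ count
      budget' : sumTo (weight ∘ Q') (suc t) + sumTo (unseen weight δ') n ≡ sumTo weight n
      budget' = cong (_+ sumTo (unseen weight δ') n)
          (cong₂ _+_ (cong weight Q't) (sumTo-cong t λ v v< → cong weight (Q'i v<)))
        ∔ regroup (weight y) (sumTo (weight ∘ Q) t) (sumTo (unseen weight δ') n)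
        ∔ cong (sumTo (weight ∘ Q) t +_) (sym (unseen-mark weight δ y< new d<)) ∔ budget
        where regroup : ∀ a b c → a + b + c ≡ b + (a + c)
              regroup = solve-∀
      split : ∀ {i} → i < suc t → i < t ⊎ i ≡ t
      split i< = m≤n⇒m<n∨m≡n (s≤s⁻¹ i<)
      old : ∀ v → δ' v < n → δ v < n ⊎ y ≡ v
      old v v< with y ≟ v
      ... | yes p = inj₂ p
      ... | no  p = inj₁ (subst (_< n) (≔-miss δ (suc ℓ) p) v<)
      queue' : ∀ i → i < suc t → Q' i < n × δ' (Q' i) < n × δ' (Q' i) ≤ i
      queue' i i< with split i<
      ... | inj₁ p = let a , b , c = queue i p in
        subst (_< n) (sym (Q'i p)) a , subst (_< n) (sym (δ'Q'i p)) b , subst (_≤ i) (sym (δ'Q'i p)) c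
      ... | inj₂ refl = subst (_< n) (sym Q't) y< , subst (_< n) (sym δ'Q't) d< , subst (_≤ t)
          (sym δ'Q't) ℓ<t
      le' : ∀ v → v < n → δ' v ≤ n
      le' v v< with y ≟ v
      ... | yes refl = ≤-trans (≤-reflexive δ'y) (<⇒≤ d<)
      ... | no  p    = ≤-trans (≤-reflexive (≔-miss δ (suc ℓ) p)) (le v v<)
      seen' : ∀ v → v < n → δ' v < n → (∃[ i ] h ≤ i × i < suc t × Q' i ≡ v) ⊎ X δ' v
      seen' v v< s with old v s
      ... | inj₂ refl = inj₁ (t , h≤t , ≤-refl , Q't)
      ... | inj₁ o with seen v v< o
      ...   | inj₁ (i , a , b , c) = inj₁ (i , a , m≤n⇒m≤1+n b , Q'i b ∔ c)
      ...   | inj₂ X' = inj₂ (X-agrees agree o X')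
      sorted' : ∀ i j → h ≤ i → i ≤ j → j < suc t → δ' (Q' i) ≤ δ' (Q' j)
      sorted' i j hi ij j< with split j<
      ... | inj₁ p = subst₂ _≤_ (sym (δ'Q'i (≤-<-trans ij p))) (sym (δ'Q'i p)) (sorted i j hi ij p)
      ... | inj₂ refl with m≤n⇒m<n∨m≡n ij
      ...   | inj₂ refl = ≤-refl
      ...   | inj₁ i<   = subst₂ _≤_ (sym (δ'Q'i i<)) (sym δ'Q't)
                           (let a , b , _ = queue i i< in upper (Q i) a b)
      upper' : ∀ v → v < n → δ' v < n → δ' v ≤ suc ℓ
      upper' v v< s with old v s
      ... | inj₂ refl = ≤-reflexive δ'y
      ... | inj₁ o    = subst (_≤ suc ℓ) (sym (agree v o)) (upper v v< o)
      lower' : ∀ i → h ≤ i → i < suc t → ℓ ≤ δ' (Q' i)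
      lower' i hi i< with split i<
      ... | inj₁ p    = subst (ℓ ≤_) (sym (δ'Q'i p)) (lower i hi p)
      ... | inj₂ refl = subst (ℓ ≤_) (sym δ'Q't) (n≤1+n ℓ)
      walk' : ∀ v → v < n → δ' v < n → Walk x v (δ' v)
      walk' v v< s with old v s
      ... | inj₂ refl = subst (Walk x y) (sym δ'y) wy
      ... | inj₁ o    = subst (Walk x v) (sym (agree v o)) (walk v v< o)

    -- The level moves up to the head of the queue: `lower` puts the head at `ℓ` or beyond, which
    -- preserves `upper`, and `sorted` yields the new `lower`. The head leaves the queue before its
    -- edges are handled, so `X` has to make an exception for it.
    dequeue : ∀ {δ Q h t ℓ} → Inv Done δ Q h t ℓ → h < t →
      Inv (λ δ v → Done δ v ⊎ v ≡ Q h) δ Q (suc h) t (δ (Q h))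
    dequeue {δ} {Q} {h} {t} {ℓ} I h<t = record
      { Inv I hiding (h≤t; seen; sorted; upper; lower)
      ; h≤t = h<t
      ; seen = seen'
      ; sorted = λ i j hi → Inv.sorted I i j (<⇒≤ hi)
      ; upper = λ v v< s → ≤-trans (Inv.upper I v v< s) (s≤s (Inv.lower I h ≤-refl h<t))
      ; lower = λ i hi i< → Inv.sorted I h i ≤-refl (<⇒≤ hi) i<
      }
      where
      seen' : ∀ v → v < n → δ v < n → (∃[ i ] suc h ≤ i × i < t × Q i ≡ v) ⊎ (Done δ v ⊎ v ≡ Q h)
      seen' v v< s with Inv.seen I v v< s
      ... | inj₂ d = inj₂ (inj₁ d)
      ... | inj₁ (i , a , b , c) with m≤n⇒m<n∨m≡n a
      ...   | inj₁ p    = inj₁ (i , p , b , c)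
      ...   | inj₂ refl = inj₂ (inj₂ (sym c))

    finish : ∀ {δ Q h t ℓ u} → Inv (λ δ v → Done δ v ⊎ v ≡ u) δ Q h t ℓ → Done δ u → Inv Done δ Q h t ℓ
    finish {δ} I d = record { Inv I hiding (seen) ; seen = seen' }
      where
      seen' : ∀ v → v < n → δ v < n → _
      seen' v v< s with Inv.seen I v v< s
      ... | inj₁ p = inj₁ p
      ... | inj₂ (inj₁ q) = inj₂ q
      ... | inj₂ (inj₂ refl) = inj₂ d

    -- With an empty queue all seen vertices are `Done`, so an edge never leaves the seen vertices
    -- and raises `δ` by at most one. Following a walk from `x` then bounds `δ` by its length.
    exhausted : ∀ {δ Q h t ℓ} → Inv Done δ Q h t ℓ → t ≤ h → DistFrom n x δ
    exhausted {δ} {Q} {h} {t} I t≤h = record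
      { dist≤n = Inv.le I
      ; attained = Inv.walk I
      ; shortest = λ w → let a , b = along w x<n (subst (_< n) (sym (Inv.source I)) (≤-<-trans z≤n x<n)) in
          a , ≤-trans b (≤-reflexive (cong (_+ _) (Inv.source I)))
      }
      where
      done : ∀ v → v < n → δ v < n → Done δ v
      done v v< s with Inv.seen I v v< s
      ... | inj₂ d = d
      ... | inj₁ (i , a , b , _) = contradiction (≤-trans t≤h a) (<⇒≱ b)
      along : ∀ {y v k} → Walk y v k → y < n → δ y < n → δ v < n × δ v ≤ δ y + k
      along nil y< s = s , m≤m+n _ 0
      along {y} {v} {suc k} (cons {e} e< w) y< s =
        let a , b = done y y< s e e< refl
            c , d = along w (tgt< e e<) a in
        c , ≤-trans d (≤-trans (+-monoˡ-≤ k b) (≤-reflexive (sym (+-suc (δ y) k))))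

    start : ∀ δ Q → (∀ v → v < n → δ v ≡ n) →
            Inv Done (δ [ x ≔ᵣ 0 ]) (Q [ 0 ≔ᵣ x ]) 0 1 0
    start δ Q δn = record
      { h≤t = z≤n
      ; count = sym (unseen-mark (λ _ → 1) δ x<n (≤-reflexive (sym (δn x x<n))) (≤-<-trans z≤n x<n))
          ∔ all (λ _ → 1) ∔ ones n
      ; budget = cong (_+ sumTo (unseen weight (δ [ x ≔ᵣ 0 ])) n) (+-identityʳ (weight x)) ∔ sym
          (unseen-mark weight δ x<n (≤-reflexive (sym (δn x x<n))) (≤-<-trans z≤n x<n)) ∔ all weight
      ; queue = λ { zero _ → x<n , subst (_< n) (sym δx) (≤-<-trans z≤n x<n) , ≤-reflexive δx ;
          (suc _) (s≤s ()) }
      ; le = λ v v< → case x ≟ v of λ { (yes refl) → ≤-trans (≤-reflexive δx) z≤n ; (no p) → ≤-reflexive (≔-miss δ 0 p ∔ δn v v<) }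
      ; seen = λ v v< s → inj₁ (0 , z≤n , s≤s z≤n , only v v< s)
      ; sorted = λ { zero zero _ _ _ → ≤-refl ; _ (suc _) _ _ (s≤s ()) }
      ; upper = λ v v< s → ≤-trans (≤-reflexive (cong (δ [ x ≔ᵣ 0 ]) (sym (only v v< s)) ∔ δx)) z≤n
      ; lower = λ _ _ _ → z≤n
      ; walk = λ v v< s → subst₂ (Walk x) (only v v< s)
          (sym (cong (δ [ x ≔ᵣ 0 ]) (sym (only v v< s)) ∔ δx)) nil
      ; source = δx
      }
      where
      δx : (δ [ x ≔ᵣ 0 ]) x ≡ 0
      δx = ≔-hit δ 0 refl
      only : ∀ v → v < n → (δ [ x ≔ᵣ 0 ]) v < n → x ≡ v
      only v v< s with x ≟ v
      ... | yes p = p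
      ... | no  p = contradiction (subst (_< n) (≔-miss δ 0 p ∔ δn v v<) s) (<-irrefl refl)
      all : ∀ g → sumTo (unseen g δ) n ≡ sumTo g n
      all g = sumTo-cong n λ v v< → unseen-new g δ (≤-reflexive (sym (δn v v<)))
      ones : ∀ k → sumTo (λ _ → 1) k ≡ k
      ones zero    = refl
      ones (suc k) = cong suc (ones k)

reverse : ∀ {m src tgt x y k} → Graph.Walk m src tgt x y k → Graph.Walk m tgt src y x k
reverse Graph.nil         = Graph.nil
reverse {m} {src} {tgt} (Graph.cons e< w) = Graph.snoc m tgt src (reverse w) e<

-- Breadth-first search as a program

zr rN rM rK rL rS two bS bH bT bU bD bP bV bX bI : Reg
zr = 0
rN = 1
rM = 2
rK = 3
rL = 4
rS = 5
two = 6
bS = 7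
bH = 8
bT = 9
bU = 10
bD = 11
bP = 12
bV = 13
bX = 14
bI = 15

-- The search starts from bS, with distances in array 0, the queue in array 1 (between bH and
-- bT), and the graph in arrays 2 + hd, 2 + nx, 2 + tg.
bfs-edge : ℕ → ℕ → Cmd
bfs-edge nx tg = blk (ld bV (2 + tg) bP ∷ ld bX 0 bV ∷ ld bP (2 + nx) bP ∷ [])
  ⨾ ifl bX rN (blk []) (blk (st 0 bV bD ∷ st 1 bT bV ∷ inc bT ∷ []))

bfs-vertex : ℕ → ℕ → ℕ → Cmd
bfs-vertex hd nx tg = blk (ld bU 1 bH ∷ inc bH ∷ ld bD 0 bU ∷ inc bD ∷ ld bP (2 + hd) bU ∷ [])
  ⨾ whl zr bP (bfs-edge nx tg)

bfs-init : Cmd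
bfs-init = blk (st 0 bS zr ∷ clr bH ∷ clr bT ∷ st 1 bT bS ∷ inc bT ∷ [])

bfs : ℕ → ℕ → ℕ → Cmd
bfs hd nx tg = forC bI rN (blk (st 0 bI rN ∷ [])) ⨾ bfs-init ⨾ whl bH bT (bfs-vertex hd nx tg)

<suc-cases : ∀ {k} {A : ℕ → Set} → A k → (∀ v → v < k → A v) → ∀ v → v < suc k → A v
<suc-cases {k} a h v v< with m≤n⇒m<n∨m≡n (s≤s⁻¹ v<)
... | inj₁ p    = h v p
... | inj₂ refl = a

module Search (cell : ℕ → ℕ) (|cells| bound : ℕ) (n m : ℕ) where

  open Semantics cell |cells| bound

  -- The terms are for filling the distances with `n`, the initial block, the last test of the
  -- queue, and the total `weight`.
  bfsCost : ℕ
  bfsCost = 3 + n * 4 + (5 + (2 + (10 * n + 10 * m)))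

  -- The code is shared by the graph and its reverse, which differ in the arrays used and in the
  -- roles of `src` and `tgt`.
  module Direction (src tgt : ℕ → ℕ)
    (src< : ∀ e → e < m → src e < n) (tgt< : ∀ e → e < m → tgt e < n) (hd nx tg : ℕ) where

    open Graph m src tgt

    record Adjacency (s : St) : Set where
      field
        headA : ∀ u → u < n → arr s (2 + hd) u ≡ last m u
        nextA : ∀ e → e < m → arr s (2 + nx) (suc e) ≡ last e (src e)
        tgtA  : ∀ e → e < m → arr s (2 + tg) (suc e) ≡ tgt e

    open Adjacency

    adjacency-cong : ∀ {s s'} → (∀ j i → arr s' (2 + j) i ≡ arr s (2 + j) i) →
                     Adjacency s → Adjacency s'
    adjacency-cong h a = record
      { headA = λ u u< → h hd u ∔ headA a u u<
      ; nextA = λ e e< → h nx (suc e) ∔ nextA a e e<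
      ; tgtA  = λ e e< → h tg (suc e) ∔ tgtA a e e< }

    module _ (x : ℕ) (x<n : x < n) where

      open BreadthFirst n x x<n src< tgt<

      module Vertex (s : St) (adj : Adjacency s) (N≡ : reg s rN ≡ n) (z≡ : reg s zr ≡ 0)
        {ℓ : ℕ} (inv : Inv Done (arr s 0) (arr s 1) (reg s bH) (reg s bT) ℓ)
        (h<t : reg s bH < reg s bT) where

        u d : ℕ
        u = arr s 1 (reg s bH)
        d = arr s 0 u

        u<n : u < n
        u<n = Inv.queue inv _ h<t .proj₁
        d<n : d < n
        d<n = Inv.queue inv _ h<t .proj₂ .proj₁

        s₁ : St
        s₁ = do* (ld bU 1 bH ∷ inc bH ∷ ld bD 0 bU ∷ inc bD ∷ ld bP (2 + hd) bU ∷ []) s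

        X : (ℕ → ℕ) → ℕ → Set
        X δ v = Done δ v ⊎ v ≡ u

        X-agrees : ∀ {δ δ' v} → Agrees δ δ' → δ v < n → X δ v → X δ' v
        X-agrees a v< (inj₁ q) = inj₁ (done-agrees a v< q)
        X-agrees a v< (inj₂ q) = inj₂ q

        -- Edges leaving u are handled from the last to the first; those from k on are done.
        record Handled (k : ℕ) (s' : St) : Set where
          field
            k≤m  : k ≤ m
            ptr  : reg s' bP ≡ last k u
            keep : Inv X (arr s' 0) (arr s' 1) (reg s₁ bH) (reg s' bT) d
            from : arr s' 0 u ≡ d
            d<t  : d < reg s' bT
            used : sumTo (weight ∘ arr s' 1) (reg s₁ bH) ≡ sumTo (weight ∘ arr s 1) (reg s₁ bH)
            rest : ∀ e → k ≤ e → e < m → src e ≡ u → arr s' 0 (tgt e) < n × arr s' 0 (tgt e) ≤ suc d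

        open Handled

        handled₁ : Handled m s₁
        handled₁ = record { k≤m = ≤-refl ; ptr = headA adj u u<n ; keep = dequeue inv h<t ; from =
            refl ; used = refl
          ; d<t = ≤-<-trans (Inv.queue inv _ h<t .proj₂ .proj₂) h<t
          ; rest = λ e le e< → contradiction le (<⇒≱ e<) }

        I : ℕ → St → Set
        I κ s' = ∃[ k ] κ ≡ 10 * deg k u × Handled k s'

        edge : ∀ κ s' → Frame (bfs-edge nx tg) s₁ s' → I κ s' → reg s' zr < reg s' bP →
               ∃₂ λ κ₁ κ₂ → (2 + κ₁ + κ₂ ≤ κ) × Ex (bfs-edge nx tg) κ₁ s' (I κ₂)
        edge κ s' f (k , κ≡ , H) z<P with last-view k u
        ... | none l _ = contradiction (subst (reg s' zr <_) (ptr H ∔ l) z<P) λ ()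
        -- 8 is 3 for the first block, 2 for the test and 3 for the longer branch; with 2 for the
        -- loop test this is the 10 per edge in `weight`.
        ... | some e e<k l se between dg = 8 , 10 * deg e u ,
              ≤-reflexive (sym (*-suc 10 (deg e u)) ∔ cong (10 *_) (sym dg) ∔ sym κ≡) ,
              seqE (blkE {Q = λ s'' → s'' ≡ s₂} tt refl)
                (λ { _ refl → iflE (λ le → subE z≤n (blkE tt (e , refl , seen-case le)))
                                   (λ ge → blkE tt (e , refl , new-case ge)) })
          where
          s₂ = do* (ld bV (2 + tg) bP ∷ ld bX 0 bV ∷ ld bP (2 + nx) bP ∷ []) s'
          e<m : e < m
          e<m = ≤-trans e<k (k≤m H)
          P≡ : reg s' bP ≡ suc e
          P≡ = ptr H ∔ l
          adj' : Adjacency s'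
          adj' = adjacency-cong {s} {s'} (λ j i → arrF f (2 + j) refl i) adj
          V≡ : reg s₂ bV ≡ tgt e
          V≡ = cong (arr s' (2 + tg)) P≡ ∔ tgtA adj' e e<m
          ptr₂ : reg s₂ bP ≡ last e u
          ptr₂ = cong (arr s' (2 + nx)) P≡ ∔ nextA adj' e e<m ∔ cong (last e) se
          N₂ : reg s₂ rN ≡ n
          N₂ = regF f rN refl ∔ N≡
          D₂ : reg s₂ bD ≡ suc d
          D₂ = regF f bD refl
          V<n : reg s₂ bV < n
          V<n = subst (_< n) (sym V≡) (tgt< e e<m)
          rest' : ∀ (δ : ℕ → ℕ) → Agrees (arr s' 0) δ → δ (tgt e) < n × δ (tgt e) ≤ suc d →
                  ∀ e' → e ≤ e' → e' < m → src e' ≡ u → δ (tgt e') < n × δ (tgt e') ≤ suc d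
          rest' δ a te e' le e'< se' with m≤n⇒m<n∨m≡n le
          ... | inj₂ refl = te
          ... | inj₁ p with k ≤? e'
          ...   | yes q = let b , c = rest H e' q e'< se' ; r = a (tgt e') b in
                          subst (_< n) (sym r) b , subst (_≤ suc d) (sym r) c
          ...   | no  q = contradiction se' (between e' p (≰⇒> q))
          seen-case : reg s₂ bX < reg s₂ rN → Handled e s₂
          seen-case le = record { k≤m = <⇒≤ e<m ; ptr = ptr₂ ; keep = keep H ; from = from H ; d<t =
              d<t H ; used = used H
            ; rest = rest' (arr s' 0) (λ _ _ → refl)
                (te< , Inv.upper (keep H) _ (tgt< e e<m) te<) }
            where te< : arr s' 0 (tgt e) < n
                  te< = subst₂ _<_ (cong (arr s' 0) V≡) N₂ le
          new-case : reg s₂ rN ≤ reg s₂ bX →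
            Handled e (do* (st 0 bV bD ∷ st 1 bT bV ∷ inc bT ∷ []) s₂)
          new-case ge = record { k≤m = <⇒≤ e<m ; ptr = ptr₂
            ; keep = subst (λ z → Inv X (arr s' 0 [ reg s₂ bV ≔ᵣ z ])
                (arr s' 1 [ reg s' bT ≔ᵣ reg s₂ bV ]) (reg s₁ bH) (suc (reg s' bT)) d)
                (sym D₂) (visit {X} (keep H) X-agrees V<n new (d<t H) walk')
            ; from = agree u (subst (_< n) (sym (from H)) d<n) ∔ from H
            ; d<t = m≤n⇒m≤1+n (d<t H)
            ; used = sumTo-cong (reg s₁ bH) (λ i i< → cong weight (≔-miss (arr s' 1) (reg s₂ bV)
                (λ t≡i → <⇒≱ i< (subst (reg s₁ bH ≤_) t≡i (Inv.h≤t (keep H)))))) ∔ used H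
            ; rest = rest' δ' agree (subst (_< n) (sym te) sd<n , ≤-reflexive te) }
            where
            δ' = arr s' 0 [ reg s₂ bV ≔ᵣ reg s₂ bD ]
            new : n ≤ arr s' 0 (reg s₂ bV)
            new = subst (_≤ arr s' 0 (reg s₂ bV)) N₂ ge
            agree : Agrees (arr s' 0) δ'
            agree = mark-agrees (arr s' 0) new
            te : δ' (tgt e) ≡ suc d
            te = ≔-hit (arr s' 0) (reg s₂ bD) V≡ ∔ D₂
            walk' : Walk x (reg s₂ bV) (suc d)
            walk' = subst (λ z → Walk x z (suc d)) (sym V≡)
              (snoc (subst₂ (Walk x) (sym se) (from H)
                  (Inv.walk (keep H) u u<n (subst (_< n) (sym (from H)) d<n))) e<m)
            -- `visit` has already proved this; it is read back from its `queue` field at the new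
            -- entry.
            sd<n : suc d < n
            sd<n = let I' = visit {X} (keep H) X-agrees V<n new (d<t H) walk' in
              subst (_< n) (cong (arr s' 0 [ reg s₂ bV ≔ᵣ suc d ])
                  (≔-hit (arr s' 1) (reg s₂ bV) refl) ∔ ≔-hit (arr s' 0) (suc d) refl)
                (Inv.queue I' (reg s' bT) ≤-refl .proj₂ .proj₁)

        edges-done : ∀ κ s' → Frame (bfs-edge nx tg) s₁ s' → I κ s' → reg s' bP ≤ reg s' zr →
          Inv Done (arr s' 0) (arr s' 1) (suc (reg s bH)) (reg s' bT) d × reg s' bH ≡ suc (reg s bH)
            × sumTo (weight ∘ arr s' 1) (suc (reg s bH)) ≡ sumTo (weight ∘ arr s 1) (suc (reg s bH))
        edges-done κ s' f (k , κ≡ , H) ge with last-view k u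
        ... | some e e<k l _ _ _ = contradiction
                (subst₂ _≤_ (ptr H ∔ l) (regF f zr refl ∔ z≡) ge) λ ()
        ... | none _ no-e = finish (keep H) done , regF f bH refl , used H
          where
          done : Done (arr s' 0) u
          done e e<m se with k ≤? e
          ... | yes p = subst (λ z → arr s' 0 (tgt e) < n × arr s' 0 (tgt e) ≤ suc z) (sym (from H))
              (rest H e p e<m se)
          ... | no  p = contradiction se (no-e e (≰⇒> p))

      module Whole (s : St) (adj : Adjacency s) (N≡ : reg s rN ≡ n) (z≡ : reg s zr ≡ 0)
        (S≡ : reg s bS ≡ x) where

        J : ℕ → St → Set
        J κ s' = (∃[ ℓ ] Inv Done (arr s' 0) (arr s' 1) (reg s' bH) (reg s' bT) ℓ)
          × κ + sumTo (weight ∘ arr s' 1) (reg s' bH) ≡ sumTo weight n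

        vertex : ∀ κ s' → Adjacency s' → reg s' rN ≡ n → reg s' zr ≡ 0 → J κ s' → reg s' bH < reg s' bT →
                 ∃₂ λ κ₁ κ₂ → (2 + κ₁ + κ₂ ≤ κ) × Ex (bfs-vertex hd nx tg) κ₁ s' (J κ₂)
        vertex κ s' adj' N' z' ((ℓ , inv) , κ≡) h<t =
          -- 5 for the block, 2 for the last test of the inner loop, and 10 per edge. With the outer
          -- test this is one less than `weight u`.
          7 + 10 * deg m u , κ ∸ weight u , ≤-trans (≤-reflexive (+-comm (9 + 10 * deg m u) (κ ∸ weight u)))
              (≤-trans (+-monoʳ-≤ (κ ∸ weight u) (n≤1+n (9 + 10 * deg m u))) (≤-reflexive (m∸n+n≡m w≤))) ,
            seqE {κ = 5} {κ' = 2 + 10 * deg m u} (blkE {Q = λ s'' → s'' ≡ s₁} tt refl)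
              (λ { _ refl → whileR I {Q = J (κ ∸ weight u)} s₁ edge
                 (λ κ' s'' f i ge → let a , b , c = edges-done κ' s'' f i ge in
                    (d , subst (λ z → Inv Done (arr s'' 0) (arr s'' 1) z (reg s'' bT) d) (sym b) a) ,
                    cong₂ _+_ refl (cong (sumTo (weight ∘ arr s'' 1)) b ∔ c)
                      ∔ sym (+-assoc (κ ∸ weight u) (weight u) _) ∔ cong (_+ _) (m∸n+n≡m w≤) ∔ κ≡)
                 (10 * deg m u) (m , refl , handled₁) })
          where
          open Vertex s' adj' N' z' inv h<t
          P : ℕ → ℕ
          P = sumTo (weight ∘ arr s' 1)
          -- By `budget`, the weights of the head and of all entries before it fit into the total.
          w≤ : weight u ≤ κ
          w≤ = +-cancelʳ-≤ (P (reg s' bH)) (weight u) κ (≤-trans (sumTo-≤ (weight ∘ arr s' 1) h<t)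
                 (≤-trans (≤-trans (m≤m+n _ _) (≤-reflexive (Inv.budget inv))) (≤-reflexive (sym κ≡))))

        search : Ex (bfs hd nx tg) bfsCost s (λ s' → DistFrom n x (arr s' 0))
        search = seqE (forR {n = n} {κ = 1} (λ k s' → ∀ v → v < k → arr s' 0 v ≡ n)
            {Q = λ s' → Frame (forC bI rN (blk (st 0 bI rN ∷ []))) s s' × (∀ v → v < n → arr s' 0 v ≡ n)}
            s N≡ refl refl (λ _ ())
            (λ k s' k< f i≡ j → blkE tt λ _ → <suc-cases
                (≔-hit (arr s' 0) (reg s' rN) i≡ ∔ regF f rN refl ∔ N≡)
                (λ v v< → ≔-miss (arr s' 0) (reg s' rN) (λ e → <-irrefl (sym (sym i≡ ∔ e)) v<) ∔ j v v<))
            (λ s' f j → f , j))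
          (λ { s₁ (f₁ , all-n) → seqE (blkE {Q = λ s'' → s'' ≡ do* init s₁} tt refl) λ { _ refl →
            whileR J {Q = λ s' → DistFrom n x (arr s' 0)} (do* init s₁)
              (λ κ s' f j h<t → vertex κ s'
                 (adjacency-cong {s} {s'} (λ j i → arrF f (2 + j) refl i ∔ arrF f₁ (2 + j) refl i) adj)
                 (regF f rN refl ∔ regF f₁ rN refl ∔ N≡) (regF f zr refl ∔ regF f₁ zr refl ∔ z≡) j h<t)
              (λ κ s' f j ge → exhausted (j .proj₁ .proj₂) ge)
              (10 * n + 10 * m)
              ((0 , subst₂ (λ a b → Inv Done (arr s₁ 0 [ a ≔ᵣ b ]) (arr s₁ 1 [ 0 ≔ᵣ a ]) 0 1 0)
                      (sym (regF f₁ bS refl ∔ S≡)) (sym (regF f₁ zr refl ∔ z≡))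
                          (start (arr s₁ 0) (arr s₁ 1) all-n)) ,
               +-identityʳ _ ∔ sym (sumTo-linear 10 10 (deg m) n ∔ cong (λ z → 10 * n + 10 * z)
                   (sumTo-deg m src<))) } })
          where
          init = st 0 bS zr ∷ clr bH ∷ clr bT ∷ st 1 bT bS ∷ inc bT ∷ []

-- The algorithm

rI rJ rX rY best yst vst rho cnt rE rU rA rB arg : Reg
rI = 16
rJ = 17
rX = 18
rY = 19
best = 20
yst = 21
vst = 22
rho = 23
cnt = 24
rE = 25
rU = 26
rA = 27
rB = 28
arg = 29

-- Arrays 2, 3, 4 and 5, 6, 7 hold the graph and its reverse, array 8 is F, array 9 is D, and
-- array 10 keeps the distances to the vertex that maximises D.
setup : List Atom
setup =
  clr zr ∷ clr rX ∷ inp rN rX ∷ inc rX ∷ inp rM rX ∷ clr two ∷ inc two ∷ inc two ∷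
  mov best rN ∷ mov rX rM ∷ inc rX ∷ []

sqrtC : Cmd
sqrtC = blk (clr rK ∷ []) ⨾ forC rI rN
  (blk (mov rA rK ∷ inc rA ∷ mul rB rA rA ∷ mov rX rI ∷ inc rX ∷ [])
   ⨾ ifl rX rB (blk []) (blk (mov rK rA ∷ [])))

logC : Cmd
logC = blk (clr rL ∷ clr rA ∷ inc rA ∷ []) ⨾ forC rI rN
  (ifl rI rA (blk []) (blk (inc rL ∷ mul rA rA two ∷ [])))

countC : ℕ → Cmd
countC A = blk (set rS A ∷ mul rS rS rL ∷ mul rS rS rK ∷ [])

build-edge : List Atom
build-edge =
  inp rX arg ∷ inc arg ∷ inp rY arg ∷ inc arg ∷ mov rB rI ∷ inc rB ∷
  ld rA 2 rX ∷ st 3 rB rA ∷ st 2 rX rB ∷ st 4 rB rY ∷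
  ld rA 5 rY ∷ st 6 rB rA ∷ st 5 rY rB ∷ st 7 rB rX ∷ []

buildC : Cmd
buildC = blk (mov arg two ∷ []) ⨾ forC rI rM (blk build-edge)

fillC : Cmd
fillC = forC rI rN (blk (st 9 rI rN ∷ []))

-- `rX` holds the old entry and `rY` the new distance, so `merge rX rY` keeps maxima and
-- `merge rY rX` minima. Writing the array as `2 + j` lets frames show by computation that array 0
-- is untouched.
merge : Reg → Reg → ℕ → Cmd
merge a b j = forC rJ rN (blk (ld rX (2 + j) rJ ∷ ld rY 0 rJ ∷ [])
  ⨾ ifl a b (blk (st (2 + j) rJ rY ∷ [])) (blk []))

sampleC : Cmd
sampleC = samp bS rN ⨾ bfs 3 4 5 ⨾ merge rX rY 6 ⨾ bfs 0 1 2 ⨾ merge rY rX 7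

-- `rX` is the challenger and `rY` the current choice, so `select rX rY` finds a minimum and
-- `select rY rX` a maximum.
select : Reg → Reg → ℕ → Cmd
select a b j = blk (clr arg ∷ []) ⨾ forC rJ rN (blk (ld rX j rJ ∷ ld rY j arg ∷ [])
  ⨾ ifl a b (blk (mov arg rJ ∷ [])) (blk []))

tryC : Cmd
tryC = bfs 0 1 2 ⨾ blk (clr rE ∷ [])
  ⨾ forC rJ rN (blk (ld rX 0 rJ ∷ []) ⨾ ifl rE rX (blk (mov rE rX ∷ [])) (blk []))
  ⨾ ifl rE best (blk (mov best rE ∷ [])) (blk [])

-- The cap `K` on the number of searches keeps the running time within the bound even for an unlucky
-- sample. It never takes effect when there are fewer than `K` candidates.
candidate : Cmd
candidate = blk (ld rX 10 rU ∷ [])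
  ⨾ ifl rX rho (ifl cnt rK (blk (inc cnt ∷ mov bS rU ∷ []) ⨾ tryC) (blk [])) (blk [])

candidatesC : Cmd
candidatesC = blk (clr cnt ∷ clr rU ∷ []) ⨾ whl rU rN (candidate ⨾ blk (inc rU ∷ []))

finishC : Cmd
finishC = ifl best rN (blk (inc best ∷ [])) (blk (clr best ∷ []))

copyC : Cmd
copyC = forC rJ rN (blk (ld rX 0 rJ ∷ st 10 rJ rX ∷ []))

workC : ℕ → Cmd
workC A = sqrtC ⨾ logC ⨾ countC A ⨾ buildC ⨾ fillC ⨾ forC rI rS sampleC
  ⨾ select rX rY 8 ⨾ blk (mov yst arg ∷ []) ⨾ select rY rX 9 ⨾ blk (mov vst arg ∷ [])
  ⨾ blk (mov bS yst ∷ []) ⨾ tryC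
  ⨾ blk (mov bS vst ∷ ld rho 9 vst ∷ []) ⨾ bfs 3 4 5 ⨾ copyC
  ⨾ candidatesC

-- After `setup`, `rX` holds `m + 1`. If this is below `n`, no vertex reaches all others: `best`
-- keeps its initial value `n`, and the output is ∞.
mainC : ℕ → Cmd
mainC A = blk setup ⨾ ifl rX rN (blk []) (workC A) ⨾ finishC

valid-mainC : ∀ A → valid (mainC A) ≡ true
valid-mainC A = refl

-- Cost and correctness of the routines

n<2^n : ∀ n → n < 2 ^ n
n<2^n zero    = s≤s z≤n
n<2^n (suc n) = +-mono-≤ (m^n>0 2 n) (≤-trans (n<2^n n) (m≤m+n (2 ^ n) 0))

√-step : ∀ k → suc k < suc ⌊√ k ⌋ * suc ⌊√ k ⌋ → ⌊√ suc k ⌋ ≡ ⌊√ k ⌋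
√-step k p with suc ⌊√ k ⌋ * suc ⌊√ k ⌋ ≤ᵇ suc k in eq
... | false = refl
... | true  = contradiction (≤ᵇ⇒≤ (suc ⌊√ k ⌋ * suc ⌊√ k ⌋) (suc k) (subst IsTrue (sym eq) tt)) (<⇒≱ p)

√-jump : ∀ k → suc ⌊√ k ⌋ * suc ⌊√ k ⌋ ≤ suc k → ⌊√ suc k ⌋ ≡ suc ⌊√ k ⌋
√-jump k p with suc ⌊√ k ⌋ * suc ⌊√ k ⌋ ≤ᵇ suc k | ≤⇒≤ᵇ p
... | true | _ = refl

√-≤ : ∀ k → ⌊√ k ⌋ ≤ k
√-≤ zero = z≤n
√-≤ (suc k) with suc ⌊√ k ⌋ * suc ⌊√ k ⌋ ≤ᵇ suc k
... | true  = s≤s (√-≤ k)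
... | false = m≤n⇒m≤1+n (√-≤ k)

module Sizes (A n m : ℕ) (cell : ℕ → ℕ) (n>0 : 0 < n) where

  -- Large enough for all products formed: squares up to `n * n`, powers of two up to `2 * n`, and
  -- the sample size, for which the crude `L ≤ 2 * n` and `K ≤ n` give `2 * A * (n * n)`.
  bound : ℕ
  bound = (2 + 2 * A) * (n * n)

  open Semantics cell (2 + 2 * m) bound
  open Search cell (2 + 2 * m) bound n m

  src tgt : ℕ → ℕ
  src e = cell (2 + 2 * e)
  tgt e = cell (3 + 2 * e)

  n≤n² : n ≤ n * n
  n≤n² = ≤-trans (≤-reflexive (sym (*-identityˡ n))) (*-monoˡ-≤ n n>0)

  n²≤ : ∀ c → c ≤ 2 + 2 * A → c * (n * n) ≤ bound
  n²≤ c = *-monoˡ-≤ (n * n)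

  sqrtE : ∀ s → reg s rN ≡ n →
    Ex sqrtC (1 + (3 + n * (3 + (5 + (2 + 1))))) s (λ s' → reg s' rK ≡ ⌊√ n ⌋)
  sqrtE s N≡ = seqE (blkE {Q = λ s' → s' ≡ s₁} tt refl) λ { _ refl →
    forR {n = n} {κ = 5 + (2 + 1)} (λ k s' → reg s' rK ≡ ⌊√ k ⌋) s₁ N≡ refl refl refl
      (λ k s' k< f i≡ j → seqE {κ' = 2 + 1} (blkE {Q = λ s'' → s'' ≡ do* pre s'}
          (subst (λ r → suc r * suc r ≤ bound) (sym j) (≤-trans (*-mono-≤ (r≤ k k<) (r≤ k k<))
             (≤-trans (≤-reflexive (sym (*-identityˡ (n * n)))) (n²≤ 1 (s≤s z≤n)))) , tt) refl)
        λ { _ refl → iflE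
          (λ le → subE z≤n (blkE tt λ _ → j ∔ sym (√-step k
              (subst₂ (λ x r → suc x < suc r * suc r) i≡ j le))))
          (λ ge → blkE tt λ _ → cong suc j ∔ sym (√-jump k
              (subst₂ (λ x r → suc r * suc r ≤ suc x) i≡ j ge))) })
      (λ s' f j → j) }
    where
    s₁ = do1 (clr rK) s
    pre = mov rA rK ∷ inc rA ∷ mul rB rA rA ∷ mov rX rI ∷ inc rX ∷ []
    r≤ : ∀ k → k < n → suc ⌊√ k ⌋ ≤ n
    r≤ k k< = ≤-trans (s≤s (√-≤ k)) k<

  -- Of the two bounds on `2 ^ L`, the lower one makes the sample large enough and the upper one
  -- keeps the running time small.
  logE : ∀ s → reg s rN ≡ n → reg s two ≡ 2 →
    Ex logC (3 + (3 + n * (3 + (2 + 2)))) s (λ s' → ∃[ L ] reg s' rL ≡ L × n ≤ 2 ^ L × 2 ^ L ≤ 2 * n)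
  logE s N≡ two≡ = seqE (blkE {Q = λ s' → s' ≡ s₁} tt refl) λ { _ refl →
    forR {n = n} {κ = 2 + 2} (λ k s' → ∃[ L ] reg s' rL ≡ L × reg s' rA ≡ 2 ^ L × k ≤ 2 ^ L × 2 ^ L ≤ 2 * n)
      s₁ N≡ refl refl (0 , refl , refl , z≤n , ≤-trans n>0 (m≤m+n n _))
      (λ { k s' k< f i≡ (L , L≡ , p≡ , k≤ , p≤) → iflE
        (λ le → subE z≤n (blkE tt λ _ → L , L≡ , p≡ , subst₂ _<_ i≡ p≡ le , p≤))
        -- The counter has caught up with the power: by the invariant `k = 2 ^ L`, so doubling gives
        -- `2 * k ≤ 2 * n`.
        (λ ge → blkE ((subst₂ (λ x y → x * y ≤ bound) (sym (k≡ L ge i≡ p≡ k≤))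
            (sym (regF f two refl ∔ two≡))
             (≤-trans (*-monoˡ-≤ 2 (<⇒≤ k<)) (≤-trans
                 (≤-trans (≤-reflexive (*-comm n 2)) (*-monoʳ-≤ 2 n≤n²)) (n²≤ 2 (m≤m+n 2 _))))) , tt)
          λ _ → suc L , cong suc L≡ , cong₂ _*_ p≡ (regF f two refl ∔ two≡) ∔ *-comm (2 ^ L) 2 ,
             ≤-trans (≤-reflexive (cong suc (sym (k≡ L ge i≡ p≡ k≤) ∔ p≡)))
                 (+-mono-≤ (m^n>0 2 L) (m≤m+n (2 ^ L) 0)) ,
             *-monoʳ-≤ 2 (≤-trans (≤-reflexive (sym p≡ ∔ k≡ L ge i≡ p≡ k≤)) (<⇒≤ k<))) })
      (λ { s' f (L , L≡ , p≡ , k≤ , p≤) → L , L≡ , k≤ , p≤ }) }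
    where
    s₁ = do* (clr rL ∷ clr rA ∷ inc rA ∷ []) s
    k≡ : ∀ L {k a i} → a ≤ i → i ≡ k → a ≡ 2 ^ L → k ≤ 2 ^ L → a ≡ k
    k≡ L ge refl refl le = ≤-antisym ge le

  countE : ∀ s L → reg s rL ≡ L → 2 ^ L ≤ 2 * n → reg s rK ≡ ⌊√ n ⌋ →
    Ex (countC A) 3 s (λ s' → reg s' rS ≡ A * L * ⌊√ n ⌋)
  countE s L L≡ p≤ K≡ = blkE
    (≤-trans (≤-trans (m≤n*m A 2) (m≤n+m (2 * A) 2))
        (≤-trans (≤-reflexive (sym (*-identityʳ (2 + 2 * A)))) (*-monoʳ-≤ (2 + 2 * A) (≤-trans n>0 n≤n²)))
    , ≤-trans (≤-trans (≤-reflexive (cong (A *_) L≡)) (m≤m*n' (A * L) n)) big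
    , ≤-trans (*-mono-≤ (≤-reflexive (cong (A *_) L≡)) (≤-trans (≤-reflexive K≡) (√-≤ n))) big , tt)
    (cong₂ _*_ (cong (A *_) L≡) K≡)
    where
    m≤m*n' : ∀ a b → {{0 < b}} → a ≤ a * b
    m≤m*n' a b {{p}} = ≤-trans (≤-reflexive (sym (*-identityʳ a))) (*-monoʳ-≤ a p)
    instance pos = n>0
    L≤ : L ≤ 2 * n
    L≤ = ≤-trans (<⇒≤ (n<2^n L)) p≤
    big : A * L * n ≤ bound
    big = ≤-trans (*-monoˡ-≤ n (*-monoʳ-≤ A L≤)) (≤-trans (≤-reflexive (regroup A n))
        (n²≤ (2 * A) (m≤n+m (2 * A) 2)))
      where regroup : ∀ A n → A * (2 * n) * n ≡ 2 * A * (n * n)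
            regroup = solve-∀

module Routines (A n m : ℕ) (cell : ℕ → ℕ) (n>0 : 0 < n)
  (src<′ : ∀ e → e < m → cell (2 + 2 * e) < n) (tgt<′ : ∀ e → e < m → cell (3 + 2 * e) < n) where

  open Sizes A n m cell n>0 public
  open Semantics cell (2 + 2 * m) bound
  open Search cell (2 + 2 * m) bound n m

  src< : ∀ e → e < m → src e < n
  src< = src<′
  tgt< : ∀ e → e < m → tgt e < n
  tgt< = tgt<′

  module Out = Direction src tgt src< tgt< 0 1 2
  module In  = Direction tgt src tgt< src< 3 4 5
  module GO  = Graph m src tgt
  module GI  = Graph m tgt src

  record Env (s : St) : Set where
    field
      N≡   : reg s rN ≡ n
      zr≡  : reg s zr ≡ 0
      adjO : Out.Adjacency s
      adjI : In.Adjacency s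

  open Env

  -- One boolean for all the obligations of `Env`, so that a single `refl` carries the graph across
  -- a command.
  harmful : Cmd → Bool
  harmful c = wr c rN ∨ wr c zr ∨ wa c 2 ∨ wa c 3 ∨ wa c 4 ∨ wa c 5 ∨ wa c 6 ∨ wa c 7

  env-frame : ∀ {c s s'} → harmful c ≡ false → Frame c s s' → Env s → Env s'
  env-frame {c} h f E =
    let h₁ , r₁ = ∨-false (wr c rN) h ; h₂ , r₂ = ∨-false (wr c zr) r₁
        h₃ , r₃ = ∨-false (wa c 2) r₂ ; h₄ , r₄ = ∨-false (wa c 3) r₃ ; h₅ , r₅ = ∨-false (wa c 4) r₄
        h₆ , r₆ = ∨-false (wa c 5) r₅ ; h₇ , h₈ = ∨-false (wa c 6) r₆ in
    record
      { N≡ = regF f rN h₁ ∔ N≡ E ; zr≡ = regF f zr h₂ ∔ zr≡ E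
      ; adjO = record
          { headA = λ u u< → arrF f 2 h₃ u ∔ Out.Adjacency.headA (adjO E) u u<
          ; nextA = λ e e< → arrF f 3 h₄ (suc e) ∔ Out.Adjacency.nextA (adjO E) e e<
          ; tgtA  = λ e e< → arrF f 4 h₅ (suc e) ∔ Out.Adjacency.tgtA (adjO E) e e< }
      ; adjI = record
          { headA = λ u u< → arrF f 5 h₆ u ∔ In.Adjacency.headA (adjI E) u u<
          ; nextA = λ e e< → arrF f 6 h₇ (suc e) ∔ In.Adjacency.nextA (adjI E) e e<
          ; tgtA  = λ e e< → arrF f 7 h₈ (suc e) ∔ In.Adjacency.tgtA (adjI E) e e< } }

  record Built (src tgt : ℕ → ℕ) (H N T : ℕ → ℕ) (k : ℕ) : Set where
    field
      head≡ : ∀ u → H u ≡ Graph.last m src tgt k u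
      next≡ : ∀ e → e < k → N (suc e) ≡ Graph.last m src tgt e (src e)
      tgt≡  : ∀ e → e < k → T (suc e) ≡ tgt e

  built-step : ∀ {src tgt H N T k x y} → Built src tgt H N T k → x ≡ src k → y ≡ tgt k →
    Built src tgt (H [ x ≔ᵣ suc k ]) (N [ suc k ≔ᵣ H x ]) (T [ suc k ≔ᵣ y ]) (suc k)
  built-step {src} {tgt} {H} {N} {T} {k} B refl refl = record
    { head≡ = λ u → if-cong (src k ≡ᵇ u) (head≡ u)
    ; next≡ = <suc-cases (≔-hit N (H (src k)) refl ∔ head≡ (src k))
        (λ e e< → ≔-miss N {suc k} {suc e} (H (src k)) (λ { refl → <-irrefl refl e< }) ∔ next≡ e e<)
    ; tgt≡ = <suc-cases (≔-hit T (tgt k) refl)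
        (λ e e< → ≔-miss T {suc k} {suc e} (tgt k) (λ { refl → <-irrefl refl e< }) ∔ tgt≡ e e<) }
    where
    open Built B
    if-cong : ∀ b {x y z : ℕ} → x ≡ y → (if b then z else x) ≡ (if b then z else y)
    if-cong b refl = refl

  buildE : ∀ s → reg s rM ≡ m → reg s two ≡ 2 → (∀ j i → arr s j i ≡ 0) →
    Ex buildC (1 + (3 + m * (3 + 14))) s (λ s' → Out.Adjacency s' × In.Adjacency s')
  buildE s M≡ two≡ zeros = seqE (blkE {Q = λ s' → s' ≡ s₁} tt refl) λ { _ refl →
    forR {n = m} {κ = 14} J s₁ M≡ refl refl
      (two≡ , record { head≡ = zeros 2 ; next≡ = λ _ () ; tgt≡ = λ _ () }
            , record { head≡ = zeros 5 ; next≡ = λ _ () ; tgt≡ = λ _ () })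
      (λ { k s' k< f i≡ (a≡ , bo , bi) → blkE
          (subst (_< 2 + 2 * m) (sym a≡) (s≤s (s≤s (*-monoʳ-< 2 k<))) ,
           subst (_< 2 + 2 * m) (sym (cong suc a≡))
               (s≤s (s≤s (≤-trans (≤-reflexive (sym (*-suc 2 k))) (*-monoʳ-≤ 2 k<)))) , tt)
          λ _ → cong (2 +_) a≡ ∔ cong (2 +_) (sym (*-suc 2 k)) ,
            subst (λ z → Built src tgt (arr s' 2 [ cell (reg s' arg) ≔ᵣ suc z ])
                     (arr s' 3 [ suc z ≔ᵣ arr s' 2 (cell (reg s' arg)) ])
                     (arr s' 4 [ suc z ≔ᵣ cell (suc (reg s' arg)) ]) (suc k)) (sym i≡)
              (built-step bo (cong cell a≡) (cong (cell ∘ suc) a≡)) ,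
            subst (λ z → Built tgt src (arr s' 5 [ cell (suc (reg s' arg)) ≔ᵣ suc z ])
                     (arr s' 6 [ suc z ≔ᵣ arr s' 5 (cell (suc (reg s' arg))) ])
                     (arr s' 7 [ suc z ≔ᵣ cell (reg s' arg) ]) (suc k)) (sym i≡)
              (built-step bi (cong (cell ∘ suc) a≡) (cong cell a≡)) })
      (λ { s' f (_ , bo , bi) →
        record { headA = λ u _ → Built.head≡ bo u ; nextA = Built.next≡ bo ; tgtA = Built.tgt≡ bo } ,
        record { headA = λ u _ → Built.head≡ bi u ; nextA = Built.next≡ bi ; tgtA = Built.tgt≡ bi } }) }
    where
    s₁ = do1 (mov arg two) s
    J : ℕ → St → Set
    J k s' = reg s' arg ≡ 2 + 2 * k × Built src tgt (arr s' 2) (arr s' 3) (arr s' 4) k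
                                    × Built tgt src (arr s' 5) (arr s' 6) (arr s' 7) k

  fillE : ∀ s → reg s rN ≡ n → Ex fillC (3 + n * (3 + 1)) s (λ s' → ∀ v → v < n → arr s' 9 v ≡ n)
  fillE s N≡ = forR {n = n} {κ = 1} (λ k s' → ∀ v → v < k → arr s' 9 v ≡ n) s N≡ refl refl (λ _ ())
    (λ k s' k< f i≡ j → blkE tt λ _ → <suc-cases
       (≔-hit (arr s' 9) (reg s' rN) i≡ ∔ regF f rN refl ∔ N≡)
       (λ v v< → ≔-miss (arr s' 9) (reg s' rN) (λ e → <-irrefl (sym (sym i≡ ∔ e)) v<) ∔ j v v<))
    (λ s' f j → j)

  copyE : ∀ s → reg s rN ≡ n → Ex copyC (3 + n * (3 + 2)) s (λ s' → ∀ v → v < n → arr s' 10 v ≡ arr s 0 v)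
  copyE s N≡ = forR {n = n} {κ = 2} (λ k s' → ∀ v → v < k → arr s' 10 v ≡ arr s 0 v) s N≡ refl refl (λ _ ())
    (λ k s' k< f i≡ j → blkE tt λ _ → <suc-cases
       (≔-hit (arr s' 10) (arr s' 0 (reg s' rJ)) i≡ ∔ arrF f 0 refl _ ∔ cong (arr s 0) i≡)
       (λ v v< → ≔-miss (arr s' 10) (arr s' 0 (reg s' rJ)) (λ e → <-irrefl (sym (sym i≡ ∔ e)) v<) ∔ j v v<))
    (λ s' f j → j)

  loopCost : ℕ
  loopCost = 3 + n * (3 + (2 + (2 + 1)))

  mergeE : ∀ a b j (f : ℕ → ℕ → ℕ) → let loads = do* (ld rX (2 + j) rJ ∷ ld rY 0 rJ ∷ []) in
    (∀ s → reg (loads s) a < reg (loads s) b →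
       f (arr s (2 + j) (reg s rJ)) (arr s 0 (reg s rJ)) ≡ arr s 0 (reg s rJ)) →
    (∀ s → reg (loads s) b ≤ reg (loads s) a →
       f (arr s (2 + j) (reg s rJ)) (arr s 0 (reg s rJ)) ≡ arr s (2 + j) (reg s rJ)) →
    ∀ s → reg s rN ≡ n →
    Ex (merge a b j) loopCost s (λ s' → ∀ v → v < n → arr s' (2 + j) v ≡ f (arr s (2 + j) v) (arr s 0 v))
  mergeE a b j f hit miss s N≡ = forR {n = n} {κ = 2 + (2 + 1)} J s N≡ refl refl ((λ _ ()) , λ _ _ → refl)
    (λ { k s' k< fr i≡ (lo , hi) →
      let old : f (arr s' (2 + j) (reg s' rJ)) (arr s' 0 (reg s' rJ)) ≡ f (arr s (2 + j) k) (arr s 0 k)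
          old = cong₂ f (cong (arr s' (2 + j)) i≡ ∔ hi k ≤-refl) (cong (arr s' 0) i≡ ∔ arrF fr 0 refl k) in
      seqE (blkE {Q = λ s'' → s'' ≡ loads s'} tt refl) λ { _ refl → iflE
        (λ le → blkE tt λ _ →
          <suc-cases (stored s' k ∔ ≔-hit (arr s' (2 + j)) (arr s' 0 (reg s' rJ)) i≡ ∔ sym
              (hit s' le) ∔ old)
            (λ v v< → stored s' v ∔ ≔-miss (arr s' (2 + j)) (arr s' 0 (reg s' rJ))
                (λ e → <-irrefl (sym (sym i≡ ∔ e)) v<) ∔ lo v v<) ,
          λ v k<v → stored s' v ∔ ≔-miss (arr s' (2 + j)) (arr s' 0 (reg s' rJ))
              (λ e → <-irrefl (sym i≡ ∔ e) k<v) ∔ hi v (<⇒≤ k<v))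
        (λ ge → subE z≤n (blkE tt λ _ →
          <suc-cases (cong (arr s' (2 + j)) (sym i≡) ∔ sym (miss s' ge) ∔ old) lo ,
          λ v k<v → hi v (<⇒≤ k<v))) } })
    (λ s' f (lo , _) → lo)
    where
    loads = do* (ld rX (2 + j) rJ ∷ ld rY 0 rJ ∷ [])
    J : ℕ → St → Set
    J k s' = (∀ v → v < k → arr s' (2 + j) v ≡ f (arr s (2 + j) v) (arr s 0 v))
           × (∀ v → k ≤ v → arr s' (2 + j) v ≡ arr s (2 + j) v)
    stored : ∀ s i → arr (do1 (st (2 + j) rJ rY) (loads s)) (2 + j) i
                     ≡ (arr s (2 + j) [ reg s rJ ≔ᵣ arr s 0 (reg s rJ) ]) i
    stored s i = cong (λ g → g i)
      (≔-hit (arr s) {2 + j} (arr s (2 + j) [ reg s rJ ≔ᵣ arr s 0 (reg s rJ) ]) refl)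

  selectE : ∀ a b j (_≼_ : ℕ → ℕ → Set) → (∀ {x} → x ≼ x) → (∀ {x y z} → x ≼ y → y ≼ z → x ≼ z) →
    let loads = do* (ld rX j rJ ∷ ld rY j arg ∷ []) in
    (∀ s → reg (loads s) a < reg (loads s) b → arr s j (reg s rJ) ≼ arr s j (reg s arg)) →
    (∀ s → reg (loads s) b ≤ reg (loads s) a → arr s j (reg s arg) ≼ arr s j (reg s rJ)) →
    ∀ s → reg s rN ≡ n →
    Ex (select a b j) (1 + loopCost) s
       (λ s' → reg s' arg < n × (∀ v → v < n → arr s j (reg s' arg) ≼ arr s j v))
  selectE a b j _≼_ ≼-refl ≼-trans hit miss s N≡ =
    seqE (blkE {Q = λ s' → s' ≡ do1 (clr arg) s} tt refl) λ { _ refl →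
    forR {n = n} {κ = 2 + (2 + 1)} J (do1 (clr arg) s) N≡ refl refl (n>0 , λ _ ())
      (λ { k s' k< fr i≡ (a< , best≼) →
        let same : ∀ i → arr s' j i ≡ arr s j i
            same i = arrF fr j refl i
            to : ∀ {x y} → arr s' j x ≼ arr s' j y → arr s j x ≼ arr s j y
            to = subst₂ _≼_ (same _) (same _) in
        seqE (blkE {Q = λ s'' → s'' ≡ loads s'} tt refl) λ { _ refl → iflE
          (λ le → blkE tt λ _ → subst (_< n) (sym i≡) k< ,
             <suc-cases (subst (λ z → arr s j (reg s' rJ) ≼ arr s j z) i≡ ≼-refl)
                        (λ v v< → ≼-trans (to (hit s' le)) (best≼ v v<)))
          (λ ge → subE z≤n (blkE tt λ _ → a< ,
             <suc-cases (subst (λ z → arr s j (reg s' arg) ≼ arr s j z) i≡ (to (miss s' ge))) best≼)) } })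
      (λ s' f q → q) }
    where
    loads = do* (ld rX j rJ ∷ ld rY j arg ∷ [])
    J : ℕ → St → Set
    J k s' = reg s' arg < n × (∀ v → v < k → arr s j (reg s' arg) ≼ arr s j v)

  Reach : ℕ → ℕ → Set
  Reach x r = ∀ v → v < n → ∃[ j ] j ≤ r × GO.Walk x v j

  record Ecc (y e : ℕ) : Set where
    field
      δ     : ℕ → ℕ
      dist  : GO.DistFrom n y δ
      δ≤e   : ∀ v → v < n → δ v ≤ e
      tight : ∃[ v ] v < n × δ v ≡ e

  -- This is why the answer is never below the radius: `n` means ∞, and any other value is an
  -- eccentricity.
  Valid : ℕ → Set
  Valid b = b ≡ n ⊎ ∃[ y ] y < n × Ecc y b

  -- `b` does not exceed the eccentricity of `y`. Phrasing this through upper bounds of the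
  -- eccentricity makes it vacuous when that is infinite, and excludes `b = n` otherwise.
  Below : ℕ → ℕ → Set
  Below b y = ∀ r → Reach y r → b < n × b ≤ r

  below-≤ : ∀ {b b' y} → b' ≤ b → Below b y → Below b' y
  below-≤ le B r R = let p , q = B r R in ≤-<-trans le p , ≤-trans le q

  ecc-below : ∀ {y e} → Ecc y e → Below e y
  ecc-below E r R =
    let v , v< , q = Ecc.tight E ; j , j≤ , w = R v v< ; p , l = GO.DistFrom.shortest (Ecc.dist E) w in
    subst (_< n) q p , ≤-trans (≤-reflexive (sym q)) (≤-trans l j≤)

  record Tried (y b b' : ℕ) : Set where
    field
      valid′ : Valid b → Valid b'
      below  : Below b' y
      b'≤b   : b' ≤ b

  tryCost : ℕ
  tryCost = bfsCost + (1 + ((3 + n * (3 + (1 + (2 + 1)))) + (2 + 1)))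

  tryE : ∀ s y → Env s → y < n → reg s bS ≡ y →
         Ex tryC tryCost s (λ s' → Tried y (reg s best) (reg s' best))
  tryE s y E y<n S≡ =
    seqE (frameE (Out.Whole.search y y<n s (adjO E) (N≡ E) (zr≡ E) S≡)) λ { s₁ (f₁ , dist) →
    seqE (blkE {Q = λ s' → s' ≡ do1 (clr rE) s₁} tt refl) λ { _ refl →
    seqE (forR {n = n} {κ = 1 + (2 + 1)} (J (arr s₁ 0))
        {Q = λ s' → reg s' best ≡ reg s best × Ecc y (reg s' rE)}
        (do1 (clr rE) s₁) (regF f₁ rN refl ∔ N≡ E) refl refl ((λ _ ()) , inj₁ refl)
        (λ { k s' k< f i≡ (max , att) →
          let X≡ : arr s' 0 (reg s' rJ) ≡ arr s₁ 0 k
              X≡ = arrF f 0 refl _ ∔ cong (arr s₁ 0) i≡ in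
          seqE (blkE {Q = λ s'' → s'' ≡ do1 (ld rX 0 rJ) s'} tt refl) λ { _ refl → iflE
            (λ le → blkE tt λ _ → <suc-cases (≤-reflexive (sym X≡)) (λ v v< → ≤-trans (max v v<) (<⇒≤ le)) ,
                       inj₂ (k , k< , sym X≡))
            (λ ge → subE z≤n (blkE tt λ _ → <suc-cases (≤-trans (≤-reflexive (sym X≡)) ge) max , att)) } })
        (λ { s' f (max , att) → regF f best refl ∔ regF f₁ best refl , record
            { δ = arr s₁ 0 ; dist = dist ; δ≤e = max
               ; tight = attain (arr s₁ 0) dist att } }))
      λ { s₂ (b≡ , ecc) → iflE
        (λ le → blkE tt (record { valid′ = λ _ → inj₂ (y , y<n , ecc) ; below = ecc-below ecc
                                ; b'≤b = ≤-trans (<⇒≤ le) (≤-reflexive b≡) }))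
        (λ ge → subE z≤n (blkE tt (record { valid′ = subst Valid (sym b≡)
                                ; below = below-≤ ge (ecc-below ecc)
                                ; b'≤b = ≤-reflexive b≡ }))) } } }
    where
    J : (ℕ → ℕ) → ℕ → St → Set
    J δ k s' = (∀ v → v < k → δ v ≤ reg s' rE) × (reg s' rE ≡ 0 ⊎ ∃[ v ] v < n × δ v ≡ reg s' rE)
    attain : ∀ δ {e} → GO.DistFrom n y δ → e ≡ 0 ⊎ (∃[ v ] v < n × δ v ≡ e) → ∃[ v ] v < n × δ v ≡ e
    attain δ D (inj₂ a) = a
    -- The initial 0 of the running maximum is the distance from `y` to itself.
    attain δ D (inj₁ refl) = y , y<n , n≤0⇒n≡0 (GO.DistFrom.shortest D GO.nil .proj₂)

-- Sampling, and searching from the candidates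

module Analysis (A n m : ℕ) (cell : ℕ → ℕ) (n>0 : 0 < n)
  (src<′ : ∀ e → e < m → cell (2 + 2 * e) < n) (tgt<′ : ∀ e → e < m → cell (3 + 2 * e) < n) where

  open Routines A n m cell n>0 src<′ tgt<′ public
  open Semantics cell (2 + 2 * m) bound
  open Search cell (2 + 2 * m) bound n m
  open GO using (Walk; DistFrom)
  open DistFrom
  open Env

  vertex : ℕ → ℕ
  vertex ω = ⟦ rem ⟧ 0 ω n

  vertex< : ∀ ω → vertex ω < n
  vertex< ω = go n n>0
    where go : ∀ n → 0 < n → ⟦ rem ⟧ 0 ω n < n
          go (suc n) _ = m%n<n ω (suc n)

  Far Near : (ℕ → ℕ) → ℕ → Set
  Far F ω  = ∀ y → y < n → F y < n → ∃[ j ] j ≤ F y × Walk y (vertex ω) j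
  Near D ω = ∀ v j → v < n → Walk (vertex ω) v j → D v ≤ j

  -- `far-upper` holds because a vertex that reaches everything within `r` reaches every sample
  -- within `r`; applied to a centre it bounds the least `F` by the radius.
  record Sampled (F D : ℕ → ℕ) (l : List ℕ) : Set where
    field
      far       : All (Far F) l
      far-upper : ∀ x r → x < n → Reach x r → F x < n × F x ≤ r
      near      : All (Near D) l
      near-att  : ∀ v → v < n → D v < n → ∃[ ω ] ω ∈ l × Walk (vertex ω) v (D v)
      near-≤    : ∀ v → v < n → D v ≤ n

  sampled-step : ∀ {F D F' D' l ω δi δo} → Sampled F D l →
    GI.DistFrom n (vertex ω) δi → DistFrom n (vertex ω) δo →
    (∀ v → v < n → F' v ≡ F v ⊔ δi v) → (∀ v → v < n → D' v ≡ D v ⊓ δo v) → Sampled F' D' (ω ∷ l)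
  sampled-step {F} {D} {F'} {D'} {l} {ω} {δi} {δo} S dᵢ dₒ F≡ D≡ = record
    { far = (λ y y< p → δi y , ≤F' y y< , reverse (GI.DistFrom.attained dᵢ y y< (≤-<-trans (≤F' y y<) p)))
          ∷ All.map (λ {ω'} → far-mono ω') far
    ; far-upper = λ x r x< R → let a , b = far-upper x r x< R
                                   j , j≤ , w = R (vertex ω) (vertex< ω)
                                   c , d = GI.DistFrom.shortest dᵢ (reverse w) in
        subst (_< n) (sym (F≡ x x<)) (⊔-lub a c) , subst (_≤ r) (sym (F≡ x x<)) (⊔-lub b (≤-trans d j≤))
    ; near = (λ v j v< w → ≤-trans (≤-reflexive (D≡ v v<)) (≤-trans (m⊓n≤n _ _) (shortest dₒ w .proj₂)))
           ∷ All.map (λ {ω'} → near-mono ω') near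
    ; near-att = att
    ; near-≤ = λ v v< → ≤-trans (≤-reflexive (D≡ v v<)) (≤-trans (m⊓n≤m _ _) (near-≤ v v<))
    }
    where
    open Sampled S
    ≤F' : ∀ v → v < n → δi v ≤ F' v
    ≤F' v v< = ≤-trans (m≤n⊔m (F v) _) (≤-reflexive (sym (F≡ v v<)))
    F≤ : ∀ v → v < n → F v ≤ F' v
    F≤ v v< = ≤-trans (m≤m⊔n _ (δi v)) (≤-reflexive (sym (F≡ v v<)))
    far-mono : ∀ ω' → Far F ω' → Far F' ω'
    far-mono ω' h y y< p = let j , j≤ , w = h y y< (≤-<-trans (F≤ y y<) p) in j , ≤-trans j≤ (F≤ y y<) , w
    near-mono : ∀ ω' → Near D ω' → Near D' ω'
    near-mono ω' h v j v< w = ≤-trans (≤-reflexive (D≡ v v<)) (≤-trans (m⊓n≤m _ _) (h v j v< w))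
    att : ∀ v → v < n → D' v < n → ∃[ ω' ] ω' ∈ ω ∷ l × Walk (vertex ω') v (D' v)
    att v v< p with ≤-total (D v) (δo v)
    ... | inj₁ le = let e = D≡ v v< ∔ m≤n⇒m⊓n≡m le
                        ω' , i , w = near-att v v< (subst (_< n) e p) in
                    ω' , there i , subst (Walk (vertex ω') v) (sym e) w
    ... | inj₂ ge = let e = D≡ v v< ∔ m≥n⇒m⊓n≡n ge in
                    ω , here refl , subst (Walk (vertex ω) v) (sym e) (attained dₒ v v< (subst (_< n) e p))

  perSample : ℕ
  perSample = 1 + (bfsCost + (loopCost + (bfsCost + loopCost)))

  sampleE : ∀ s → Env s → Sampled (arr s 8) (arr s 9) (log s) →
    Ex sampleC perSample s (λ s' → length (log s') ≡ suc (length (log s)) × Sampled (arr s' 8)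
        (arr s' 9) (log s'))
  sampleE s E S = seqE (sampE {Q = λ s' → ∃[ ω ] s' ≡ doSamp bS rN ω s} λ ω → ω , refl) λ { _ (ω , refl) →
    seqE (frameE (In.Whole.search (vertex ω) (vertex< ω) (doSamp bS rN ω s) (adjI (E₀ ω)) (N≡ E)
        (zr≡ E) (S≡ ω)))
    λ { s₁ (f₁ , dᵢ) → let E₁ = env-frame refl f₁ (E₀ ω) in
    seqE (frameE (mergeE rX rY 6 _⊔_ (λ _ p → m≤n⇒m⊔n≡n (<⇒≤ p)) (λ _ → m≥n⇒m⊔n≡m) s₁ (N≡ E₁)))
    λ { s₂ (f₂ , F≡) → let E₂ = env-frame refl f₂ E₁ in
    seqE (frameE (Out.Whole.search (vertex ω) (vertex< ω) s₂ (adjO E₂) (N≡ E₂) (zr≡ E₂)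
            (regF f₂ bS refl ∔ regF f₁ bS refl ∔ S≡ ω)))
    λ { s₃ (f₃ , dₒ) → let E₃ = env-frame refl f₃ E₂ in
    monoE (frameE (mergeE rY rX 7 _⊓_ (λ _ p → m≥n⇒m⊓n≡n (<⇒≤ p)) (λ _ → m≤n⇒m⊓n≡m) s₃ (N≡ E₃)))
    λ { s₄ (f₄ , D≡) →
      let log≡ : log s₄ ≡ ω ∷ log s
          log≡ = logF f₄ refl ∔ logF f₃ refl ∔ logF f₂ refl ∔ logF f₁ refl in
      cong length log≡ , subst (Sampled (arr s₄ 8) (arr s₄ 9)) (sym log≡)
        (sampled-step S dᵢ dₒ
          (λ v v< → arrF f₄ 8 refl v ∔ arrF f₃ 8 refl v ∔ F≡ v v< ∔ cong (_⊔ arr s₁ 0 v) (arrF f₁ 8 refl v))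
          (λ v v< → D≡ v v< ∔ cong (_⊓ arr s₃ 0 v)
              (arrF f₃ 9 refl v ∔ arrF f₂ 9 refl v ∔ arrF f₁ 9 refl v))) } } } } }
    where
    E₀ : ∀ ω → Env (doSamp bS rN ω s)
    E₀ ω = record { N≡ = N≡ E ; zr≡ = zr≡ E ; adjO = Out.adjacency-cong {s} (λ _ _ → refl) (adjO E)
                  ; adjI = In.adjacency-cong {s} (λ _ _ → refl) (adjI E) }
    S≡ : ∀ ω → ⟦ rem ⟧ 0 ω (reg s rN) ≡ vertex ω
    S≡ ω = cong (⟦ rem ⟧ 0 ω) (N≡ E)

  count : (ℕ → Bool) → ℕ → ℕ
  count p = sumTo (λ v → if p v then 1 else 0)

  candidateCost : ℕ → ℕ
  candidateCost K = 2 + (2 + (n * 10 + K * (2 + tryCost)))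

  module Candidates (s : St) (E : Env s) (K : ℕ) (K≡ : reg s rK ≡ K) where

    C : ℕ → ℕ
    C = arr s 10

    p : ℕ → Bool
    p v = C v <ᵇ reg s rho

    -- The time left has two purses: 10 for each vertex still to be examined, and `2 + tryCost` for
    -- each search still allowed. `cnt≤` compares the searches made with the candidates passed, so
    -- that reaching the cap exhibits `K` candidates.
    record Prog (κ : ℕ) (s' : St) : Set where
      field
        u≤n    : reg s' rU ≤ n
        cnt≤K  : reg s' cnt ≤ K
        cnt≤   : reg s' cnt ≤ count p (reg s' rU)
        κ≡     : κ ≡ (n ∸ reg s' rU) * 10 + (K ∸ reg s' cnt) * (2 + tryCost)
        valid′ : Valid (reg s best) → Valid (reg s' best)
        b≤     : reg s' best ≤ reg s best
        below  : ∀ v → v < reg s' rU → C v < reg s rho → Below (reg s' best) v ⊎ K ≤ reg s' cnt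

    loop : Cmd
    loop = candidate ⨾ blk (inc rU ∷ [])

    iteration : ∀ κ s' → Env s' → reg s' rK ≡ K → reg s' rho ≡ reg s rho → (∀ v → arr s' 10 v ≡ C v) →
      Prog κ s' → reg s' rU < reg s' rN → ∃₂ λ κ₁ κ₂ → (2 + κ₁ + κ₂ ≤ κ) × Ex loop κ₁ s' (Prog κ₂)
    iteration κ s' E' K' rho≡ C≡ P u<N = go
      where
      open Prog P
      u c : ℕ
      u = reg s' rU
      c = reg s' cnt
      u<n : u < n
      u<n = subst (u <_) (N≡ E') u<N
      s₁ = do1 (ld rX 10 rU) s'
      n∸u : n ∸ u ≡ suc (n ∸ suc u)
      n∸u = +-∸-assoc 1 u<n
      κ₂ : ℕ
      κ₂ = (n ∸ suc u) * 10 + (K ∸ c) * (2 + tryCost)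
      κ₂≤ : ∀ κ₁ → κ₁ ≤ 8 → 2 + κ₁ + κ₂ ≤ κ
      κ₂≤ κ₁ le = ≤-trans (+-monoˡ-≤ κ₂ (+-monoʳ-≤ 2 le)) (≤-reflexive
        (sym (+-assoc 10 ((n ∸ suc u) * 10) _) ∔ cong (λ z → z * 10 + (K ∸ c) * (2 + tryCost))
            (sym n∸u) ∔ sym κ≡))
      cnt≤′ : c ≤ count p (suc u)
      cnt≤′ = ≤-trans cnt≤ (m≤n+m _ (if p u then 1 else 0))
      hit : C u < reg s rho → count p (suc u) ≡ suc (count p u)
      hit q with C u <ᵇ reg s rho | <⇒<ᵇ q
      ... | true | _ = refl
      skip : (C u < reg s rho → K ≤ c) → Prog κ₂ (do1 (inc rU) s₁)
      skip h = record { u≤n = u<n ; cnt≤K = cnt≤K ; cnt≤ = cnt≤′ ; κ≡ = refl ; valid′ = valid′ ; b≤ = b≤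
                      ; below = <suc-cases (λ q → inj₂ (h q)) below }
      go : ∃₂ λ κ₁ κ₂ → (2 + κ₁ + κ₂ ≤ κ) × Ex loop κ₁ s' (Prog κ₂)
      go with reg s₁ rX <? reg s₁ rho | c <? reg s' rK
      ... | no x≮ | _ = 1 + (2 + 0) + 1 , κ₂ , κ₂≤ _ (m≤m+n 4 4) ,
        seqE (seqE (blkE {Q = λ s'' → s'' ≡ s₁} tt refl) λ { _ refl →
          iflE {Q = λ s'' → s'' ≡ s₁} (λ q → contradiction q x≮) (λ _ → blkE tt refl) })
          λ { _ refl → blkE tt (skip λ q → contradiction (subst₂ _<_ (sym (C≡ u)) (sym rho≡) q) x≮) }
      ... | yes x< | no c≮ = 1 + (2 + (2 + 0)) + 1 , κ₂ , κ₂≤ _ (m≤m+n 6 2) ,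
        seqE (seqE (blkE {Q = λ s'' → s'' ≡ s₁} tt refl) λ { _ refl →
          iflE {κ = 2 + 0} {Q = λ s'' → s'' ≡ s₁} (λ _ → iflE (λ q → contradiction q c≮)
              (λ _ → blkE tt refl))
               (λ q → contradiction x< (≤⇒≯ q)) })
          λ { _ refl → blkE tt (skip λ _ → subst (_≤ c) K' (≮⇒≥ c≮)) }
      ... | yes x< | yes c< = 1 + (2 + (2 + (2 + tryCost))) + 1 , κ₃ , κ₃≤ ,
        seqE (seqE (blkE {Q = λ s'' → s'' ≡ s₁} tt refl) λ { _ refl →
          iflE {κ = 2 + (2 + tryCost)} {Q = Q} (λ _ → iflE
            (λ _ → seqE (blkE {Q = λ s'' → s'' ≡ s₂} tt refl) λ { _ refl → frameE (tryE s₂ u E₂ u<n refl) })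
            (λ q → contradiction c< (≤⇒≯ q)))
               (λ q → contradiction x< (≤⇒≯ q)) })
          λ { s₃ (f , t) → blkE tt (record
            { u≤n = subst (_≤ n) (sym (cong suc (regF f rU refl))) u<n
            ; cnt≤K = subst (_≤ K) (sym (regF f cnt refl)) c<K
            ; cnt≤ = subst₂ (λ x y → x ≤ count p (suc y)) (sym (regF f cnt refl)) (sym (regF f rU refl))
                (≤-trans (s≤s cnt≤) (≤-reflexive (sym (hit x<'))))
            ; κ≡ = cong₂ (λ x y → (n ∸ suc y) * 10 + (K ∸ x) * (2 + tryCost))
                (sym (regF f cnt refl)) (sym (regF f rU refl))
            ; valid′ = λ v → Tried.valid′ t (valid′ v)
            ; b≤ = ≤-trans (Tried.b'≤b t) b≤
            ; below = subst (λ z → ∀ v → v < suc z → C v < reg s rho → Below (reg s₃ best) v ⊎ K ≤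
                reg s₃ cnt)
                (sym (regF f rU refl)) (<suc-cases (λ _ → inj₁ (Tried.below t)) λ v v< q → still f t
                    (below v v< q)) }) }
        where
        s₂ = do* (inc cnt ∷ mov bS rU ∷ []) s₁
        E₂ : Env s₂
        E₂ = env-frame {blk (ld rX 10 rU ∷ inc cnt ∷ mov bS rU ∷ [])} refl
            (frame-do* (ld rX 10 rU ∷ inc cnt ∷ mov bS rU ∷ []) s') E'
        Q : St → Set
        Q s₃ = Frame tryC s₂ s₃ × Tried u (reg s₂ best) (reg s₃ best)
        c<K : c < K
        c<K = subst (c <_) K' c<
        x<' : C u < reg s rho
        x<' = subst₂ _<_ (C≡ u) rho≡ x<
        κ₃ : ℕ
        κ₃ = (n ∸ suc u) * 10 + (K ∸ suc c) * (2 + tryCost)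
        κ₃≤ : 2 + (1 + (2 + (2 + (2 + tryCost))) + 1) + κ₃ ≤ κ
        κ₃≤ = ≤-trans (m≤n+m _ 2) (≤-reflexive (regroup tryCost (n ∸ suc u) (K ∸ suc c)
            ∔ cong₂ (λ x y → x * 10 + y * (2 + tryCost)) (sym n∸u) (sym (+-∸-assoc 1 c<K)) ∔ sym κ≡))
          where regroup : ∀ t a b → 4 + (1 + (2 + (2 + (2 + t))) + 1) + (a * 10 + b * (2 + t)) ≡ (1 + a) * 10 + (1 + b) * (2 + t)
                regroup = solve-∀
        still : ∀ {s₃ v} → Frame tryC s₂ s₃ → Tried u (reg s₂ best) (reg s₃ best) →
                Below (reg s' best) v ⊎ K ≤ c → Below (reg s₃ best) v ⊎ K ≤ reg s₃ cnt
        still f t (inj₁ b) = inj₁ (below-≤ (Tried.b'≤b t) b)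
        still f t (inj₂ q) = inj₂ (subst (K ≤_) (sym (regF f cnt refl)) (m≤n⇒m≤1+n q))

    candidatesE : Ex candidatesC (candidateCost K) s (λ s' →
      (Valid (reg s best) → Valid (reg s' best)) × reg s' best ≤ reg s best ×
      (count p n < K → ∀ v → v < n → C v < reg s rho → Below (reg s' best) v))
    candidatesE = seqE (blkE {Q = λ s' → s' ≡ s₁} tt refl) λ { _ refl →
      whileR Prog s₁
        (λ κ s' f P → iteration κ s' (env-frame {loop} refl f E₁) (regF f rK refl ∔ K≡)
            (regF f rho refl) (arrF f 10 refl) P)
        (λ κ s' f P ge → Prog.valid′ P , Prog.b≤ P , λ few v v< q →
           let n≤u = subst (_≤ reg s' rU) (regF f rN refl ∔ N≡ E) ge in
           case Prog.below P v (≤-trans v< n≤u) q of λ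
             { (inj₁ b) → b
             -- The cap has been reached, so there are at least `K` candidates, against `few`.
             ; (inj₂ K≤) → contradiction (≤-trans K≤ (≤-trans (Prog.cnt≤ P)
                 (≤-reflexive (cong (count p) (≤-antisym (Prog.u≤n P) n≤u))))) (<⇒≱ few) })
        (n * 10 + K * (2 + tryCost))
        (record { u≤n = z≤n ; cnt≤K = z≤n ; cnt≤ = z≤n ; κ≡ = refl ; valid′ = λ v → v ; b≤ = ≤-refl
            ; below = λ _ () }) }
      where
      s₁ = do* (clr cnt ∷ clr rU ∷ []) s
      E₁ : Env s₁
      E₁ = env-frame {blk (clr cnt ∷ clr rU ∷ [])} refl (frame-do* (clr cnt ∷ clr rU ∷ []) s) E

-- The approximation argument

√-grow : ∀ k → ⌊√ k ⌋ ≤ ⌊√ suc k ⌋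
√-grow k with suc ⌊√ k ⌋ * suc ⌊√ k ⌋ ≤ᵇ suc k
... | true  = n≤1+n _
... | false = ≤-refl

√-positive : ∀ {k} → 0 < k → 0 < ⌊√ k ⌋
√-positive {suc zero}    _ = s≤s z≤n
√-positive {suc (suc k)} _ = ≤-trans (√-positive {suc k} (s≤s z≤n)) (√-grow (suc k))

module Correctness (A n m : ℕ) (cell : ℕ → ℕ) (n>0 : 0 < n)
  (src<′ : ∀ e → e < m → cell (2 + 2 * e) < n) (tgt<′ : ∀ e → e < m → cell (3 + 2 * e) < n)
  (inp0 : cell 0 ≡ n) (inp1 : cell 1 ≡ m)
  (maxL : ℕ) (maxL-ok : ∀ L → 2 ^ L ≤ 2 * n → L ≤ maxL) where

  open Analysis A n m cell n>0 src<′ tgt<′ public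
  open Semantics cell (2 + 2 * m) bound
  open Search cell (2 + 2 * m) bound n m
  open GO using (Walk; DistFrom)
  open Env

  K : ℕ
  K = ⌊√ n ⌋

  Near-to : ℕ → ℕ → ℕ → Set
  Near-to v r u = ∃[ j ] j < suc r × Walk u v j

  near-to? : ∀ v r u → Dec (Near-to v r u)
  near-to? v r u = anyUpTo? (λ j → GO.walk? j u v) (suc r)

  ball : ℕ → ℕ → ℕ → Bool
  ball v r u = does (near-to? v r u)

  -- `L` is the logarithm that the program has computed; `L-ok` later compares it with `⌈log₂ n ⌉`.
  record Missed (v r : ℕ) (l : List ℕ) : Set where
    field
      L      : ℕ
      L-ok   : n ≤ 2 ^ L
      enough : A * L * K ≤ length l
      avoid  : All (λ ω → ball v r (vertex ω) ≡ false) l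

  -- The radius can be kept below `n`, since the ball in question has radius `D v - 1` and
  -- `D v ≤ n`. The union bound then has only `n * n` events.
  Unlucky : List ℕ → Set
  Unlucky l = ∃₂ λ v r → v < n × r < n × K ≤ count (ball v r) n × Missed v r l

  TwoApprox : ℕ → Set
  TwoApprox b = ∀ x r → x < n → Reach x r → b < n × b ≤ 2 * r

  Outcome : ℕ → List ℕ → Set
  Outcome b l = Valid b × (TwoApprox b ⊎ Unlucky l)

  -- The split is on the number of candidates. With fewer than `K`, all of them have been searched
  -- from. Otherwise the candidates themselves are the ball, of radius `D v - 1` around `v`, that
  -- the sample has missed.
  two-approx-or-missed : ∀ {F D : ℕ → ℕ} {l y v} {δ C : ℕ → ℕ} {ρ b} → Sampled F D l → ∀ L → n ≤ 2 ^
      L → A * L * K ≤ length l →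
    y < n → v < n → (∀ u → u < n → F y ≤ F u) → (∀ u → u < n → D u ≤ D v) →
    GI.DistFrom n v δ → (∀ u → u < n → C u ≡ δ u) → ρ ≡ D v → Below b y →
    (count (λ u → C u <ᵇ ρ) n < K → ∀ u → u < n → C u < ρ → Below b u) →
    TwoApprox b ⊎ Unlucky l
  two-approx-or-missed {F} {D} {l} {y} {v} {δ} {C} {ρ} {b} S L L-ok enough y< v< ymin vmax dist C≡
      refl by few
    with count (λ u → C u <ᵇ D v) n <? K
  ... | yes few? = inj₁ approx
    where
    open Sampled S
    Cx : ∀ x r → x < n → Reach x r → C x < n × C x ≤ r
    Cx x r x< R = let j , j≤ , w = R v v< ; p , q = GI.DistFrom.shortest dist (reverse w) in
      subst (_< n) (sym (C≡ x x<)) p , subst (_≤ r) (sym (C≡ x x<)) (≤-trans q j≤)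
    approx : TwoApprox b
    approx x r x< R with D v <? n | D v ≤? r
    -- The sample `ω` is chosen for the target `u`: `y` reaches it within `F y ≤ F x ≤ r`, and it
    -- reaches `u` within `D u ≤ D v ≤ r`.
    ... | yes D<n | yes D≤r = by (2 * r) λ u u< →
      let ω , i , w = near-att u u< (≤-<-trans (vmax u u<) D<n)
          F<n , F≤r = far-upper x r x< R
          j , j≤ , w' = All.lookup far i y y< (≤-<-trans (ymin x x<) F<n) in
      j + D u , ≤-trans (+-mono-≤ (≤-trans j≤ (≤-trans (ymin x x<) F≤r)) (≤-trans (vmax u u<) D≤r))
                  (≤-reflexive (cong (r +_) (sym (+-identityʳ r)))) ,
      GO.append w' w
    -- `x` reaches `v` within `r < D v`, so `x` is a candidate itself.
    ... | yes _ | no D≰r = let p , q = few few? x x< (≤-<-trans (Cx x r x< R .proj₂) (≰⇒> D≰r)) r R in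
      p , ≤-trans q (m≤m+n r _)
    -- No sample reaches `v`. Every vertex that does is then a candidate, `x` among them.
    ... | no D≮n | _ = let p , q = few few? x x< (≤-trans (Cx x r x< R .proj₁) (≮⇒≥ D≮n)) r R in
      p , ≤-trans q (m≤m+n r _)
  ... | no many = inj₂ (unlucky (D v) refl)
    where
    open Sampled S
    unlucky : ∀ d → D v ≡ d → Unlucky l
    -- `D v = 0` would leave no candidates, but there are at least `K`, and `K` is positive.
    unlucky zero e = contradiction (≤-trans (s≤s (≤-reflexive none)) (√-positive n>0)) many
      where
      none : count (λ u → C u <ᵇ D v) n ≡ 0
      none = cong (λ d → count (λ u → C u <ᵇ d) n) e ∔ zeros′ n
        where zeros′ : ∀ k → count (λ u → C u <ᵇ 0) k ≡ 0
              zeros′ zero    = refl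
              zeros′ (suc k) = zeros′ k
    unlucky (suc r) e = v , r , v< , subst (_≤ n) e (near-≤ v v<) ,
      subst (K ≤_) (sumTo-cong n λ u u< → cong (λ b → if b then 1 else 0) (same u u<)) (≮⇒≥ many) ,
      record { L = L ; L-ok = L-ok ; enough = enough ; avoid = All.map (λ {ω} → missed ω) near }
      where
      same : ∀ u → u < n → (C u <ᵇ D v) ≡ ball v r u
      same u u< with near-to? v r u
      ... | yes (j , j< , w) = T⇒true _ (<⇒<ᵇ (≤-<-trans (≤-trans (≤-reflexive (C≡ u u<))
              (GI.DistFrom.shortest dist (reverse w) .proj₂)) (subst (j <_) (sym e) j<)))
      ... | no  far-away = ¬T⇒false _ λ t → let q = subst (_< D v) (C≡ u u<) (<ᵇ⇒< (C u) (D v) t) in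
              far-away (δ u , subst (δ u <_) e q , reverse
                  (GI.DistFrom.attained dist u u< (≤-trans q (near-≤ v v<))))
      missed : ∀ ω → Near D ω → ball v r (vertex ω) ≡ false
      missed ω h with near-to? v r (vertex ω)
      ... | no  _ = refl
      ... | yes (j , j< , w) = contradiction (subst (_≤ j) e (h v j v< w)) (<⇒≱ j<)

  workCost : ℕ
  workCost = (1 + (3 + n * (3 + (5 + (2 + 1))))) + ((3 + (3 + n * (3 + (2 + 2)))) + (3
    + ((1 + (3 + m * (3 + 14))) + ((3 + n * (3 + 1)) + ((3 + A * maxL * K * (3 + perSample))
    + ((1 + loopCost) + (1 + ((1 + loopCost) + (1 + (1 + (tryCost + (2 + (bfsCost
    + ((3 + n * (3 + 2)) + candidateCost K))))))))))))))

  workE : ∀ s → reg s rN ≡ n → reg s zr ≡ 0 → reg s rM ≡ m → reg s two ≡ 2 → reg s best ≡ n →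
    log s ≡ [] → (∀ j i → arr s j i ≡ 0) →
    Ex (workC A) workCost s (λ s' → Outcome (reg s' best) (log s'))
  workE s N₀ z₀ M₀ two₀ best₀ log₀ zeros =
    seqE (frameE (sqrtE s N₀)) λ { s₁ (f₁ , K₁) →
    seqE (frameE (logE s₁ (regF f₁ rN refl ∔ N₀) (regF f₁ two refl ∔ two₀)))
        λ { s₂ (f₂ , L , L₂ , n≤ , ≤2n) →
    seqE (frameE (countE s₂ L L₂ ≤2n (regF f₂ rK refl ∔ K₁))) λ { s₃ (f₃ , S₃) →
    let reg₃ : ∀ r → wr sqrtC r ≡ false → wr logC r ≡ false → wr (countC A) r ≡ false → reg s₃ r ≡ reg s r
        reg₃ r a b c = regF f₃ r c ∔ regF f₂ r b ∔ regF f₁ r a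
        arr₃ : ∀ j i → arr s₃ j i ≡ 0
        arr₃ j i = arrF f₃ j refl i ∔ arrF f₂ j refl i ∔ arrF f₁ j refl i ∔ zeros j i in
    seqE (frameE (buildE s₃ (reg₃ rM refl refl refl ∔ M₀) (reg₃ two refl refl refl ∔ two₀) arr₃))
        λ { s₄ (f₄ , aO , aI) →
    let E₄ : Env s₄
        E₄ = record { N≡ = regF f₄ rN refl ∔ reg₃ rN refl refl refl ∔ N₀
                    ; zr≡ = regF f₄ zr refl ∔ reg₃ zr refl refl refl ∔ z₀ ; adjO = aO ; adjI = aI } in
    seqE (frameE (fillE s₄ (N≡ E₄))) λ { s₅ (f₅ , D≡n) →
    let E₅ = env-frame refl f₅ E₄
        S₅ : reg s₅ rS ≡ A * L * K
        S₅ = regF f₅ rS refl ∔ regF f₄ rS refl ∔ S₃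
        F₅ : ∀ v → arr s₅ 8 v ≡ 0
        F₅ v = arrF f₅ 8 refl v ∔ arrF f₄ 8 refl v ∔ arr₃ 8 v
        log₅ : log s₅ ≡ []
        log₅ = logF f₅ refl ∔ logF f₄ refl ∔ logF f₃ refl ∔ logF f₂ refl ∔ logF f₁ refl ∔ log₀ in
    -- The number of rounds depends on the computed `L`, so the cost is raised to that for `maxL`.
    seqE (frameE (subE (+-monoʳ-≤ 3 (*-monoˡ-≤ (3 + perSample) (*-monoˡ-≤ K (*-monoʳ-≤ A (maxL-ok L ≤2n)))))
      (forR {n = A * L * K} {κ = perSample}
        (λ k s' → length (log s') ≡ k × Sampled (arr s' 8) (arr s' 9) (log s')) s₅ S₅ refl refl
        (cong length log₅ , subst (Sampled (arr s₅ 8) (arr s₅ 9)) (sym log₅)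
          -- The empty sample: array 8 is still zero from the start, and `fillC` has put `n` into
          -- array 9.
          (record { far = [] ; near = []
                  ; far-upper = λ x r _ _ → subst (_< n) (sym (F₅ x)) n>0 , subst (_≤ r) (sym (F₅ x)) z≤n
                  ; near-att = λ v v< p → contradiction (subst (_< n) (D≡n v v<) p) (<-irrefl refl)
                  ; near-≤ = λ v v< → ≤-reflexive (D≡n v v<) }))
        (λ { k s' k< f i≡ (len , S) → monoE (sampleE s' (env-frame {forC rI rS sampleC} refl f E₅) S)
               λ { s'' (len' , S') _ → len' ∔ cong suc len , S' } })
        (λ s' f q → q)))) λ { s₆ (f₆ , len , S) →
    let E₆ = env-frame {forC rI rS sampleC} refl f₆ E₅ in
    seqE (frameE (selectE rX rY 8 _≤_ ≤-refl ≤-trans (λ _ → <⇒≤) (λ _ q → q) s₆ (N≡ E₆)))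
        λ { s₇ (f₇ , y< , ymin) →
    seqE {κ = 1} (blkE {Q = λ s' → s' ≡ do1 (mov yst arg) s₇} tt refl) λ { _ refl →
    let E₇ = env-frame {select rX rY 8} refl f₇ E₆
        s₈ = do1 (mov yst arg) s₇
        E₈ = env-frame {blk (mov yst arg ∷ [])} {s₇} refl (frame-do* (mov yst arg ∷ []) s₇) E₇
        D₈ : ∀ v → arr s₇ 9 v ≡ arr s₆ 9 v
        D₈ = arrF f₇ 9 refl in
    seqE (frameE (selectE rY rX 9 _≥_ ≤-refl (λ p q → ≤-trans q p) (λ _ → <⇒≤) (λ _ q → q) s₈
        (N≡ E₈))) λ { s₉ (f₉ , v< , vmax) →
    seqE {κ = 1} (blkE {Q = λ s' → s' ≡ do1 (mov vst arg) s₉} tt refl) λ { _ refl →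
    seqE {κ = 1} (blkE {Q = λ s' → s' ≡ do* (mov vst arg ∷ mov bS yst ∷ []) s₉} tt refl) λ { _ refl →
    let s₁₁ = do* (mov vst arg ∷ mov bS yst ∷ []) s₉
        E₁₁ = env-frame {blk (mov vst arg ∷ mov bS yst ∷ [])} {s₉} refl
                (frame-do* (mov vst arg ∷ mov bS yst ∷ []) s₉) (env-frame {select rY rX 9} refl f₉ E₈)
        y = reg s₇ arg
        v = reg s₉ arg
        best₁₁ : reg s₉ best ≡ n
        best₁₁ = regF f₉ best refl ∔ regF f₇ best refl ∔ regF f₆ best refl ∔ regF f₅ best refl ∔
            regF f₄ best refl
                   ∔ reg₃ best refl refl refl ∔ best₀ in
    seqE (frameE (tryE s₁₁ y E₁₁ y< (regF f₉ yst refl))) λ { s₁₂ (f₁₂ , tried) →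
    seqE {κ = 2} (blkE {Q = λ s' → s' ≡ do* (mov bS vst ∷ ld rho 9 vst ∷ []) s₁₂} tt refl) λ { _ refl →
    let s₁₃ = do* (mov bS vst ∷ ld rho 9 vst ∷ []) s₁₂
        E₁₃ = env-frame {blk (mov bS vst ∷ ld rho 9 vst ∷ [])} {s₁₂} refl
                (frame-do* (mov bS vst ∷ ld rho 9 vst ∷ []) s₁₂) (env-frame refl f₁₂ E₁₁)
        D≡ : ∀ u → arr s₁₂ 9 u ≡ arr s₆ 9 u
        D≡ u = arrF f₁₂ 9 refl u ∔ arrF f₉ 9 refl u ∔ D₈ u in
    seqE (frameE (In.Whole.search v v< s₁₃ (adjI E₁₃) (N≡ E₁₃) (zr≡ E₁₃) (regF f₁₂ vst refl)))
        λ { s₁₄ (f₁₄ , dist) →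
    let E₁₄ = env-frame refl f₁₄ E₁₃ in
    seqE (frameE (copyE s₁₄ (N≡ E₁₄))) λ { s₁₅ (f₁₅ , C≡) →
    let E₁₅ = env-frame refl f₁₅ E₁₄
        K₁₅ : reg s₁₅ rK ≡ K
        K₁₅ = regF f₁₅ rK refl ∔ regF f₁₄ rK refl ∔ regF f₁₂ rK refl ∔ regF f₉ rK refl ∔ regF f₇ rK refl
                ∔ regF f₆ rK refl ∔ regF f₅ rK refl ∔ regF f₄ rK refl ∔ regF f₃ rK refl ∔ regF f₂ rK
                    refl ∔ K₁
        rho≡ : reg s₁₅ rho ≡ arr s₆ 9 v
        rho≡ = regF f₁₅ rho refl ∔ regF f₁₄ rho refl ∔ cong (arr s₁₂ 9) (regF f₁₂ vst refl) ∔ D≡ v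
        best₁₅ : reg s₁₅ best ≡ reg s₁₂ best
        best₁₅ = regF f₁₅ best refl ∔ regF f₁₄ best refl in
    monoE (frameE (Candidates.candidatesE s₁₅ E₁₅ K K₁₅)) λ { s₁₆ (f₁₆ , valid′ , b≤ , few) →
      valid′ (subst Valid (sym best₁₅) (Tried.valid′ tried (inj₁ best₁₁))) ,
      subst (λ l → TwoApprox (reg s₁₆ best) ⊎ Unlucky l)
        (sym (logF f₁₆ refl ∔ logF f₁₅ refl ∔ logF f₁₄ refl ∔ logF f₁₂ refl ∔ logF f₉ refl ∔ logF f₇ refl))
        (two-approx-or-missed S L n≤ (≤-reflexive (sym len)) y< v<
           ymin (λ u u< → subst₂ _≤_ (D₈ u) (D₈ v) (vmax u u<)) dist
           (λ u u< → C≡ u u<) rho≡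
           (below-≤ (≤-trans b≤ (≤-reflexive best₁₅)) (Tried.below tried)) few) }
    } } } } } } } } } } } } } } }

  Post : ℕ → List ℕ → Set
  Post x l = ∃[ b ] (b < n × x ≡ suc b ⊎ b ≡ n × x ≡ 0) × Outcome b l

  valid-≤ : ∀ {b} → Valid b → b ≤ n
  valid-≤ (inj₁ p) = ≤-reflexive p
  valid-≤ (inj₂ (y , y< , E)) = let v , v< , q = Ecc.tight E in
    subst (_≤ n) q (DistFrom.dist≤n (Ecc.dist E) v v<)

  mainE : ∀ κ → (n ≤ suc m → workCost ≤ κ) →
    Ex (mainC A) (11 + ((2 + κ) + (2 + 1))) s₀ (λ s → Post (reg s best) (log s))
  mainE κ work≤κ = seqE {κ = 11} (blkE {Q = λ s → s ≡ do* setup s₀} (s≤s z≤n , s≤s (s≤s z≤n) , tt)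
      refl) λ { _ refl →
    seqE (iflE {κ = κ} {Q = λ s → reg s rN ≡ n × Outcome (reg s best) (log s)}
      -- Here `m + 1 < n`, so by `spanning` no vertex reaches all others, and the claim about
      -- `best = n` is vacuous.
      (λ p → subE z≤n (blkE tt (inp0 , inj₁ inp0 , inj₁ λ x r x< R → contradiction
         (GO.spanning λ v v< → let j , _ , w = R v v< in j , w) (<⇒≱ (subst₂ (λ x y → suc x < y) inp1 inp0 p)))))
      (λ q → subE (work≤κ (subst₂ (λ x y → x ≤ suc y) inp0 inp1 q))
          (monoE (frameE (workE (do* setup s₀) inp0 refl inp1 refl inp0 refl (λ _ _ → refl)))
         λ { s (f , o) → regF f rN refl ∔ inp0 , o })))
    λ { s (N≡ , v , o) → iflE
      (λ p → blkE tt (reg s best , inj₁ (subst (reg s best <_) N≡ p , refl) , v , o))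
      (λ p → blkE tt (reg s best , inj₂ (≤-antisym (valid-≤ v) (subst (_≤ reg s best) N≡ p) , refl)
          , v , o)) } }

-- Counting tapes

sumTo-front : ∀ f k → sumTo f (suc k) ≡ f 0 + sumTo (f ∘ suc) k
sumTo-front f zero    = refl
sumTo-front f (suc k) = cong (f (suc k) +_) (sumTo-front f k) ∔ swap (f (suc k)) (f 0) (sumTo (f ∘ suc) k)
  where swap : ∀ a b c → a + (b + c) ≡ b + (a + c)
        swap = solve-∀

sumTo-+ : ∀ f a b → sumTo f (a + b) ≡ sumTo (λ v → f (v + b)) a + sumTo f b
sumTo-+ f zero    b = refl
sumTo-+ f (suc a) b = cong (f (a + b) +_) (sumTo-+ f a b) ∔ sym (+-assoc (f (a + b)) _ _)

sumTo-bounded : ∀ c B f n → (∀ v → v < n → c * f v ≤ B) → c * sumTo f n ≤ n * B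
sumTo-bounded c B f zero    h = ≤-reflexive (*-zeroʳ c)
sumTo-bounded c B f (suc n) h = ≤-trans (≤-reflexive (*-distribˡ-+ c (f n) (sumTo f n)))
  (+-mono-≤ (h n ≤-refl) (sumTo-bounded c B f n λ v v< → h v (m≤n⇒m≤1+n v<)))

sumTo-member : ∀ f {v n} → v < n → f v ≤ sumTo f n
sumTo-member f {v} {suc n} v< with v ≟ n
... | yes refl = m≤m+n _ _
... | no  v≢n  = ≤-trans (sumTo-member f (≤∧≢⇒< (s≤s⁻¹ v<) v≢n)) (m≤n+m _ (f n))

tally : ∀ {A : Set} → (A → ℕ) → List A → ℕ
tally f []       = 0
tally f (x ∷ xs) = f x + tally f xs

tally-++ : ∀ {A : Set} (f : A → ℕ) xs ys → tally f (xs ++ ys) ≡ tally f xs + tally f ys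
tally-++ f []       ys = refl
tally-++ f (x ∷ xs) ys = cong (f x +_) (tally-++ f xs ys) ∔ sym (+-assoc (f x) _ _)

tally-map : ∀ {A B : Set} (f : B → ℕ) (g : A → B) xs → tally f (map g xs) ≡ tally (f ∘ g) xs
tally-map f g []       = refl
tally-map f g (x ∷ xs) = cong (f (g x) +_) (tally-map f g xs)

tally-product : ∀ {A B C : Set} (f : C → ℕ) (g : A → B → C) xs ys →
  tally f (cartesianProductWith g xs ys) ≡ tally (λ x → tally (f ∘ g x) ys) xs
tally-product f g []       ys = refl
tally-product f g (x ∷ xs) ys = tally-++ f (map (g x) ys) _ ∔ cong₂ _+_ (tally-map f (g x) ys)
    (tally-product f g xs ys)

tally-scale : ∀ {A : Set} c B (f g : A → ℕ) → (∀ x → c * f x ≤ g x * B) → ∀ xs → c * tally f xs ≤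
    tally g xs * B
tally-scale c B f g h []       = ≤-reflexive (*-zeroʳ c)
tally-scale c B f g h (x ∷ xs) = ≤-trans (≤-reflexive (*-distribˡ-+ c (f x) (tally f xs)))
  (≤-trans (+-mono-≤ (h x) (tally-scale c B f g h xs))
      (≤-reflexive (sym (*-distribʳ-+ B (g x) (tally g xs)))))

tally-cong : ∀ {A : Set} (f g : A → ℕ) → (∀ x → f x ≡ g x) → ∀ xs → tally f xs ≡ tally g xs
tally-cong f g h []       = refl
tally-cong f g h (x ∷ xs) = cong₂ _+_ (h x) (tally-cong f g h xs)

tally-sum : ∀ {A : Set} (f g : A → ℕ) xs → tally (λ x → f x + g x) xs ≡ tally f xs + tally g xs
tally-sum f g []       = refl
tally-sum f g (x ∷ xs) = cong (f x + g x +_) (tally-sum f g xs) ∔ regroup (f x) (g x) _ _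
  where regroup : ∀ a b c d → a + b + (c + d) ≡ a + c + (b + d)
        regroup = solve-∀

tally-0 : ∀ {A : Set} (xs : List A) → tally (λ _ → 0) xs ≡ 0
tally-0 []       = refl
tally-0 (x ∷ xs) = tally-0 xs

tally-sumTo : ∀ {A : Set} (f : ℕ → A → ℕ) n xs →
  tally (λ x → sumTo (λ v → f v x) n) xs ≡ sumTo (λ v → tally (f v) xs) n
tally-sumTo f zero    xs = tally-0 xs
tally-sumTo f (suc n) xs = tally-sum (f n) _ xs ∔ cong (tally (f n) xs +_) (tally-sumTo f n xs)

tally-1 : ∀ {A : Set} (xs : List A) → tally (λ _ → 1) xs ≡ length xs
tally-1 []       = refl
tally-1 (x ∷ xs) = cong suc (tally-1 xs)

tally-tabulate : ∀ {A : Set} k (f : A → ℕ) (g : Fin k → A) h → (∀ i → f (g i) ≡ h (toℕ i)) →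
  tally f (tabulate g) ≡ sumTo h k
tally-tabulate zero    f g h e = refl
tally-tabulate (suc k) f g h e =
  cong₂ _+_ (e Fin.zero) (tally-tabulate k f (g ∘ Fin.suc) (h ∘ suc) (e ∘ Fin.suc)) ∔ sym (sumTo-front h k)

filter-tally : ∀ {A : Set} {P : A → Set} (P? : Unary.Decidable P) (f : A → ℕ) →
  (∀ x → P x → 0 < f x) → ∀ xs → length (filter P? xs) ≤ tally f xs
filter-tally P? f h []       = z≤n
filter-tally P? f h (x ∷ xs) with P? x
... | yes p = +-mono-≤ (h x p) (filter-tally P? f h xs)
... | no  _ = ≤-trans (filter-tally P? f h xs) (m≤n+m _ (f x))

length-tapes : ∀ w T → length (allTapes w T) ≡ (2 ^ w) ^ T
length-tapes w zero    = refl
length-tapes w (suc T) = sym (tally-1 (allTapes w (suc T))) ∔ tally-product (λ _ → 1) Vec._∷_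
    (allFin (2 ^ w)) (allTapes w T)
  ∔ tally-tabulate (2 ^ w) _ (λ i → i) (λ _ → (2 ^ w) ^ T) (λ _ → tally-1 (allTapes w T) ∔ length-tapes w T)
  ∔ const-sum (2 ^ w)
  where const-sum : ∀ k → sumTo (λ _ → (2 ^ w) ^ T) k ≡ k * (2 ^ w) ^ T
        const-sum zero    = refl
        const-sum (suc k) = cong ((2 ^ w) ^ T +_) (const-sum k)

-- False when fewer than `s` words have been sampled. A run that stops early is thus never counted,
-- and the bound below holds for arbitrary programs.
avoids : (ℕ → Bool) → ℕ → List ℕ → Bool
avoids hit zero    ωs       = true
avoids hit (suc s) []       = false
avoids hit (suc s) (ω ∷ ωs) = not (hit ω) ∧ avoids hit s ωs

all-avoid : ∀ hit {s ωs} → s ≤ length ωs → All (λ ω → hit ω ≡ false) ωs → avoids hit s ωs ≡ true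
all-avoid hit {zero}  le a = refl
all-avoid hit {suc s} (s≤s le) (p ∷ a) rewrite p = all-avoid hit le a

-- If a word avoids hit with probability at most r / (1 + r), then the first s words that a program
-- samples all do so with probability at most (r / (1 + r)) ^ s, however it chooses when to sample.
module Sampling (P : Program) (w : ℕ) (hit : ℕ → Bool) (r : ℕ)
  (rare : suc r * tally (λ ω → fromBool (not (hit (toℕ ω)))) (allFin (2 ^ w)) ≤ r * 2 ^ w) where

  failures : ∀ T → ℕ → State w → ℕ
  failures T s σ = tally (λ ωs → fromBool (avoids hit s (trace P σ ωs))) (allTapes w T)

  emit-view : ∀ i → (∀ ω → emit {w} i ω ≡ []) ⊎ (∀ ω → emit {w} i ω ≡ toℕ ω ∷ [])
  emit-view (const _ _)  = inj₁ λ _ → refl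
  emit-view (op _ _ _ _) = inj₁ λ _ → refl
  emit-view (load _ _)   = inj₁ λ _ → refl
  emit-view (store _ _)  = inj₁ λ _ → refl
  emit-view (rand _)     = inj₂ λ _ → refl
  emit-view (jump _)     = inj₁ λ _ → refl
  emit-view (jzero _ _)  = inj₁ λ _ → refl

  trace-nothing : ∀ {T} (σ : State w) (ωs : Vec (Word w) T) → head (drop (pc σ) P) ≡ nothing → trace
      P σ ωs ≡ []
  trace-nothing σ []       e rewrite e = refl
  trace-nothing σ (ω ∷ ωs) e rewrite e = refl

  trace-[] : ∀ (σ : State w) → trace P σ [] ≡ []
  trace-[] σ with head (drop (pc σ) P)
  ... | nothing = refl
  ... | just _  = refl

  X : ℕ
  X = 2 ^ w

  inner : ∀ T → State w → ℕ → Word w → ℕ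
  inner T σ s ω = tally (λ ωs → fromBool (avoids hit s (trace P σ (ω ∷ ωs)))) (allTapes w T)

  unfold : ∀ {T} s σ → failures (suc T) s σ ≡ tally (inner T σ s) (allFin X)
  unfold {T} s σ = tally-product (λ ωs → fromBool (avoids hit s (trace P σ ωs))) Vec._∷_ (allFin X)
      (allTapes w T)

  all-words : tally (λ _ → 1) (allFin X) ≡ X
  all-words = tally-1 (allFin X) ∔ Listₚ.length-tabulate {n = X} (λ i → i)

  -- Induction on the tape, with denominators cleared. A step that samples spends `rare` once and
  -- leaves one word fewer to avoid; any other step passes the claim on for each of the `X` values
  -- of its tape word. If the program halts or the tape ends too soon, the count is zero.
  bound-failures : ∀ T s σ → suc r ^ s * failures T s σ ≤ r ^ s * X ^ T
  bound-failures T zero σ = ≤-reflexive (cong (1 *_) (tally-1 (allTapes w T) ∔ length-tapes w T))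
  bound-failures zero (suc s) σ = ≤-trans (≤-reflexive
    (cong (λ t → suc r ^ suc s * (fromBool (avoids hit (suc s) t) + 0)) {x = trace P σ []}
        (trace-[] σ) ∔ *-zeroʳ (suc r ^ suc s))) z≤n
  bound-failures (suc T) (suc s) σ = go (head (drop (pc σ) P)) refl
    where
    go : ∀ i → head (drop (pc σ) P) ≡ i → suc r ^ suc s * failures (suc T) (suc s) σ ≤ r ^ suc s * X ^ suc T
    go nothing e = ≤-trans (≤-reflexive (cong (suc r ^ suc s *_)
      (tally-cong _ (λ _ → 0) (λ ωs → cong (fromBool ∘ avoids hit (suc s)) {x = trace P σ ωs}
          (trace-nothing σ ωs e)) (allTapes w (suc T))
        ∔ tally-0 (allTapes w (suc T))) ∔ *-zeroʳ (suc r ^ suc s))) z≤n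
    go (just i) e with emit-view i
    ... | inj₁ silent = ≤-trans (≤-reflexive (cong (suc r ^ suc s *_) (unfold (suc s) σ)))
      (≤-trans (tally-scale (suc r ^ suc s) (r ^ suc s * X ^ T) (inner T σ (suc s)) (λ _ → 1)
          (λ ω → ≤-trans (≤-reflexive (cong (suc r ^ suc s *_)
          (tally-cong _ _ (λ ωs → cong (fromBool ∘ avoids hit (suc s)) {x = trace P σ (ω ∷ ωs)}
              (trace-just {P} {σ = σ} e ∔ cong (_++ trace P (exec i ω σ) ωs) (silent ω))) (allTapes w T))))
          (≤-trans (bound-failures T (suc s) (exec i ω σ)) (≤-reflexive (sym (+-identityʳ _))))) (allFin X))
        (≤-reflexive (cong (_* (r ^ suc s * X ^ T)) all-words ∔ regroup X (r ^ suc s) (X ^ T))))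
      where regroup : ∀ a b c → a * (b * c) ≡ b * (a * c)
            regroup = solve-∀
    ... | inj₂ loud = ≤-trans (≤-reflexive (cong (suc r ^ suc s *_) (unfold (suc s) σ) ∔ *-assoc
        (suc r) (suc r ^ s) _))
      (≤-trans (*-monoʳ-≤ (suc r) (tally-scale (suc r ^ s) (r ^ s * X ^ T) (inner T σ (suc s))
          (λ ω → fromBool (not (hit (toℕ ω)))) one (allFin X)))
      (≤-trans (≤-reflexive (sym (*-assoc (suc r) misses (r ^ s * X ^ T))))
      (≤-trans (*-monoˡ-≤ (r ^ s * X ^ T) rare) (≤-reflexive (regroup r X (r ^ s) (X ^ T))))))
      where
      misses : ℕ
      misses = tally (λ ω → fromBool (not (hit (toℕ ω)))) (allFin X)
      regroup : ∀ a b c d → a * b * (c * d) ≡ a * c * (b * d)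
      regroup = solve-∀
      one : ∀ ω → suc r ^ s * tally (λ ωs → fromBool (avoids hit (suc s) (trace P σ (ω ∷ ωs))))
          (allTapes w T)
                ≤ fromBool (not (hit (toℕ ω))) * (r ^ s * X ^ T)
      one ω = ≤-trans (≤-reflexive (cong (suc r ^ s *_) (tally-cong _ _ (λ ωs →
          cong (fromBool ∘ avoids hit (suc s)) {x = trace P σ (ω ∷ ωs)}
              (trace-just {P} {σ = σ} e ∔ cong (_++ trace P (exec i ω σ) ωs) (loud ω)))
          (allTapes w T)))) (split (hit (toℕ ω)))
        where
        split : ∀ b → suc r ^ s * tally (λ ωs → fromBool
            (not b ∧ avoids hit s (trace P (exec i ω σ) ωs))) (allTapes w T)
                      ≤ fromBool (not b) * (r ^ s * X ^ T)
        split true  = ≤-reflexive (cong (suc r ^ s *_) (tally-0 (allTapes w T)) ∔ *-zeroʳ (suc r ^ s))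
        split false = ≤-trans (bound-failures T s (exec i ω σ)) (≤-reflexive (sym (+-identityʳ _)))

-- Amplification by repeated sampling

-- Bernoulli's inequality `(1 + 1/x)^k ≥ 1 + k/x`, multiplied by `x ^ suc k`.
bernoulli : ∀ x k → x ^ k * (x + k) ≤ suc x ^ k * x
bernoulli x zero    = ≤-reflexive (cong (1 *_) (+-identityʳ x))
bernoulli x (suc k) = ≤-trans (≤-trans (m≤m+n _ (x ^ k * k)) (≤-reflexive (regroup x k (x ^ k))))
  (≤-trans (*-monoʳ-≤ (suc x) (bernoulli x k)) (≤-reflexive (sym (*-assoc (suc x) (suc x ^ k) x))))
  where regroup : ∀ x k p → x * p * (x + (1 + k)) + p * k ≡ (1 + x) * (p * (x + k))
        regroup = solve-∀

-- Bernoulli with exponent `x + 1` gives the factor `2 + 1/x`. So `x + 1` trials, each failing with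
-- probability `x / (x + 1)`, all fail with probability at most 1/2.
halving : ∀ x → 0 < x → 2 * x ^ suc x ≤ suc x ^ suc x
halving x@(suc _) _ = *-cancelʳ-≤ (2 * x ^ suc x) (suc x ^ suc x) x
  (≤-trans (≤-trans (m≤m+n _ (x ^ suc x)) (≤-reflexive (regroup x (x ^ suc x)))) (bernoulli x (suc x)))
  where regroup : ∀ x p → 2 * p * x + p ≡ p * (x + (1 + x))
        regroup = solve-∀

^-distrib-* : ∀ x y k → (x * y) ^ k ≡ x ^ k * y ^ k
^-distrib-* x y zero    = refl
^-distrib-* x y (suc k) = cong (x * y *_) (^-distrib-* x y k) ∔ regroup x y (x ^ k) (y ^ k)
  where regroup : ∀ a b c d → a * b * (c * d) ≡ a * c * (b * d)
        regroup = solve-∀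

-- The trials form `k` blocks of `x + 1`, and each block halves the bound.
amplify : ∀ x k {B Y} → 0 < x → suc x ^ (suc x * k) * B ≤ x ^ (suc x * k) * Y → 2 ^ k * B ≤ Y
amplify x@(suc _) k {B} {Y} x>0 h = *-cancelˡ-≤ (x ^ (suc x * k)) {{m^n≢0 x (suc x * k)}}
  (≤-trans (≤-trans (≤-reflexive eq₁) (*-monoˡ-≤ B (^-monoˡ-≤ k (halving x x>0))))
    (≤-trans (≤-reflexive (cong (_* B) (^-*-assoc (suc x) (suc x) k))) h))
  where
  eq₁ : x ^ (suc x * k) * (2 ^ k * B) ≡ (2 * x ^ suc x) ^ k * B
  eq₁ = cong (_* (2 ^ k * B)) (sym (^-*-assoc x (suc x) k)) ∔ regroup ((x ^ suc x) ^ k) (2 ^ k) B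
        ∔ cong (_* B) (sym (^-distrib-* 2 (x ^ suc x) k))
    where regroup : ∀ a b c → a * (b * c) ≡ b * a * c
          regroup = solve-∀

-- A word modulo `n` is not uniform unless `n` divides `X`. Counting only the `X / n` full periods
-- loses at most a factor 2, and `n ≤ 4 K²` turns the density `K / n` into at least `1 / (4 K)`. A
-- hit thus has probability at least `1 / (8 K)`.
hits-often : ∀ n K X p → .{{_ : NonZero n}} → n ≤ X → n ≤ 4 * (K * K) → K ≤ sumTo (fromBool ∘ p) n →
  X ≤ 8 * K * sumTo (λ ω → fromBool (p (ω % n))) X
hits-often n K X p n≤X n≤ K≤ = ≤-trans X≤ (≤-trans (*-monoˡ-≤ (2 * t) n≤)
  (≤-trans (≤-reflexive (regroup K t)) (*-monoʳ-≤ (8 * K) (≤-trans (*-monoʳ-≤ t K≤) many))))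
  where
  t = X / n
  f : ℕ → ℕ
  f ω = fromBool (p (ω % n))
  regroup : ∀ K t → 4 * (K * K) * (2 * t) ≡ 8 * K * (t * K)
  regroup = solve-∀
  X≤ : X ≤ n * (2 * t)
  X≤ = ≤-trans (≤-reflexive (m≡m%n+[m/n]*n X n)) (≤-trans
      (+-mono-≤ (<⇒≤ (m%n<n X n)) (≤-reflexive (*-comm t n)))
    (≤-trans (+-monoˡ-≤ (n * t) (≤-trans (≤-reflexive (sym (*-identityʳ n))) (*-monoʳ-≤ n (m≥n⇒m/n>0 n≤X))))
      (≤-reflexive (regroup′ n t))))
    where regroup′ : ∀ n t → n * t + n * t ≡ n * (2 * t)
          regroup′ = solve-∀
  periods : ∀ t → sumTo f (t * n) ≡ t * sumTo (fromBool ∘ p) n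
  periods zero    = refl
  periods (suc t) = sumTo-+ f n (t * n) ∔ cong₂ _+_
    (sumTo-cong n λ v v< → cong (fromBool ∘ p) ([m+kn]%n≡m%n v t n ∔ m<n⇒m%n≡m v<)) (periods t)
  many : t * sumTo (fromBool ∘ p) n ≤ sumTo f X
  many = ≤-trans (≤-reflexive (sym (periods t))) (sumTo-≤ f (m/n*n≤m X n))

-- Running time and word size

√-upper : ∀ k → k < suc ⌊√ k ⌋ * suc ⌊√ k ⌋
√-upper zero    = s≤s z≤n
√-upper (suc k) with suc ⌊√ k ⌋ * suc ⌊√ k ⌋ ≤? suc k
... | yes p = subst (λ r → suc k < suc r * suc r) (sym (√-jump k p))
        (≤-<-trans (√-upper k) (*-mono-< (n<1+n (suc ⌊√ k ⌋)) (n<1+n (suc ⌊√ k ⌋))))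
... | no ¬p = subst (λ r → suc k < suc r * suc r) (sym (√-step k (≰⇒> ¬p))) (≰⇒> ¬p)

-- From `n < (K + 1)²` and `K ≥ 1`.
n≤4√n² : ∀ {n} → 0 < n → n ≤ 4 * (⌊√ n ⌋ * ⌊√ n ⌋)
n≤4√n² {n} n>0 = ≤-trans (<⇒≤ (√-upper n))
  (≤-trans (*-mono-≤ (+-monoˡ-≤ K (√-positive n>0)) (+-monoˡ-≤ K (√-positive n>0)))
      (≤-reflexive (regroup K)))
  where K = ⌊√ n ⌋
        regroup : ∀ K → (K + K) * (K + K) ≡ 4 * (K * K)
        regroup = solve-∀

n≤2^⌈log₂n⌉ : ∀ n → n ≤ 2 ^ ⌈log₂ n ⌉
n≤2^⌈log₂n⌉ = <-rec _ go
  where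
  go : ∀ n → (∀ {k} → k < n → k ≤ 2 ^ ⌈log₂ k ⌉) → n ≤ 2 ^ ⌈log₂ n ⌉
  go zero          rec = z≤n
  go (suc zero)    rec = m^n>0 2 ⌈log₂ 1 ⌉
  go n@(suc (suc k)) rec = ≤-trans (≤-reflexive (sym (⌊n/2⌋+⌈n/2⌉≡n n)))
    (≤-trans (+-monoˡ-≤ h (⌊n/2⌋≤⌈n/2⌉ n)) (≤-trans (≤-reflexive (cong (h +_) (sym (+-identityʳ h))))
      (≤-trans (*-monoʳ-≤ 2 (rec (⌈n/2⌉<n k))) (≤-reflexive
          (cong (2 *_) (cong (2 ^_) (⌈log₂⌈n/2⌉⌉≡⌈log₂n⌉∸1 n)) ∔ cong (2 ^_) ℓ≡)))))
    where
    h = ⌈ n /2⌉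
    ℓ≡ : suc (⌈log₂ n ⌉ ∸ 1) ≡ ⌈log₂ n ⌉
    ℓ≡ = m+[n∸m]≡n {1} (⌈log₂⌉-mono-≤ {2} {n} (s≤s (s≤s z≤n)))

⌈log₂⌉-least : ∀ {n} L → n ≤ 2 ^ L → ⌈log₂ n ⌉ ≤ L
⌈log₂⌉-least L p = ≤-trans (⌈log₂⌉-mono-≤ p) (≤-reflexive (⌈log₂2^n⌉≡n L))

module Budget (A n m L K : ℕ) (n≤μ : n ≤ suc m) (L>0 : 0 < L) (K>0 : 0 < K) where

  μ = suc m

  infix 4 _≼_
  -- The coefficient is part of the type, so that combining bounds also computes the constants.
  -- Every term becomes a multiple of `m + 1`, thanks to `n ≤ m + 1`.
  record _≼_ (x c : ℕ) : Set where
    constructor linear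
    field holds : x ≤ c * μ

  lin : ∀ a b c {x} → x ≡ a + b * n + c * m → x ≼ (a + b + c)
  lin a b c refl = linear (≤-trans (+-mono-≤ (+-mono-≤
      (≤-trans (≤-reflexive (sym (*-identityʳ a))) (*-monoʳ-≤ a (s≤s z≤n)))
      (*-monoʳ-≤ b n≤μ)) (*-monoʳ-≤ c (n≤1+n m))) (≤-reflexive (regroup a b c μ)))
    where regroup : ∀ a b c x → a * x + b * x + c * x ≡ (a + b + c) * x
          regroup = solve-∀

  bfs≤ : 3 + n * 4 + (5 + (2 + (10 * n + 10 * m))) ≼ 34
  bfs≤ = lin 10 14 10 (regroup n m)
    where regroup : ∀ n m → 3 + n * 4 + (5 + (2 + (10 * n + 10 * m))) ≡ 10 + 14 * n + 10 * m
          regroup = solve-∀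

  loop≤ : 3 + n * 8 ≼ 11
  loop≤ = lin 3 8 0 (cong (3 +_) (*-comm n 8) ∔ sym (+-identityʳ _))

  affine : ∀ a b {b'} → b' ≡ b → a + n * b' ≼ (a + b)
  affine a b refl = subst (a + n * b ≼_) (+-identityʳ (a + b))
    (lin a b 0 (cong (a +_) (*-comm n b) ∔ sym (+-identityʳ _)))

  const≤ : ∀ a → a ≼ a
  const≤ a = linear (≤-trans (≤-reflexive (sym (*-identityʳ a))) (*-monoʳ-≤ a (s≤s z≤n)))

  infixr 5 _⊞_
  _⊞_ : ∀ {a b x y} → x ≼ a → y ≼ b → x + y ≼ (a + b)
  _⊞_ {a} {b} (linear p) (linear q) = linear (≤-trans (+-mono-≤ p q)
      (≤-reflexive (sym (*-distribʳ-+ μ a b))))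

  try≤ : 3 + n * 4 + (5 + (2 + (10 * n + 10 * m))) + (1 + ((3 + n * 7) + 3)) ≼ 48
  try≤ = bfs≤ ⊞ const≤ 1 ⊞ affine 3 7 refl ⊞ const≤ 3

  scaled : ∀ k c {x} → x ≼ c → k * x ≼ (k * c)
  scaled k c (linear p) = linear (≤-trans (*-monoʳ-≤ k p) (≤-reflexive (sym (*-assoc k c μ))))

  work≤ : ∀ {cell n>0 s< t< i₀ i₁ ok} → K ≡ ⌊√ n ⌋ →
    Correctness.workCost A n m cell n>0 s< t< i₀ i₁ L ok ≤ (245 + 94 * A) * (μ * (L * K))
  work≤ refl = ≤-trans (_≼_.holds
    (affine 4 11 refl ⊞ affine 6 7 refl ⊞ const≤ 3
     ⊞ lin 4 0 17 (cong (4 +_) (*-comm m 17)) ⊞ affine 3 4 refl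
     ⊞ (const≤ 3 ⊞ scaled (A * L * K) 94 (const≤ 3 ⊞ const≤ 1 ⊞ bfs≤ ⊞ loop≤ ⊞ bfs≤ ⊞ loop≤))
     ⊞ (const≤ 1 ⊞ loop≤) ⊞ const≤ 1 ⊞ (const≤ 1 ⊞ loop≤) ⊞ const≤ 1 ⊞ const≤ 1 ⊞ try≤ ⊞ const≤ 2 ⊞ bfs≤
     ⊞ affine 3 5 refl ⊞ (const≤ 2 ⊞ const≤ 2 ⊞ affine 0 10 refl ⊞ scaled K 50 (const≤ 2 ⊞ try≤))))
    -- 195 is for what is done once, 94 for each of the `A * L * K` samples, 50 for each of the `K`
    -- searches. As `L` and `K` are positive, all fit under multiples of `L * K`.
    (≤-trans (*-monoˡ-≤ μ (≤-trans (≤-reflexive (total A L K)) (+-mono-≤ (+-mono-≤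
        (*-monoʳ-≤ 195 (*-mono-≤ L>0 K>0)) (≤-reflexive (cong (94 *_) (*-assoc A L K))))
        (*-monoʳ-≤ 50 (≤-trans (≤-reflexive (sym (*-identityˡ K))) (*-monoˡ-≤ K L>0))))))
      (≤-reflexive (regroup A μ (L * K))))
    where
    total : ∀ A L K → 15 + (13 + (3 + (21 + (7 + ((3 + A * L * K * 94) +
        (12 + (1 + (12 + (1 + (1 + (48 + (2 + (34
      + (8 + (2 + (2 + (10 + K * 50))))))))))))))))) ≡ 195 * (1 * 1) + 94 * (A * L * K) + 50 * K
    total = solve-∀
    regroup : ∀ A μ x → (195 * x + 94 * (A * x) + 50 * x) * μ ≡ (245 + 94 * A) * (μ * x)
    regroup = solve-∀

-- The factor 4 comes from m + 1 ≤ 2 m and ⌈log₂ n⌉ + 1 ≤ 2 ⌈log₂ n⌉, which hold unless n = 1.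
product≤ : ∀ n m → 0 < n → m ≤ n * n → n ≤ suc m →
  suc m * (suc ⌈log₂ n ⌉ * ⌊√ n ⌋) ≤ 4 * suc (m * ⌊√ n ⌋ * ⌈log₂ n ⌉ ^ 2)
product≤ (suc zero) m _ m≤ _ = ≤-trans (*-monoˡ-≤ 1 (s≤s m≤))
    (≤-trans (m≤m+n 2 2) (m≤m*n 4 (suc (m * 1 * 0))))
product≤ n@(suc (suc k)) m _ _ n≤ = ≤-trans (*-mono-≤ μ≤ (*-monoˡ-≤ K ℓ≤))
    (≤-trans (≤-reflexive (regroup m K (ℓ ^ 2)))
    (*-monoʳ-≤ 4 (n≤1+n _)))
  where
  K = ⌊√ n ⌋
  ℓ = ⌈log₂ n ⌉
  ℓ>0 : 0 < ℓ
  ℓ>0 = ⌈log₂⌉-mono-≤ {2} {n} (s≤s (s≤s z≤n))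
  μ≤ : suc m ≤ 2 * m
  μ≤ = ≤-trans (+-monoˡ-≤ m (≤-trans (s≤s z≤n) (s≤s⁻¹ n≤)))
      (≤-reflexive (cong (m +_) (sym (+-identityʳ m))))
  ℓ≤ : suc ℓ ≤ 2 * ℓ ^ 2
  ℓ≤ = ≤-trans (+-monoˡ-≤ ℓ ℓ>0) (≤-trans (≤-reflexive (cong (ℓ +_) (sym (+-identityʳ ℓ))))
    (*-monoʳ-≤ 2 (≤-trans (≤-reflexive (sym (*-identityˡ ℓ)))
        (*-mono-≤ ℓ>0 (≤-reflexive (sym (*-identityʳ ℓ)))))))
  regroup : ∀ m K q → 2 * m * (2 * q * K) ≡ 4 * (m * K * q)
  regroup = solve-∀

-- The polynomial D n⁵ dominates every address in use.
width : ∀ D n → 0 < n → D * n ^ 5 ≤ 2 ^ ((D + 5) * suc ⌈log₂ n ⌉)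
width D n n>0 = ≤-trans (*-mono-≤ (<⇒≤ (n<2^n D)) (≤-trans (^-monoˡ-≤ 5 (n≤2^⌈log₂n⌉ n))
    (≤-reflexive (^-*-assoc 2 ⌈log₂ n ⌉ 5))))
  (≤-trans (≤-reflexive (sym (^-distribˡ-+-* 2 D (⌈log₂ n ⌉ * 5))))
    (^-monoʳ-≤ 2 (≤-trans (m≤m+n _ (5 + D * ⌈log₂ n ⌉)) (≤-reflexive (regroup D ⌈log₂ n ⌉)))))
  where regroup : ∀ D l → D + l * 5 + (5 + D * l) ≡ (D + 5) * suc l
        regroup D l = expand D l
          where expand : ∀ D l → D + l * 5 + (5 + D * l) ≡ (D + 5) * (1 + l)
                expand = solve-∀

-- The exponent 5 is 2 + 1 + 2, from the crude bounds `m ≤ n²`, `⌊√ n ⌋ ≤ n` and `⌈log₂ n ⌉² ≤ n²`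
-- on the factors of the running time.
fits-width : ∀ A C n m → 0 < n → m ≤ n * n →
  16 + ((2 + 2 * A) * (n * n) + C * suc (m * ⌊√ n ⌋ * ⌈log₂ n ⌉ ^ 2) + suc m) * 16
    ≤ 16 * (5 + 2 * A + 2 * C) * n ^ 5
fits-width A C n m n>0 m≤ = ≤-trans (≤-reflexive (regroup₁ ((2 + 2 * A) * (n * n))
    (C * suc (m * K * ℓ ^ 2)) m))
  (≤-trans (*-monoʳ-≤ 16 (+-mono-≤ (+-mono-≤ (+-mono-≤ (*-monoʳ-≤ (2 + 2 * A) n²≤)
      (*-monoʳ-≤ C (+-mono-≤ 1≤ (*-mono-≤ (*-mono-≤ m≤ (√-≤ n)) (^-monoˡ-≤ 2 ℓ≤)))))
      (≤-trans m≤ n²≤)) (*-monoʳ-≤ 2 1≤)))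
    (≤-reflexive (regroup₂ A C n)))
  where
  K = ⌊√ n ⌋
  ℓ = ⌈log₂ n ⌉
  ℓ≤ : ℓ ≤ n
  ℓ≤ = ⌈log₂⌉-least n (<⇒≤ (n<2^n n))
  1≤ : 1 ≤ n ^ 5
  1≤ = m^n>0 n {{>-nonZero n>0}} 5
  n²≤ : n * n ≤ n ^ 5
  n²≤ = *-monoʳ-≤ n (≤-trans (≤-reflexive (sym (*-identityʳ n)))
      (*-monoʳ-≤ n (m^n>0 n {{>-nonZero n>0}} 3)))
  regroup₁ : ∀ a b m → 16 + (a + b + (1 + m)) * 16 ≡ 16 * (a + b + m + 2 * 1)
  regroup₁ = solve-∀
  regroup₂ : ∀ A C n → 16 * ((2 + 2 * A) * (n * (n * (n * (n * (n * 1))))) + C *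
      (n * (n * (n * (n * (n * 1)))) + n * n * n * (n * (n * 1)))
      + n * (n * (n * (n * (n * 1)))) + 2 * (n * (n * (n * (n * (n * 1)))))) ≡ 16 *
          (5 + 2 * A + 2 * C) * (n * (n * (n * (n * (n * 1)))))
  regroup₂ = solve-∀

-- The graph as the program reads it

source target : ∀ {n m} → Digraph n m → ℕ → ℕ
source G e = input G (2 + 2 * e)
target G e = input G (3 + 2 * e)

module Encoding {n m} (G : Digraph n m) where

  flat : ∀ {m} → Vec (Fin n × Fin n) m → List ℕ
  flat es = concatMap (λ (u , v) → toℕ u ∷ toℕ v ∷ []) (toList es)

  endpoints : ∀ {m} (es : Vec (Fin n × Fin n) m) (i : Fin m) →
    fromMaybe 0 (head (drop (2 * toℕ i) (flat es))) ≡ toℕ (proj₁ (Vec.lookup es i)) ×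
    fromMaybe 0 (head (drop (suc (2 * toℕ i)) (flat es))) ≡ toℕ (proj₂ (Vec.lookup es i))
  endpoints (_ ∷ _)     Fin.zero    = refl , refl
  endpoints es@(_ ∷ es') (Fin.suc i) = let p , q = endpoints es' i in
    cong (λ k → fromMaybe 0 (head (drop k (flat es)))) (*-suc 2 (toℕ i)) ∔ p ,
    cong (λ k → fromMaybe 0 (head (drop (suc k) (flat es)))) (*-suc 2 (toℕ i)) ∔ q

  source≡ : ∀ i → source G (toℕ i) ≡ toℕ (proj₁ (Vec.lookup (edges G) i))
  source≡ i = endpoints (edges G) i .proj₁

  target≡ : ∀ i → target G (toℕ i) ≡ toℕ (proj₂ (Vec.lookup (edges G) i))
  target≡ i = endpoints (edges G) i .proj₂

  source< : ∀ e → e < m → source G e < n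
  source< e e< = subst (λ k → source G k < n) (Finₚ.toℕ-fromℕ< e<)
    (subst (_< n) (sym (source≡ (fromℕ< e<))) (Finₚ.toℕ<n _))

  target< : ∀ e → e < m → target G e < n
  target< e e< = subst (λ k → target G k < n) (Finₚ.toℕ-fromℕ< e<)
    (subst (_< n) (sym (target≡ (fromℕ< e<))) (Finₚ.toℕ<n _))

  halve : ∀ a → ∃[ e ] (a ≡ 2 * e ⊎ a ≡ suc (2 * e))
  halve zero    = 0 , inj₁ refl
  halve (suc a) with halve a
  ... | e , inj₁ p = e , inj₂ (cong suc p)
  ... | e , inj₂ p = suc e , inj₁ (cong suc p ∔ sym (*-suc 2 e))

  input≤ : ∀ {B} → n ≤ B → m ≤ B → ∀ a → a < 2 + 2 * m → input G a ≤ B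
  input≤ n≤ m≤ zero          _ = n≤
  input≤ n≤ m≤ (suc zero)    _ = m≤
  input≤ {B} n≤ m≤ (suc (suc a)) (s≤s (s≤s a<)) with halve a
  ... | e , inj₁ refl = ≤-trans (<⇒≤ (source< e (*-cancelˡ-< 2 e m a<))) n≤
  ... | e , inj₂ refl = ≤-trans (<⇒≤ (target< e (*-cancelˡ-< 2 e m (<-trans (n<1+n _) a<)))) n≤

  -- There are no parallel edges, so an edge is determined by its endpoints. This is what lets all
  -- addresses fit into `O(log n)` bits.
  m≤n² : m ≤ n * n
  m≤n² = Finₚ.injective⇒≤ {f = λ i → let u , v = Vec.lookup (edges G) i in combine u v} λ {i} {j} p →
    let q , r = Finₚ.combine-injective _ _ _ _ p in Uniqueₚ.lookup-injective (unique G) i j (cong₂ _,_ q r)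

  open Graph m (source G) (target G)

  path⇒walk : ∀ {x y k} → Path G x y k → Walk (toℕ x) (toℕ y) k
  path⇒walk here       = nil
  path⇒walk {y = z} {k = suc k} (step {x} {y} e p) = subst (λ v → Walk v (toℕ z) (suc k))
    (source≡ i ∔ cong (toℕ ∘ proj₁) (sym (VecAnyₚ.lookup-index e)))
    (cons (Finₚ.toℕ<n i) (subst (λ v → Walk v (toℕ z) k)
       (sym (target≡ i ∔ cong (toℕ ∘ proj₂) (sym (VecAnyₚ.lookup-index e)))) (path⇒walk p)))
    where i = VecAny.index e

  walk⇒path : ∀ {a b k} → Walk a b k → ∀ {x y} → a ≡ toℕ x → b ≡ toℕ y → Path G x y k
  walk⇒path nil refl q with Finₚ.toℕ-injective q
  ... | refl = here
  walk⇒path (cons {e} e< w) {x} p q = step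
    (subst (_∈ᵥ edges G) (cong₂ _,_ (Finₚ.toℕ-injective
        (sym (source≡ i) ∔ cong (source G) (Finₚ.toℕ-fromℕ< e<) ∔ p)) refl)
       (∈ₚ.∈-lookup i (edges G)))
    (walk⇒path w (cong (target G) (sym (Finₚ.toℕ-fromℕ< e<)) ∔ target≡ i) q)
    where i = fromℕ< e<

-- From the computed value to the source radius

module Radius {n m} (G : Digraph n m) (A : ℕ) (n>0 : 0 < n)
  (maxL : ℕ) (maxL-ok : ∀ L → 2 ^ L ≤ 2 * n → L ≤ maxL) where

  open Encoding G
  open Correctness A n m (input G) n>0 source< target< refl refl maxL maxL-ok
  open GO using (DistFrom)

  ecc⇒eccentricity : ∀ {y e} (y< : y < n) → Ecc y e → e < n → IsEccentricity G (fromℕ< y<) [ e ]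
  ecc⇒eccentricity {y} {e} y< E e<n = (fromℕ< w< , subst (IsDistance G (fromℕ< y<) (fromℕ< w<))
      (cong [_] w≡) (at (fromℕ< w<) δw<)) , upper
    where
    open Ecc E
    open DistFrom dist
    w< = tight .proj₂ .proj₁
    w≡ : δ (toℕ (fromℕ< w<)) ≡ e
    w≡ = cong δ (Finₚ.toℕ-fromℕ< w<) ∔ tight .proj₂ .proj₂
    δw< : δ (toℕ (fromℕ< w<)) < n
    δw< = subst (_< n) (sym w≡) e<n
    path : ∀ v → δ (toℕ v) < n → Path G (fromℕ< y<) v (δ (toℕ v))
    path v p = walk⇒path (attained (toℕ v) (Finₚ.toℕ<n v) p) (sym (Finₚ.toℕ-fromℕ< y<)) refl
    short : ∀ {v j} → Path G (fromℕ< y<) v j → δ (toℕ v) ≤ j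
    short p = shortest (subst (λ z → GO.Walk z _ _) (Finₚ.toℕ-fromℕ< y<) (path⇒walk p)) .proj₂
    at : ∀ v → δ (toℕ v) < n → IsDistance G (fromℕ< y<) v [ δ (toℕ v) ]
    at v p = finite (path v p) short
    reached : ∀ v → δ (toℕ v) < n
    reached v = ≤-<-trans (δ≤e (toℕ v) (Finₚ.toℕ<n v)) e<n
    upper : ∀ v d → IsDistance G (fromℕ< y<) v d → d ≤⁺ [ e ]
    upper v _ (finite p min)  = ≤[ ≤-trans (min (path v (reached v))) (δ≤e (toℕ v) (Finₚ.toℕ<n v)) ]
    upper v _ (infinite none) = contradiction (path v (reached v)) none

  -- Whether v is within distance r of x is decidable; if it were not, then by induction on the
  -- length there would be no path from x to v at all, at odds with the eccentricity r of x.
  eccentricity⇒reach : ∀ {x r} → IsEccentricity G x [ r ] → Reach (toℕ x) r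
  eccentricity⇒reach {x} {r} (_ , upper) v v< with near-to? v r (toℕ x)
  ... | yes (j , s≤s j≤ , w) = j , j≤ , w
  ... | no  far = contradiction (upper v' ⊤⁺ (infinite λ {j} → none j)) λ ()
    where
    v' = fromℕ< v<
    walk : ∀ {j} → Path G x v' j → GO.Walk (toℕ x) v j
    walk p = subst (λ z → GO.Walk (toℕ x) z _) (Finₚ.toℕ-fromℕ< v<) (path⇒walk p)
    none : ∀ j → ¬ Path G x v' j
    none = <-rec _ λ j shorter p → case upper v' [ j ] (finite p λ {i} q → ≮⇒≥ λ i<j → shorter i<j q) of
      λ { ≤[ j≤r ] → far (j , s≤s j≤r , walk p) }

  -- The lower bound requires no luck, since a valid value is ∞ or an eccentricity; the upper bound
  -- applies `TwoApprox` to a centre.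
  post⇒approximates : ∀ R → IsSourceRadius G R → ∀ x l → Post x l → 2-Approximates R (decode x) ⊎ Unlucky l
  post⇒approximates R (_ , least) x l (b , _ , _ , inj₂ u) = inj₂ u
  post⇒approximates R ((c , ecc) , least) x l (b , out , valid , inj₁ approx) = inj₁
      (lower out valid , upper R ecc out)
    where
    lower : ∀ {x} → (b < n × x ≡ suc b ⊎ b ≡ n × x ≡ 0) → Valid b → R ≤⁺ decode x
    lower (inj₂ (_ , refl))  _ = R ≤⊤⁺
    lower (inj₁ (b< , refl)) (inj₁ refl) = contradiction b< (<-irrefl refl)
    lower (inj₁ (b< , refl)) (inj₂ (y , y< , E)) = least _ _ (ecc⇒eccentricity y< E b<)
    upper : ∀ R → IsEccentricity G c R → ∀ {x} → (b < n × x ≡ suc b ⊎ b ≡ n × x ≡ 0) → decode x ≤⁺ (2· R)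
    upper ⊤⁺    _ _ = _ ≤⊤⁺
    upper [ r ] e o with approx (toℕ c) r (Finₚ.toℕ<n c) (eccentricity⇒reach e)
    upper [ r ] e (inj₁ (_ , refl))    | _ , b≤ = ≤[ b≤ ]
    upper [ r ] e (inj₂ (refl , refl)) | b< , _ = contradiction b< (<-irrefl refl)

-- Union bound over the in-balls

all-ʳ++ : ∀ {P : ℕ → Set} xs {ys} → All P (xs ʳ++ ys) → All P xs × All P ys
all-ʳ++ []       a = [] , a
all-ʳ++ (x ∷ xs) a with all-ʳ++ xs a
... | b , (p ∷ c) = (p ∷ b) , c

rem-% : ∀ n .{{_ : NonZero n}} ω → ⟦ rem ⟧ 0 ω n ≡ ω % n
rem-% (suc n) ω = refl

∧-intro : ∀ {a b} → a ≡ true → b ≡ true → a ∧ b ≡ true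
∧-intro refl refl = refl


module Success (a A n m : ℕ) (A≡ : A ≡ 8 * (2 + a)) .{{_ : NonZero n}} (G : Digraph n m) (n>0 : 0 < n)
  (maxL : ℕ) (maxL-ok : ∀ L → 2 ^ L ≤ 2 * n → L ≤ maxL) (P : Program) (w T : ℕ) (n≤X : n ≤ 2 ^ w) where

  open Encoding G
  open Correctness A n m (input G) n>0 source< target< refl refl maxL maxL-ok
  open Radius G A n>0 maxL maxL-ok

  ℓ : ℕ
  ℓ = ⌈log₂ n ⌉

  σ : State w
  σ = initial w G

  module Analysed (outcome : (ωs : Vec (Word w) T) → ∃[ x ] run P σ ωs ≡ just x × Post (toℕ x)
      (trace P σ ωs ʳ++ [])) where

    halts : (ωs : Vec (Word w) T) → Is-just (run P σ ωs)
    halts ωs = subst Is-just (sym (outcome ωs .proj₂ .proj₁)) (just tt)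

    hit : ℕ → ℕ → ℕ → Bool
    hit v r ω = ball v r (vertex ω)

    s : ℕ
    s = A * ℓ * K

    -- The size test is part of the event, so the union bound may run over all `n * n` pairs, and
    -- small balls contribute nothing.
    event : ℕ → ℕ → Vec (Word w) T → ℕ
    event v r ωs = fromBool ((K ≤ᵇ count (ball v r) n) ∧ avoids (hit v r) s (trace P σ ωs))

    unlucky⇒event : ∀ ωs → Unlucky (trace P σ ωs ʳ++ []) → 0 < sumTo (λ v → sumTo (λ r → event v r ωs) n) n
    unlucky⇒event ωs (v , r , v< , r< , big , M) = ≤-trans (≤-trans (≤-reflexive (sym happens))
        (sumTo-member (λ r → event v r ωs) r<)) (sumTo-member (λ v → sumTo (λ r → event v r ωs) n) v<)
      where
      open Missed M
      happens : event v r ωs ≡ 1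
      happens = cong fromBool (∧-intro (T⇒true _ (≤⇒≤ᵇ big)) (all-avoid (hit v r)
        (≤-trans (*-monoˡ-≤ K (*-monoʳ-≤ A (⌈log₂⌉-least L L-ok)))
          (≤-trans enough (≤-reflexive (Listₚ.length-ʳ++ (trace P σ ωs) ∔ +-identityʳ _))))
        (all-ʳ++ (trace P σ ωs) avoid .proj₁)))

    -- `q / (q + 1)` is `1 - 1/(8 K)`, the bound on the probability that a word misses a large ball.
    X q : ℕ
    X = 2 ^ w
    q = pred (8 * K)

    8K≡ : suc q ≡ 8 * K
    8K≡ = suc-pred (8 * K) {{>-nonZero (*-mono-≤ {1} {8} (s≤s z≤n) (√-positive n>0))}}

    rare : ∀ v r → K ≤ count (ball v r) n →
      suc q * tally (λ ω → fromBool (not (hit v r (toℕ ω)))) (allFin X) ≤ q * X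
    -- `X`, which is at most `suc q` times the hits, is added to both sides; hits and misses
    -- together make `X`.
    rare v r big = +-cancelˡ-≤ X _ _ (≤-trans (+-monoˡ-≤ (suc q * misses) often) (≤-reflexive
      (sym (*-distribˡ-+ (suc q) hits misses) ∔ cong (suc q *_) both)))
      where
      hits misses : ℕ
      hits = tally (λ ω → fromBool (hit v r (toℕ ω))) (allFin X)
      misses = tally (λ ω → fromBool (not (hit v r (toℕ ω)))) (allFin X)
      both : hits + misses ≡ X
      both = sym (tally-sum (λ ω → fromBool (hit v r (toℕ ω))) _ (allFin X))
        ∔ tally-cong _ (λ _ → 1) (λ ω → complement (hit v r (toℕ ω))) (allFin X)
        ∔ tally-1 (allFin X) ∔ Listₚ.length-tabulate {n = X} (λ i → i)
        where complement : ∀ b → fromBool b + fromBool (not b) ≡ 1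
              complement true  = refl
              complement false = refl
      often : X ≤ suc q * hits
      often = ≤-trans (hits-often n K X (ball v r) n≤X (n≤4√n² n>0) big) (≤-reflexive (cong₂ _*_ (sym 8K≡)
        (sumTo-cong X (λ ω _ → cong (fromBool ∘ ball v r) (sym (rem-% n ω)))
          ∔ sym (tally-tabulate X (λ ω → fromBool (hit v r (toℕ ω))) (λ i → i) _ (λ _ → refl)))))

    event-rare : ∀ v r → n * (n * n ^ a) * tally (event v r) (allTapes w T) ≤ X ^ T
    event-rare v r = split (K ≤ᵇ count (ball v r) n) (≤ᵇ⇒≤ K _)
      where
      split : ∀ b → (IsTrue b → K ≤ count (ball v r) n) →
        n * (n * n ^ a) * tally (λ ωs → fromBool (b ∧ avoids (hit v r) s (trace P σ ωs)))
            (allTapes w T) ≤ X ^ T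
      split false _   = ≤-trans (≤-reflexive (cong (n * (n * n ^ a) *_) (tally-0 (allTapes w T)) ∔
          *-zeroʳ (n * (n * n ^ a)))) z≤n
      split true  big = ≤-trans (*-monoˡ-≤ (S.failures T s σ) n^≤)
        (amplify q ((2 + a) * ℓ) q>0 (subst (λ z → suc q ^ z * S.failures T s σ ≤ q ^ z * X ^ T) s≡
            (S.bound-failures T s σ)))
        where
        module S = Sampling P w (hit v r) q (rare v r (big tt))
        q>0 : 0 < q
        q>0 = s≤s⁻¹ (≤-trans (≤-trans (s≤s (s≤s z≤n)) (*-monoʳ-≤ 8 (√-positive n>0)))
            (≤-reflexive (sym 8K≡)))
        n^≤ : n * (n * n ^ a) ≤ 2 ^ ((2 + a) * ℓ)
        n^≤ = ≤-trans (^-monoˡ-≤ (2 + a) (n≤2^⌈log₂n⌉ n))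
          (≤-reflexive (^-*-assoc 2 ℓ (2 + a) ∔ cong (2 ^_) (*-comm ℓ (2 + a))))
        -- The sample consists of `(2 + a) * ℓ` blocks of `8 * K = suc q` words, one block for each
        -- halving. This dictates `A = 8 * (2 + a)`.
        s≡ : s ≡ suc q * ((2 + a) * ℓ)
        s≡ = cong (λ z → z * ℓ * K) A≡ ∔ regroup (2 + a) ℓ K ∔ cong (_* ((2 + a) * ℓ)) (sym 8K≡)
          where regroup : ∀ b l k → 8 * b * l * k ≡ 8 * k * (b * l)
                regroup = solve-∀

    -- Both sides are scaled by `n * n`: each of the `n * n` events is rare by the factor
    -- `n * (n * n ^ a)`, so cancelling leaves `n ^ a`.
    correct : ∀ R → IsSourceRadius G R → FailsWithProbability≤1/ {w} {T} (n ^ a) (outputs2Approx? P σ R)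
    correct R isR = *-cancelˡ-≤ n (*-cancelˡ-≤ n (≤-trans
        (*-monoʳ-≤ n (*-monoʳ-≤ n (*-monoʳ-≤ (n ^ a)
            (≤-trans (filter-tally (∁? (outputs2Approx? P σ R)) union covered tapes)
          (≤-reflexive (tally-sumTo (λ v ωs → sumTo (λ r → event v r ωs) n) n tapes
            ∔ sumTo-cong n λ v _ → tally-sumTo (event v) n tapes))))))
        (≤-trans (≤-reflexive (regroup n (n ^ a) _))
          (≤-trans (sumTo-bounded (n * (n * n ^ a)) (n * X ^ T)
              (λ v → sumTo (λ r → tally (event v r) tapes) n) n
              λ v _ → sumTo-bounded (n * (n * n ^ a)) (X ^ T) (λ r → tally (event v r) tapes) n λ r
                  _ → event-rare v r)
            (≤-reflexive (cong (λ z → n * (n * z)) (sym (length-tapes w T))))))))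
      where
      tapes = allTapes w T
      union : Vec (Word w) T → ℕ
      union ωs = sumTo (λ v → sumTo (λ r → event v r ωs) n) n
      regroup : ∀ n p t → n * (n * (p * t)) ≡ n * (n * p) * t
      regroup = solve-∀
      covered : ∀ ωs → ¬ Outputs2Approx P σ R ωs → 0 < union ωs
      covered ωs ¬q = let x , h , post = outcome ωs in
        case post⇒approximates R isR (toℕ x) (trace P σ ωs ʳ++ []) post of λ
          { (inj₁ approx) → contradiction (subst (Any (λ x → 2-Approximates R (decode (toℕ x))))
              (sym h) (just approx)) ¬q
          ; (inj₂ u) → unlucky⇒event ωs u }

-- 133 is `5 + 8 * 16`: the prologue and epilogue, and 16 units of cost outside `workC`.
time-arith : ∀ q z → 5 + (11 + ((2 + q * (4 * (1 + z))) + (2 + 1))) * 8 ≤ (133 + 8 * (q * 4)) * (1 + z)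
time-arith q z = ≤-trans (m≤m+n _ (133 * z)) (≤-reflexive (regroup q z))
  where regroup : ∀ q z → 5 + (11 + ((2 + q * (4 * (1 + z))) + (2 + 1))) * 8 + 133 * z ≡ (133 + 8 * (q * 4)) * (1 + z)
        regroup = solve-∀

-- The sample has A ⌈log₂ n⌉ K elements at least.  As 8 K of them miss a large ball with probability
-- at most 1 / 2, all of them do so with probability at most 1 / n ^ (2 + a), and the union bound over
-- n² balls leaves 1 / n ^ a.  The constants are variables because their unfoldings are too large to
-- compute with.
module Main (a A q C D : ℕ) (A≡ : A ≡ 8 * (2 + a)) (q≡ : q ≡ 245 + 94 * A) (C≡ : C ≡ 133 + 8 * (q * 4))
  (D≡ : D ≡ 16 * (5 + 2 * A + 2 * C)) (n m : ℕ) .{{_ : NonZero n}} (G : Digraph n m) where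

  P : Program
  P = program (mainC A) best

  n>0 : 0 < n
  n>0 = >-nonZero⁻¹ n

  K ℓ w Z T : ℕ
  K = ⌊√ n ⌋
  ℓ = ⌈log₂ n ⌉
  -- The successor keeps words nonempty for `n = 1`, where `ℓ` is 0.
  w = (D + 5) * suc ℓ
  Z = m * K * ℓ ^ 2
  T = C * suc Z

  maxL-ok : ∀ L → 2 ^ L ≤ 2 * n → L ≤ suc ℓ
  maxL-ok L p = ≤-trans (⌈log₂⌉-least′ L) (≤-trans (⌈log₂⌉-mono-≤ p) (≤-reflexive (⌈log₂2*n⌉≡1+⌈log₂n⌉ n)))
    where ⌈log₂⌉-least′ : ∀ L → L ≤ ⌈log₂ 2 ^ L ⌉
          ⌈log₂⌉-least′ L = ≤-reflexive (sym (⌈log₂2^n⌉≡n L))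

  open Encoding G
  open Correctness A n m (input G) n>0 source< target< refl refl (suc ℓ) maxL-ok hiding (K)
  open Radius G A n>0 (suc ℓ) maxL-ok

  κ : ℕ
  κ = q * (4 * suc Z)

  work≤κ : n ≤ suc m → workCost ≤ κ
  work≤κ n≤ = subst (λ z → workCost ≤ z * (4 * suc Z)) (sym q≡) (≤-trans
    (Budget.work≤ A n m (suc ℓ) K n≤ (s≤s z≤n) (√-positive n>0) {input G} {n>0} {source<} {target<}
        {refl} {refl} {maxL-ok} refl)
    (*-monoʳ-≤ (245 + 94 * A) (product≤ n m n>0 m≤n² n≤)))

  time≤ : 5 + (11 + ((2 + κ) + (2 + 1))) * 8 ≤ T
  time≤ = subst (λ z → 5 + (11 + ((2 + κ) + (2 + 1))) * 8 ≤ z * suc Z) (sym C≡) (time-arith q Z)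

  n²≤bound : n * n ≤ bound
  n²≤bound = ≤-trans (≤-reflexive (sym (*-identityˡ (n * n)))) (n²≤ 1 (s≤s z≤n))

  module R = Run G (mainC A) best (valid-mainC A) w bound (bound + T) Post
    (≤-trans (fits-width A C n m n>0 m≤n²) (≤-trans (≤-reflexive (cong (_* n ^ 5) (sym D≡)))
        (width D n n>0)))
    (input≤ (≤-trans n≤n² n²≤bound) (≤-trans m≤n² n²≤bound))
    {T} {11 + ((2 + κ) + (2 + 1))} ≤-refl time≤

  outcome : (ωs : Vec (Word w) T) →
    ∃[ x ] run P (initial w G) ωs ≡ just x × Post (toℕ x) (trace P (initial w G) ωs ʳ++ [])
  outcome ωs = Machine.Res.output r , Machine.Res.halts r , Machine.Res.post r
    where r = R.run-program (mainE κ work≤κ) ωs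

  n≤X : n ≤ 2 ^ w
  n≤X = ≤-trans (n≤2^⌈log₂n⌉ n) (^-monoʳ-≤ 2 (≤-trans (n≤1+n ℓ)
      (m≤n*m (suc ℓ) (D + 5) {{>-nonZero (m≤n⇒m≤o+n D (s≤s z≤n))}})))

  open Success a A n m A≡ G n>0 (suc ℓ) maxL-ok P w T n≤X
  open Analysed outcome public using (halts; correct)

correctness : ∀ a A q C D → A ≡ 8 * (2 + a) → q ≡ 245 + 94 * A → C ≡ 133 + 8 * (q * 4) →
  D ≡ 16 * (5 + 2 * A + 2 * C) → ∀ n m .{{_ : NonZero n}} (G : Digraph n m) →
  let w = (D + 5) * suc ⌈log₂ n ⌉
      T = C * suc (m * ⌊√ n ⌋ * ⌈log₂ n ⌉ ^ 2)
      P = program (mainC A) best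
  in (∀ (ωs : Vec (Word w) T) → Is-just (run P (initial w G) ωs))
     × (∀ (R : ℕ ⁺) → IsSourceRadius G R →
          FailsWithProbability≤1/ {w} {T} (n ^ a) (outputs2Approx? P (initial w G) R))
correctness a A q C D A≡ q≡ C≡ D≡ n m G = M.halts , M.correct
  where module M = Main a A q C D A≡ q≡ C≡ D≡ n m G

theorem1p3 : ∀ (a : ℕ) →
    ∃[ P ] ∃[ c ] ∃[ C ]
    (∀ (n m : ℕ) .{{_ : NonZero n}} (G : Digraph n m) →
      let w = c * suc ⌈log₂ n ⌉
          T = C * suc (m * ⌊√ n ⌋ * ⌈log₂ n ⌉ ^ 2)
      in (∀ (ωs : Vec (Word w) T) → Is-just (run P (initial w G) ωs))
         × (∀ (R : ℕ ⁺) → IsSourceRadius G R →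
              FailsWithProbability≤1/ {w} {T} (n ^ a)
                (outputs2Approx? P (initial w G) R)))
theorem1p3 a = program (mainC A) best , D + 5 , C , correctness a A q C D refl refl refl refl
  where
  A q C D : ℕ
  A = 8 * (2 + a)
  q = 245 + 94 * A
  C = 133 + 8 * (q * 4)
  D = 16 * (5 + 2 * A + 2 * C)
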